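{- There is an algorithm that, given as input a connected graph $G$ with $n$ vertices and $m$ edges, runs in time $O(n^2m)$ and outputs a 2-join of $G$, or certifies that $G$ has no 2-join.
   Context: Graphs are finite, simple and undirected. A partition $(X_1,X_2)$ of the vertex set of a graph $G$ is a \emph{2-join} if for $i=1,2$ there exist disjoint non-empty sets $A_i,B_i\subseteq X_i$ such that: every vertex of $A_1$ is adjacent to every vertex of $A_2$, every vertex of $B_1$ is adjacent to every vertex of $B_2$, and there are no other edges between $X_1$ and $X_2$; and $|X_i|\ge 3$ for $i=1,2$. -}

module Defs where

open import Data.Bool.Base using (Bool; true; false; T; if_then_else_)
open import Data.Bool.Properties using (T?)
open import Data.Fin.Base using (Fin; toℕ; fromℕ<; remQuot)
open import Data.Fin.Properties using () renaming (_<?_ to _<ᶠ?_)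
open import Data.Fin.Subset using (Subset; _∈_; _⊆_; _∩_; _∪_; ∣_∣; Empty; Nonempty; ⊤)
open import Data.List.Base using (List; length; filter; cartesianProduct; allFin)
open import Data.Nat.Base using (ℕ; zero; suc; _+_; _*_; _∸_; _<_; _≤_; _≡ᵇ_; _<ᵇ_)
open import Data.Nat.Properties using (_<?_)
open import Data.Product.Base using (_×_; _,_; uncurry)
open import Data.Sum.Base using (_⊎_)
open import Data.Vec.Base using (tabulate)
open import Relation.Binary.Construct.Closure.ReflexiveTransitive using (Star)
open import Relation.Binary.PropositionalEquality using (_≡_)
open import Relation.Nullary.Decidable using (yes; no; _×-dec_)
open import Relation.Nullary.Negation using (¬_)

record Graph (n : ℕ) : Set where
  field
    adj    : Fin n → Fin n → Bool
    sym    : ∀ u v → adj u v ≡ adj v u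
    irrefl : ∀ v → adj v v ≡ false

open Graph public using (adj)

Adjacent : ∀ {n} → Graph n → Fin n → Fin n → Set
Adjacent G u v = T (adj G u v)

Connected : ∀ {n} → Graph n → Set
Connected G = ∀ u v → Star (Adjacent G) u v

-- Every edge is listed once, as the pair (u , v) with u < v.
edges : ∀ {n} → Graph n → List (Fin n × Fin n)
edges {n} G =
  filter (λ (u , v) → (u <ᶠ? v) ×-dec T? (adj G u v))
         (cartesianProduct (allFin n) (allFin n))

∣E_∣ : ∀ {n} → Graph n → ℕ
∣E G ∣ = length (edges G)

record Is2Join {n} (G : Graph n) (X₁ X₂ : Subset n) : Set where
  field
    X-disjoint  : Empty (X₁ ∩ X₂)
    X-cover     : X₁ ∪ X₂ ≡ ⊤
    A₁ B₁ A₂ B₂ : Subset n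
    A₁⊆X₁       : A₁ ⊆ X₁
    B₁⊆X₁       : B₁ ⊆ X₁
    A₂⊆X₂       : A₂ ⊆ X₂
    B₂⊆X₂       : B₂ ⊆ X₂
    A₁-nonempty : Nonempty A₁
    B₁-nonempty : Nonempty B₁
    A₂-nonempty : Nonempty A₂
    B₂-nonempty : Nonempty B₂
    A₁B₁-disjoint : Empty (A₁ ∩ B₁)
    A₂B₂-disjoint : Empty (A₂ ∩ B₂)
    A-complete  : ∀ u v → u ∈ A₁ → v ∈ A₂ → Adjacent G u v
    B-complete  : ∀ u v → u ∈ B₁ → v ∈ B₂ → Adjacent G u v
    no-others   : ∀ u v → u ∈ X₁ → v ∈ X₂ → Adjacent G u v →
                  (u ∈ A₁ × v ∈ A₂) ⊎ (u ∈ B₁ × v ∈ B₂)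
    3≤∣X₁∣      : 3 ≤ ∣ X₁ ∣
    3≤∣X₂∣      : 3 ≤ ∣ X₂ ∣

-- A word RAM with structured control flow.
--
-- Registers and arrays are named by numerals fixed in the program text, so
-- a program uses a constant number of each; only array indices are computed
-- at run time.  Expressions do not nest, so each instruction does a bounded
-- amount of work.

record State : Set where
  constructor ⟪_,_⟫
  field
    reg : ℕ → ℕ
    arr : ℕ → ℕ → ℕ

open State public

data Atom : Set where
  lit : ℕ → Atom
  var : ℕ → Atom

data Expr : Set where
  atom           : Atom → Expr
  _⊕_ _⊖_ _⊗_    : Atom → Atom → Expr
  load_at_       : ℕ → Atom → Expr

data Test : Set where
  _≐_ _≺_ : Atom → Atom → Test

infix  6 _⊕_ _⊖_ _⊗_ load_at_
infix  5 _≔_ store_at_value_ _≐_ _≺_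
infixr 4 _⨾_
infix  3 _⊢_,_⇓_∥_

data Prog : Set where
  skip            : Prog
  _≔_             : ℕ → Expr → Prog
  store_at_value_ : ℕ → Atom → Atom → Prog
  _⨾_             : Prog → Prog → Prog
  cond            : Test → Prog → Prog → Prog
  while           : Test → Prog → Prog

⟦_⟧ᵃ : Atom → State → ℕ
⟦ lit k ⟧ᵃ s = k
⟦ var x ⟧ᵃ s = reg s x

⟦_⟧ᵉ : Expr → State → ℕ
⟦ atom a      ⟧ᵉ s = ⟦ a ⟧ᵃ s
⟦ a ⊕ b       ⟧ᵉ s = ⟦ a ⟧ᵃ s + ⟦ b ⟧ᵃ s
⟦ a ⊖ b       ⟧ᵉ s = ⟦ a ⟧ᵃ s ∸ ⟦ b ⟧ᵃ s
⟦ a ⊗ b       ⟧ᵉ s = ⟦ a ⟧ᵃ s * ⟦ b ⟧ᵃ s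
⟦ load r at a ⟧ᵉ s = arr s r (⟦ a ⟧ᵃ s)

⟦_⟧ᵗ : Test → State → Bool
⟦ a ≐ b ⟧ᵗ s = ⟦ a ⟧ᵃ s ≡ᵇ ⟦ b ⟧ᵃ s
⟦ a ≺ b ⟧ᵗ s = ⟦ a ⟧ᵃ s <ᵇ ⟦ b ⟧ᵃ s

update : {A : Set} → (ℕ → A) → ℕ → A → (ℕ → A)
update f x a y = if x ≡ᵇ y then a else f y

setReg : State → ℕ → ℕ → State
setReg s x w = ⟪ update (reg s) x w , arr s ⟫

setArr : State → ℕ → ℕ → ℕ → State
setArr s r i w = ⟪ reg s , update (arr s) r (update (arr s r) i w) ⟫

-- W ⊢ p , s ⇓ s′ ∥ t : with words ranging over 0 … W - 1, the program p
-- started in s halts in s′ after exactly t elementary steps.  A program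
-- that tries to write a value not fitting in a word is stuck, so large
-- numbers cannot be used to pack work into a single step.
data _⊢_,_⇓_∥_ (W : ℕ) : Prog → State → State → ℕ → Set where

  ⇓skip   : ∀ {s} → W ⊢ skip , s ⇓ s ∥ 1

  ⇓assign : ∀ {s x e} → ⟦ e ⟧ᵉ s < W →
            W ⊢ x ≔ e , s ⇓ setReg s x (⟦ e ⟧ᵉ s) ∥ 1

  ⇓store  : ∀ {s r a b} → ⟦ b ⟧ᵃ s < W →
            W ⊢ store r at a value b , s ⇓ setArr s r (⟦ a ⟧ᵃ s) (⟦ b ⟧ᵃ s) ∥ 1

  ⇓seq    : ∀ {s s′ s″ p q t t′} →
            W ⊢ p , s ⇓ s′ ∥ t → W ⊢ q , s′ ⇓ s″ ∥ t′ →
            W ⊢ p ⨾ q , s ⇓ s″ ∥ (t + t′)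

  ⇓true   : ∀ {s s′ b p q t} → ⟦ b ⟧ᵗ s ≡ true →
            W ⊢ p , s ⇓ s′ ∥ t →
            W ⊢ cond b p q , s ⇓ s′ ∥ suc t

  ⇓false  : ∀ {s s′ b p q t} → ⟦ b ⟧ᵗ s ≡ false →
            W ⊢ q , s ⇓ s′ ∥ t →
            W ⊢ cond b p q , s ⇓ s′ ∥ suc t

  ⇓stop   : ∀ {s b p} → ⟦ b ⟧ᵗ s ≡ false →
            W ⊢ while b p , s ⇓ s ∥ 1

  ⇓loop   : ∀ {s s′ s″ b p t t′} → ⟦ b ⟧ᵗ s ≡ true →
            W ⊢ p , s ⇓ s′ ∥ t → W ⊢ while b p , s′ ⇓ s″ ∥ t′ →
            W ⊢ while b p , s ⇓ s″ ∥ suc (t + t′)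

bit : Bool → ℕ
bit b = if b then 1 else 0

-- Row-major adjacency matrix: the entry of (u , v) is at u * n + v.
matrix : ∀ {n} → Graph n → ℕ → ℕ
matrix {n} G i with i <? n * n
... | yes i<n² = bit (uncurry (adj G) (remQuot n (fromℕ< i<n²)))
... | no  _    = 0

-- Register 0 holds n, array 0 holds the adjacency matrix, and everything
-- else is zero.
input : ∀ {n} → Graph n → State
input {n} G = ⟪ (λ { zero → n ; (suc _) → 0 })
              , (λ { zero → matrix G ; (suc _) → λ _ → 0 }) ⟫

-- The vertices labelled k in array 1.
labelled : ∀ n → State → ℕ → Subset n
labelled n s k = tabulate λ v → arr s 1 (toℕ v) ≡ᵇ k

-- The answer is read from register 0: 1 means that the labels 1 and 2 in
-- array 1 give a 2-join, 0 that there is none.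
CorrectAnswer : ∀ {n} → Graph n → State → Set
CorrectAnswer {n} G s =
    (reg s 0 ≡ 1 × Is2Join G (labelled n s 1) (labelled n s 2))
  ⊎ (reg s 0 ≡ 0 × (∀ X₁ X₂ → ¬ Is2Join G X₁ X₂))

{-# OPTIONS --safe #-}
module Submission where

-- If a₁a₂ and b₁b₂ are edges, with a₁ and b₁ on one side, then membership of a vertex in A₁, B₁
-- (resp. A₂, B₂) can be read off its adjacency to a₂, b₂ (resp. a₁, b₁). The 2-joins using these
-- edges therefore correspond to the sets containing a₁, b₁, avoiding a₂, b₂ and closed under the
-- implication "u inside forces v inside" whenever u and v, placed on opposite sides, would violate
-- these labels. Guessing a further vertex c of the first side, it is enough to test the smallest
-- closed set containing a₁, b₁, c. It is computed in time O(n + m) by a graph search that also keeps,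
-- for each label, a list of the unvisited vertices carrying it: processing u replaces the list of its
-- label by neighbours of u, so the total list length pays for the scans.
--
-- O(n²) pairs of edges suffice. Let p be the parent function of a breadth-first tree whose root lies
-- in X₁, let x be a vertex of X₂ closest to the root, and let (p x, x) be an A-edge. If no tree edge is
-- a B-edge, then either a spanning forest of G − N(x), which contains no A-edge, contains a B-edge, or
-- all of B₂ is adjacent to x. In the latter case, for b₂ in B₂, p b₂ is in A₂ and p (p b₂) is in A₁.

open import Defs
open import Data.Bool.Base using (Bool; true; false; T; not; _∧_; _∨_; if_then_else_)
open import Data.Bool.Properties using (T?; ∨-comm) renaming (_≟_ to _≟ᵇ_)
open import Data.Empty using (⊥; ⊥-elim)
open import Data.Fin.Base using (Fin; zero; suc; toℕ; fromℕ<; combine; remQuot)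
open import Data.Fin.Properties using (any?; pigeonhole; remQuot-combine; toℕ-combine; toℕ-fromℕ<; toℕ-injective; toℕ<n)
  renaming (_<?_ to _<ᶠ?_)
open import Data.Fin.Subset using (Subset; _∈_; _⊆_; _∪_; ∣_∣; Nonempty)
open import Data.Fin.Subset.Properties using (x∈p∩q⁻; x∈p∩q⁺; x∈p∪q⁻; x∈p∪q⁺; ∈⊤; ⊆⊤; ⊆-antisym)
open import Data.List.Base as List using (_++_; length; filter; cartesianProduct)
open import Data.List.Properties using (filter-++; length-++)
open import Data.Nat.Base
open import Data.Nat.Induction using (<-wellFounded)
open import Data.Nat.Properties
open import Data.Nat.Tactic.RingSolver using (solve-∀)
open import Data.Product.Base using (_×_; _,_; ∃-syntax; proj₁; proj₂; uncurry)
open import Data.Sum.Base using (_⊎_; inj₁; inj₂)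
open import Data.Unit.Base using (⊤; tt)
open import Data.Vec.Base using ([]; _∷_; lookup; tabulate)
open import Data.Vec.Properties using ([]=⇒lookup; lookup⇒[]=; lookup∘tabulate; tabulate-cong)
open import Function.Base using (_∘_; id)
open import Induction.WellFounded using (Acc; acc)
open import Relation.Binary.Construct.Closure.ReflexiveTransitive using (Star; ε; _◅_)
open import Relation.Binary.Definitions using (tri<; tri≈; tri>)
open import Relation.Binary.PropositionalEquality hiding (J)
open import Relation.Nullary.Decidable using (Dec; yes; no; does; ¬?; _×-dec_)
open import Relation.Nullary.Negation using (¬_)

-- Program logic with running times

-- For fixed edges and `c`, the smallest closed set lies in the first side of every 2-join that uses
-- them. Replacing that side by it can only enlarge the second side, so testing this one set decides
-- the matter; `c` is there to make the first side large enough. Trying every `c` would cost a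
-- factor n. Instead n ≤ 5 is answered directly, and for n > 5 one of the vertices 0, ..., 4 differs
-- from the four edge ends. Its side is unknown, so each tuple is tried again with the sides
-- exchanged: ten closures per tuple, five tuples per pair (x, y).
--
-- Forests may be grown naively in time O(n²), by repeated selection of a least key, because only n
-- + 1 of them are built. Connectedness gives n ≤ 2m, which absorbs both n³ and n²(n + m) into
-- O(n²m); it also makes the root of the tree unique.
--
-- Every value written has to fit in a word and every step is counted, so the program logic carries
-- a time budget and a bound on stored words. What a subprogram leaves untouched is read off its
-- text, which keeps large symbolic states out of the invariants.

update-same : ∀ {A : Set} (f : ℕ → A) i w → update f i w i ≡ w
update-same f zero    w = refl
update-same f (suc i) w = update-same (f ∘ suc) i w

update-other : ∀ {A : Set} (f : ℕ → A) i w j → i ≢ j → update f i w j ≡ f j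
update-other f zero    w zero    i≢j with () ← i≢j refl
update-other f zero    w (suc j) i≢j = refl
update-other f (suc i) w zero    i≢j = refl
update-other f (suc i) w (suc j) i≢j = update-other (f ∘ suc) i w j (i≢j ∘ cong suc)

update-skip : ∀ {A : Set} (f : ℕ → A) i w j → (i ≡ᵇ j) ≡ false → update f i w j ≡ f j
update-skip f i w j eq = cong (if_then w else f j) eq

update-all : ∀ {A : Set} (P : A → Set) (f : ℕ → A) i w → P w → (∀ j → P (f j)) → ∀ j → P (update f i w j)
update-all P f i w pw pf j with i ≡ᵇ j
... | true  = pw
... | false = pf j

≡ᵇ-true : ∀ {a b} → (a ≡ᵇ b) ≡ true → a ≡ b
≡ᵇ-true {a} {b} eq = ≡ᵇ⇒≡ a b (subst T (sym eq) tt)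

≡⇒≡ᵇ-true : ∀ {a b} → a ≡ b → (a ≡ᵇ b) ≡ true
≡⇒≡ᵇ-true {zero}  refl = refl
≡⇒≡ᵇ-true {suc a} refl = ≡⇒≡ᵇ-true {a} refl

≡ᵇ-false : ∀ {a b} → (a ≡ᵇ b) ≡ false → a ≢ b
≡ᵇ-false {a} eq a≡b with () ← trans (sym eq) (≡⇒≡ᵇ-true a≡b)

≢⇒≡ᵇ-false : ∀ {a b} → a ≢ b → (a ≡ᵇ b) ≡ false
≢⇒≡ᵇ-false {a} {b} a≢b with a ≡ᵇ b in eq
... | true  with () ← a≢b (≡ᵇ-true eq)
... | false = refl

<ᵇ-true : ∀ {a b} → (a <ᵇ b) ≡ true → a < b
<ᵇ-true {a} {b} eq = <ᵇ⇒< a b (subst T (sym eq) tt)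

<ᵇ-false : ∀ {a b} → (a <ᵇ b) ≡ false → b ≤ a
<ᵇ-false {a} {b} eq = ≮⇒≥ λ a<b → subst T eq (<⇒<ᵇ a<b)

writesReg : Prog → ℕ → Bool
writesReg skip                   x = false
writesReg (y ≔ e)                x = y ≡ᵇ x
writesReg (store r at a value b) x = false
writesReg (p ⨾ q)                x = writesReg p x ∨ writesReg q x
writesReg (cond b p q)           x = writesReg p x ∨ writesReg q x
writesReg (while b p)            x = writesReg p x

writesArr : Prog → ℕ → Bool
writesArr skip                   x = false
writesArr (y ≔ e)                x = false
writesArr (store r at a value b) x = r ≡ᵇ x
writesArr (p ⨾ q)                x = writesArr p x ∨ writesArr q x
writesArr (cond b p q)           x = writesArr p x ∨ writesArr q x
writesArr (while b p)            x = writesArr p x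

∨-falseˡ : ∀ {a b} → a ∨ b ≡ false → a ≡ false
∨-falseˡ {false} _ = refl

∨-falseʳ : ∀ {a b} → a ∨ b ≡ false → b ≡ false
∨-falseʳ {false} eq = eq

-- For a concrete program these reduce to the unit type. As implicit arguments of `keep-graph` and
-- its relatives they are then filled in by eta.
NotReg NotArr : Prog → ℕ → Set
NotReg p x = T (not (writesReg p x))
NotArr p r = T (not (writesArr p r))

T-not : ∀ {b} → T (not b) → b ≡ false
T-not {false} _ = refl

-- A store returns the other array functions themselves, so arrays are compared as functions here
-- and invariants can be transported by rewriting.
record Frame (p : Prog) (s s′ : State) : Set where
  constructor frame
  field
    regF : ∀ x → writesReg p x ≡ false → reg s′ x ≡ reg s x
    arrF : ∀ r → writesArr p r ≡ false → arr s′ r ≡ arr s r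
open Frame public

Frame-refl : ∀ {p s} → Frame p s s
Frame-refl = frame (λ _ _ → refl) (λ _ _ → refl)

Frame-trans : ∀ {p s s′ s″} → Frame p s s′ → Frame p s′ s″ → Frame p s s″
Frame-trans f g = frame (λ x w → trans (regF g x w) (regF f x w))
                        (λ r w → trans (arrF g r w) (arrF f r w))

⇓-frame : ∀ {W p s s′ t} → W ⊢ p , s ⇓ s′ ∥ t → Frame p s s′
⇓-frame ⇓skip = Frame-refl
⇓-frame {s = s} (⇓assign {x = x} {e} _) =
  frame (λ y w → update-skip (reg s) x (⟦ e ⟧ᵉ s) y w) (λ _ _ → refl)
⇓-frame {s = s} (⇓store {r = r} _) =
  frame (λ _ _ → refl) (λ r′ w → update-skip (arr s) r _ r′ w)
⇓-frame (⇓seq {p = p} d e) with ⇓-frame d | ⇓-frame e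
... | f | g = frame
  (λ x w → trans (regF g x (∨-falseʳ {writesReg p x} w)) (regF f x (∨-falseˡ w)))
  (λ r w → trans (arrF g r (∨-falseʳ {writesArr p r} w)) (arrF f r (∨-falseˡ w)))
⇓-frame (⇓true _ d) with ⇓-frame d
... | f = frame (λ x w → regF f x (∨-falseˡ w)) (λ r w → arrF f r (∨-falseˡ w))
⇓-frame (⇓false {p = p} _ d) with ⇓-frame d
... | f = frame (λ x w → regF f x (∨-falseʳ {writesReg p x} w)) (λ r w → arrF f r (∨-falseʳ {writesArr p r} w))
⇓-frame (⇓stop _) = Frame-refl
⇓-frame (⇓loop _ d e) with ⇓-frame d | ⇓-frame e
... | f | g = frame (λ x w → trans (regF g x w) (regF f x w))
                    (λ r w → trans (arrF g r w) (arrF f r w))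

record Small (W : ℕ) (s : State) : Set where
  constructor small
  field
    regS : ∀ x → reg s x < W
    arrS : ∀ r i → arr s r i < W
open Small public

⇓-small : ∀ {W p s s′ t} → W ⊢ p , s ⇓ s′ ∥ t → Small W s → Small W s′
⇓-small ⇓skip sm = sm
⇓-small {W} {s = s} (⇓assign {x = x} v<W) sm =
  small (update-all (_< W) (reg s) x _ v<W (regS sm)) (arrS sm)
⇓-small {W} {s = s} (⇓store {r = r} {a = a} v<W) sm =
  small (regS sm)
        (update-all (λ f → ∀ i → f i < W) (arr s) r _
          (update-all (_< W) (arr s r) (⟦ a ⟧ᵃ s) _ v<W (arrS sm r)) (arrS sm))
⇓-small (⇓seq d e)    sm = ⇓-small e (⇓-small d sm)
⇓-small (⇓true _ d)   sm = ⇓-small d sm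
⇓-small (⇓false _ d)  sm = ⇓-small d sm
⇓-small (⇓stop _)     sm = sm
⇓-small (⇓loop _ d e) sm = ⇓-small e (⇓-small d sm)

for : ℕ → Atom → Prog → Prog
for x hi p = x ≔ atom (lit 0) ⨾ while (var x ≺ hi) (p ⨾ x ≔ var x ⊕ lit 1)

module Logic (W : ℕ) (9≤W : 9 ≤ W) where

  FitsAtom : Atom → Set
  FitsAtom (lit k) = T (k <ᵇ 9)
  FitsAtom (var _) = ⊤

  -- Only sums and products can overflow. A load, a copy or a truncated difference is bounded by a
  -- stored word or a literal, and literals below 9 fit by `9≤W`.
  Fits : Expr → ℕ → Set
  Fits (atom a)      v = FitsAtom a
  Fits (a ⊕ b)       v = v < W
  Fits (a ⊖ b)       v = FitsAtom a
  Fits (a ⊗ b)       v = v < W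
  Fits (load r at a) v = ⊤

  fitsAtom : ∀ {s} → Small W s → ∀ a → FitsAtom a → ⟦ a ⟧ᵃ s < W
  fitsAtom sm (lit k) k<9 = <-≤-trans (<ᵇ⇒< k 9 k<9) 9≤W
  fitsAtom sm (var x) _   = regS sm x

  fits : ∀ {s} → Small W s → ∀ e → Fits e (⟦ e ⟧ᵉ s) → ⟦ e ⟧ᵉ s < W
  fits sm (atom a)         f = fitsAtom sm a f
  fits sm (a ⊕ b)          f = f
  fits {s} sm (a ⊖ b)      f = ≤-<-trans (m∸n≤m _ (⟦ b ⟧ᵃ s)) (fitsAtom sm a f)
  fits sm (a ⊗ b)          f = f
  fits {s} sm (load r at a) f = arrS sm r (⟦ a ⟧ᵃ s)

  -- Smallness of the start state is assumed inside `Run`, so the rules compose without passing it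
  -- along.
  Run : Prog → State → ℕ → (State → Set) → Set
  Run p s B P = Small W s →
    ∃[ s′ ] ∃[ t ] ((W ⊢ p , s ⇓ s′ ∥ t) × t ≤ B × P s′)

  weaken : ∀ {p s B B′ P Q} → B ≤ B′ → (∀ s′ → Frame p s s′ → Small W s′ → P s′ → Q s′) → Run p s B P → Run p s B′ Q
  weaken B≤ P⇒Q r sm with r sm
  ... | s′ , t , d , t≤B , Ps = s′ , t , d , ≤-trans t≤B B≤ , P⇒Q s′ (⇓-frame d) (⇓-small d sm) Ps

  within : ∀ {p s B B′ P} → B ≤ B′ → Run p s B P → Run p s B′ P
  within B≤ = weaken B≤ λ _ _ _ → id

  skipR : ∀ {s B P} → P s → Run skip s (suc B) P
  skipR Ps sm = _ , 1 , ⇓skip , s≤s z≤n , Ps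

  -- The new value is named explicitly: nested symbolic states would otherwise grow exponentially.
  assignR : ∀ {x e s B P} v → ⟦ e ⟧ᵉ s ≡ v → Fits e v → P (setReg s x v) → Run (x ≔ e) s (suc B) P
  assignR {e = e} v refl f Ps sm = _ , 1 , ⇓assign (fits sm e f) , s≤s z≤n , Ps

  storeR : ∀ {r a b s B P} i v → ⟦ a ⟧ᵃ s ≡ i → ⟦ b ⟧ᵃ s ≡ v → FitsAtom b → P (setArr s r i v) →
           Run (store r at a value b) s (suc B) P
  storeR {b = b} i v refl refl f Ps sm = _ , 1 , ⇓store (fitsAtom sm b f) , s≤s z≤n , Ps

  seqR : ∀ {p q s B B′ P} → Run p s B (λ s′ → Run q s′ B′ P) → Run (p ⨾ q) s (B + B′) P
  seqR r sm with r sm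
  ... | s′ , t , d , t≤ , r′ with r′ (⇓-small d sm)
  ... | s″ , t′ , d′ , t′≤ , Ps = s″ , t + t′ , ⇓seq d d′ , +-mono-≤ t≤ t′≤ , Ps

  set : ∀ {x e q s B P} v → ⟦ e ⟧ᵉ s ≡ v → Fits e v → Run q (setReg s x v) B P → Run ((x ≔ e) ⨾ q) s (suc B) P
  set v eq f r = seqR {B = 1} (assignR v eq f r)

  put : ∀ {r a b q s B P} i v → ⟦ a ⟧ᵃ s ≡ i → ⟦ b ⟧ᵃ s ≡ v → FitsAtom b → Run q (setArr s r i v) B P →
        Run ((store r at a value b) ⨾ q) s (suc B) P
  put i v eq eq′ f r = seqR {B = 1} (storeR i v eq eq′ f r)

  condR : ∀ {b p q s B P} → (⟦ b ⟧ᵗ s ≡ true → Run p s B P) → (⟦ b ⟧ᵗ s ≡ false → Run q s B P) →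
          Run (cond b p q) s (suc B) P
  condR {b} {p} {q} {s} {B} {P} rt rf sm = go (⟦ b ⟧ᵗ s) refl
    where
    go : ∀ v → ⟦ b ⟧ᵗ s ≡ v → ∃[ s′ ] ∃[ t ] ((W ⊢ cond b p q , s ⇓ s′ ∥ t) × t ≤ suc B × P s′)
    go true  eq = let (s′ , t , d , t≤ , Ps) = rt eq sm in s′ , suc t , ⇓true eq d , s≤s t≤ , Ps
    go false eq = let (s′ , t , d , t≤ , Ps) = rf eq sm in s′ , suc t , ⇓false eq d , s≤s t≤ , Ps

  -- The index of the invariant is the potential that pays for the remaining iterations.
  whileR : ∀ {b p s₀ φ₀ P} (I : ℕ → State → Set) →
    (∀ φ s → Frame p s₀ s → Small W s → I φ s → ⟦ b ⟧ᵗ s ≡ true →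
       ∃[ B ] Run p s B (λ s′ → ∃[ φ′ ] (suc (B + φ′) ≤ φ × I φ′ s′))) →
    (∀ φ s → Frame p s₀ s → Small W s → I φ s → ⟦ b ⟧ᵗ s ≡ false → P s) →
    I φ₀ s₀ → Run (while b p) s₀ (suc φ₀) P
  whileR {b} {p} {s₀} {φ₀} {P} I body exit I₀ sm₀ =
    loop φ₀ s₀ (<-wellFounded φ₀) Frame-refl sm₀ I₀
    where
    Result : ℕ → State → Set
    Result φ s = ∃[ s′ ] ∃[ t ] ((W ⊢ while b p , s ⇓ s′ ∥ t) × t ≤ suc φ × P s′)
    loop : ∀ φ s → Acc _<_ φ → Frame p s₀ s → Small W s → I φ s → Result φ s
    step : ∀ φ s → Acc _<_ φ → Frame p s₀ s → Small W s → I φ s → ∀ v → ⟦ b ⟧ᵗ s ≡ v → Result φ s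
    loop φ s a fr sm i = step φ s a fr sm i (⟦ b ⟧ᵗ s) refl
    step φ s a fr sm i false eq = s , 1 , ⇓stop eq , s≤s z≤n , exit φ s fr sm i eq
    step φ s (acc rs) fr sm i true eq with body φ s fr sm i eq
    ... | B , r with r sm
    ... | s′ , t , d , t≤ , φ′ , dec , i′
      with loop φ′ s′ (rs (≤-trans (s≤s (m≤n+m φ′ B)) dec)) (Frame-trans fr (⇓-frame d)) (⇓-small d sm) i′
    ... | s″ , t′ , d′ , t′≤ , Ps =
      s″ , suc (t + t′) , ⇓loop eq d d′ ,
      s≤s (≤-trans (+-mono-≤ t≤ t′≤) (≤-trans (≤-reflexive (+-suc B φ′)) dec)) , Ps

  -- An iteration costs one test, `C` for the body and one increment; the two further steps are the
  -- initial assignment and the failing test. The potential is this cost times the number `k` of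
  -- iterations left. The body has to establish `J` for the state after the increment.
  forR : ∀ {x hi p s₀ P} (N C : ℕ) (J : ℕ → State → Set) → N < W →
    (∀ s → Frame (for x hi p) s₀ s → ⟦ hi ⟧ᵃ s ≡ N) →
    writesReg p x ≡ false →
    (∀ i s → i < N → Frame (for x hi p) s₀ s → Small W s → reg s x ≡ i → J i s →
       Run p s C (λ s′ → J (suc i) (setReg s′ x (suc i)))) →
    J 0 (setReg s₀ x 0) →
    (∀ s → Frame (for x hi p) s₀ s → J N s → P s) →
    Run (for x hi p) s₀ (suc (suc (N * suc (C + 1)))) P
  forR {x} {hi} {p} {s₀} {P} N C J N<W hiN wx body J₀ exit =
    set 0 refl tt (whileR {p = p ⨾ (x ≔ var x ⊕ lit 1)} I step stop I₀)
    where
    F : State → Set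
    F = Frame (for x hi p) s₀
    f₀ : F (setReg s₀ x 0)
    f₀ = frame (λ y w → update-skip (reg s₀) x 0 y (∨-falseˡ w)) (λ _ _ → refl)
    lift : ∀ {s} → Frame (p ⨾ (x ≔ var x ⊕ lit 1)) (setReg s₀ x 0) s → F s
    lift {s} g = frame
      (λ y w → trans (regF g y (∨-falseʳ {x ≡ᵇ y} w)) (regF f₀ y w))
      (λ r w → arrF g r w)
    I : ℕ → State → Set
    I φ s = ∃[ i ] ∃[ k ] (i + k ≡ N × reg s x ≡ i × φ ≡ k * suc (C + 1) × J i s)
    I₀ : I (N * suc (C + 1)) (setReg s₀ x 0)
    I₀ = 0 , N , refl , update-same (reg s₀) x 0 , refl , J₀
    step : ∀ φ s → Frame (p ⨾ (x ≔ var x ⊕ lit 1)) (setReg s₀ x 0) s → Small W s → I φ s → ⟦ var x ≺ hi ⟧ᵗ s ≡ true →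
       ∃[ B ] Run (p ⨾ (x ≔ var x ⊕ lit 1)) s B (λ s′ → ∃[ φ′ ] (suc (B + φ′) ≤ φ × I φ′ s′))
    step φ s fr sm (i , zero , e , ri , _ , _) eq
      with () ← <-irrefl (trans ri (trans (sym (+-identityʳ i)) e))
                  (<-≤-trans (<ᵇ-true {reg s x} eq) (≤-reflexive (hiN s (lift fr))))
    step φ s fr sm (i , suc k , e , ri , refl , j) eq = C + 1 , seqR {B = C} (λ sm′ →
      let (s′ , t , d , t≤ , j′) = body i s i<N (lift fr) sm ri j sm
          rx = trans (regF (⇓-frame d) x wx) ri
          e′ = trans (cong (_+ 1) rx) (+-comm i 1)
      in s′ , t , d , t≤ , assignR (suc i) e′ (≤-<-trans i<N N<W)
           (k * suc (C + 1) , ≤-refl , suc i , k , trans (sym (+-suc i k)) e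
           , update-same (reg s′) x (suc i) , refl , j′))
      where
      i<N : i < N
      i<N = subst (i <_) e (m<m+n i (s≤s z≤n))
    stop : ∀ φ s → Frame (p ⨾ (x ≔ var x ⊕ lit 1)) (setReg s₀ x 0) s → Small W s → I φ s → ⟦ var x ≺ hi ⟧ᵗ s ≡ false → P s
    stop φ s fr sm (i , k , e , ri , _ , j) eq =
      exit s (lift fr) (subst (λ i → J i s) (trans (sym ri) (≤-antisym (≤-trans (≤-reflexive ri) i≤N) N≤)) j)
      where
      N≤ : N ≤ reg s x
      N≤ = ≤-trans (≤-reflexive (sym (hiN s (lift fr)))) (<ᵇ-false {reg s x} eq)
      i≤N : i ≤ N
      i≤N = subst (i ≤_) e (m≤m+n i k)

-- Finite sums

sumTo : ℕ → (ℕ → ℕ) → ℕ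
sumTo zero    f = 0
sumTo (suc n) f = sumTo n f + f n

sumTo-cong : ∀ n {f g} → (∀ i → i < n → f i ≡ g i) → sumTo n f ≡ sumTo n g
sumTo-cong zero    eq = refl
sumTo-cong (suc n) eq = cong₂ _+_ (sumTo-cong n λ i i<n → eq i (m<n⇒m<1+n i<n)) (eq n ≤-refl)

sumTo-mono : ∀ n {f g} → (∀ i → i < n → f i ≤ g i) → sumTo n f ≤ sumTo n g
sumTo-mono zero    le = z≤n
sumTo-mono (suc n) le = +-mono-≤ (sumTo-mono n λ i i<n → le i (m<n⇒m<1+n i<n)) (le n ≤-refl)

sumTo-const : ∀ n c → sumTo n (λ _ → c) ≡ n * c
sumTo-const zero    c = refl
sumTo-const (suc n) c = trans (cong (_+ c) (sumTo-const n c)) (+-comm (n * c) c)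

sumTo-+ : ∀ n f g → sumTo n (λ i → f i + g i) ≡ sumTo n f + sumTo n g
sumTo-+ zero    f g = refl
sumTo-+ (suc n) f g = trans (cong (_+ (f n + g n)) (sumTo-+ n f g)) (lemma (sumTo n f) (sumTo n g) (f n) (g n))
  where
  lemma : ∀ a b c d → a + b + (c + d) ≡ a + c + (b + d)
  lemma = solve-∀

sumTo-* : ∀ n c f → sumTo n (λ i → c * f i) ≡ c * sumTo n f
sumTo-* zero    c f = sym (*-zeroʳ c)
sumTo-* (suc n) c f = trans (cong (_+ c * f n) (sumTo-* n c f)) (sym (*-distribˡ-+ c (sumTo n f) (f n)))

sumTo-≤ : ∀ n f {u} → u < n → f u ≤ sumTo n f
sumTo-≤ (suc n) f {u} u<n with u ≟ n
... | yes refl = m≤n+m (f n) (sumTo n f)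
... | no u≢n = ≤-trans (sumTo-≤ n f (≤∧≢⇒< (≤-pred u<n) u≢n)) (m≤m+n (sumTo n f) (f n))

sumTo-extend : ∀ {m n} f → m ≤ n → sumTo m f ≤ sumTo n f
sumTo-extend {m} {n} f m≤n with m ≟ n
... | yes refl = ≤-refl
sumTo-extend {m} {zero} f z≤n | no m≢n = ≤-refl
sumTo-extend {m} {suc n} f m≤n | no m≢n =
  ≤-trans (sumTo-extend f (≤-pred (≤∧≢⇒< m≤n m≢n))) (m≤m+n (sumTo n f) (f n))

-- Stated additively to avoid truncated subtraction.
sumTo-change : ∀ n f g {u} → u < n → (∀ i → i < n → i ≢ u → f i ≡ g i) →
               sumTo n f + g u ≡ sumTo n g + f u
sumTo-change (suc n) f g {u} u<n eq with u ≟ n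
... | yes refl = trans (cong (λ s → s + f n + g n) (sumTo-cong n λ i i<n → eq i (m<n⇒m<1+n i<n) (<⇒≢ i<n)))
                       (lemma (sumTo n g) (f n) (g n))
  where
  lemma : ∀ a b c → a + b + c ≡ a + c + b
  lemma = solve-∀
... | no u≢n = trans (lemma (sumTo n f) (f n) (g u))
        (trans (cong₂ _+_ (sumTo-change n f g (≤∧≢⇒< (≤-pred u<n) u≢n) λ i i<n → eq i (m<n⇒m<1+n i<n))
                          (eq n ≤-refl (u≢n ∘ sym)))
               (lemma (sumTo n g) (f u) (g n)))
  where
  lemma : ∀ a b c → a + b + c ≡ a + c + b
  lemma = solve-∀

bit≤1 : ∀ b → bit b ≤ 1
bit≤1 false = z≤n
bit≤1 true  = ≤-refl

count-not : ∀ n (f : ℕ → Bool) → sumTo n (λ v → bit (f v)) + sumTo n (λ v → bit (not (f v))) ≡ n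
count-not n f = trans (sym (sumTo-+ n (λ v → bit (f v)) (λ v → bit (not (f v)))))
  (trans (sumTo-cong n λ i _ → one (f i)) (trans (sumTo-const n 1) (*-identityʳ n)))
  where
  one : ∀ b → bit b + bit (not b) ≡ 1
  one false = refl
  one true  = refl

-- Setting the entries at `a` and then at `b` to zero splits their values off the sum, and the entry
-- at `c` survives both changes.
three≤sumTo : ∀ n f {a b c} → a < n → b < n → c < n → a ≢ b → c ≢ a → c ≢ b →
              1 ≤ f a → 1 ≤ f b → 1 ≤ f c → 3 ≤ sumTo n f
three≤sumTo n f {a} {b} {c} a<n b<n c<n a≢b c≢a c≢b fa fb fc = begin
  1 + 1 + 1                                ≤⟨ +-mono-≤ {2} {g c + f b} (+-mono-≤ {1} {g c} {1} {f b} gc fb) fa ⟩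
  g c + f b + f a                          ≤⟨ +-monoˡ-≤ (f a) (+-monoˡ-≤ (f b) (sumTo-≤ n g c<n)) ⟩
  sumTo n g + f b + f a                    ≡⟨ cong (λ x → sumTo n g + x + f a) (sym (update-other f a 0 b a≢b)) ⟩
  sumTo n g + h b + f a                    ≡⟨ cong (_+ f a) (sumTo-change n g h b<n λ i _ i≢b → update-other h b 0 i (i≢b ∘ sym)) ⟩
  sumTo n h + g b + f a                    ≡⟨ cong (λ x → sumTo n h + x + f a) (update-same h b 0) ⟩
  sumTo n h + 0 + f a                      ≡⟨ cong (_+ f a) (+-identityʳ (sumTo n h)) ⟩
  sumTo n h + f a                          ≡⟨ sumTo-change n h f a<n (λ i _ i≢a → update-other f a 0 i (i≢a ∘ sym)) ⟩
  sumTo n f + h a                          ≡⟨ cong (sumTo n f +_) (update-same f a 0) ⟩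
  sumTo n f + 0                            ≡⟨ +-identityʳ (sumTo n f) ⟩
  sumTo n f                                ∎
  where
  open ≤-Reasoning
  h g : ℕ → ℕ
  h = update f a 0
  g = update h b 0
  gc : 1 ≤ g c
  gc = subst (1 ≤_) (sym (trans (update-other h b 0 c (c≢b ∘ sym)) (update-other f a 0 c (c≢a ∘ sym)))) fc

below-suc : ∀ {P : ℕ → Set} {i} → (∀ v → v < i → P v) → P i → ∀ v → v < suc i → P v
below-suc {i = i} before now v v< with v ≟ i
... | yes refl = now
... | no v≢i   = before v (≤∧≢⇒< (≤-pred v<) v≢i)

cell-injective : ∀ {n} u u′ {i i′} → i < n → i′ < n → u * n + i ≡ u′ * n + i′ → u ≡ u′
cell-injective {n} u u′ i<n i′<n eq = ≤-antisym (no-less u′ u i′<n (sym eq)) (no-less u u′ i<n eq)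
  where
  open ≤-Reasoning
  no-less : ∀ u u′ {i i′} → i < n → u * n + i ≡ u′ * n + i′ → u′ ≤ u
  no-less u u′ {i} {i′} i<n eq = ≮⇒≥ λ u<u′ → <-irrefl eq (begin-strict
      u * n + i   <⟨ +-monoʳ-< (u * n) i<n ⟩
      u * n + n   ≡⟨ +-comm (u * n) n ⟩
      suc u * n   ≤⟨ *-monoˡ-≤ n u<u′ ⟩
      u′ * n      ≤⟨ m≤m+n (u′ * n) i′ ⟩
      u′ * n + i′ ∎)

cell-< : ∀ {n} u {v m} → u < m → v < n → u * n + v < m * n
cell-< {n} u {v} {m} u<m v<n = begin-strict
  u * n + v <⟨ +-monoʳ-< (u * n) v<n ⟩
  u * n + n ≡⟨ +-comm (u * n) n ⟩
  suc u * n ≤⟨ *-monoˡ-≤ n u<m ⟩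
  m * n     ∎
  where open ≤-Reasoning

-- 2-joins as closed sets

≢true⇒false : ∀ {b} → b ≢ true → b ≡ false
≢true⇒false {false} _  = refl
≢true⇒false {true}  ne with () ← ne refl

true≢false : true ≢ false
true≢false ()

∧∨∧-cases : ∀ a b c d → (a ∧ b) ∨ (c ∧ d) ≡ true → (a ≡ true × b ≡ true) ⊎ (c ≡ true × d ≡ true)
∧∨∧-cases true  true  c    d    _ = inj₁ (refl , refl)
∧∨∧-cases true  false true true _ = inj₂ (refl , refl)
∧∨∧-cases false b     true true _ = inj₂ (refl , refl)

-- The label of a vertex of the first (typeL) or second (typeR) side, given its adjacency to the chosen
-- A-vertex and B-vertex of the other side: 1 for A, 2 for B. The remaining codes 0, 3 of typeL and
-- 4 of typeR are different, so that two vertices are to be adjacent iff their codes agree.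
typeL typeR : Bool → Bool → ℕ
typeL p q = bit p + 2 * bit q
typeR r s = if bit r ≡ᵇ bit s then 4 else bit r + 2 * bit s

typeL<4 : ∀ p q → typeL p q < 4
typeL<4 false false = s≤s z≤n
typeL<4 true  false = s≤s (s≤s z≤n)
typeL<4 false true  = s≤s (s≤s (s≤s z≤n))
typeL<4 true  true  = ≤-refl

typeR<5 : ∀ r s → typeR r s < 5
typeR<5 false false = ≤-refl
typeR<5 true  false = s≤s (s≤s z≤n)
typeR<5 false true  = s≤s (s≤s (s≤s z≤n))
typeR<5 true  true  = ≤-refl

types-agree : ∀ p q r s → (p ≡ true → q ≡ false) → (r ≡ true → s ≡ false) →
              (p ∧ r) ∨ (q ∧ s) ≡ (typeL p q ≡ᵇ typeR r s)
types-agree true  true  r     s     dis _ with () ← dis refl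
types-agree p     q     true  true  _ dis with () ← dis refl
types-agree false false false false _ _ = refl
types-agree false false false true  _ _ = refl
types-agree false false true  false _ _ = refl
types-agree false true  false false _ _ = refl
types-agree false true  false true  _ _ = refl
types-agree false true  true  false _ _ = refl
types-agree true  false false false _ _ = refl
types-agree true  false false true  _ _ = refl
types-agree true  false true  false _ _ = refl

-- `typeL` takes the values 0 to 3 and `typeR` the values 1, 2 and 4, so that codes can agree only
-- at 1 or at 2.
types-split : ∀ p q r s → (typeL p q ≡ᵇ typeR r s) ≡
              ((typeL p q ≡ᵇ 1) ∧ (typeR r s ≡ᵇ 1)) ∨ ((typeL p q ≡ᵇ 2) ∧ (typeR r s ≡ᵇ 2))
types-split false false false false = refl
types-split false false false true  = refl
types-split false false true  false = refl
types-split false false true  true  = refl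
types-split false true  false false = refl
types-split false true  false true  = refl
types-split false true  true  false = refl
types-split false true  true  true  = refl
types-split true  false false false = refl
types-split true  false false true  = refl
types-split true  false true  false = refl
types-split true  false true  true  = refl
types-split true  true  false false = refl
types-split true  true  false true  = refl
types-split true  true  true  false = refl
types-split true  true  true  true  = refl

typeL-1 : ∀ p q → typeL p q ≡ 1 → p ≡ true × q ≡ false
typeL-1 true  false refl = refl , refl
typeL-1 false true ()

typeL-2 : ∀ p q → typeL p q ≡ 2 → p ≡ false × q ≡ true
typeL-2 false true refl = refl , refl
typeL-2 true false ()
typeL-2 true true ()

module Joins (n : ℕ) (E : ℕ → ℕ → Bool) (E-sym : ∀ u v → E u v ≡ E v u) where

  -- σ is the indicator function of X₁, α that of A₁ ∪ A₂ and β that of B₁ ∪ B₂.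
  record Join (σ α β : ℕ → Bool) : Set where
    field
      cross : ∀ {u v} → u < n → v < n → σ u ≡ true → σ v ≡ false →
              E u v ≡ (α u ∧ α v) ∨ (β u ∧ β v)
      disj  : ∀ {v} → v < n → α v ≡ true → β v ≡ false
      size₁ : 3 ≤ sumTo n (λ v → bit (σ v))
      size₂ : 3 ≤ sumTo n (λ v → bit (not (σ v)))

  record Compatible (σ α β : ℕ → Bool) (a₁ a₂ b₁ b₂ : ℕ) : Set where
    field
      join : Join σ α β
      a₁<n : a₁ < n
      a₂<n : a₂ < n
      b₁<n : b₁ < n
      b₂<n : b₂ < n
      σa₁  : σ a₁ ≡ true
      σb₁  : σ b₁ ≡ true
      σa₂  : σ a₂ ≡ false
      σb₂  : σ b₂ ≡ false
      αa₁  : α a₁ ≡ true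
      αa₂  : α a₂ ≡ true
      βb₁  : β b₁ ≡ true
      βb₂  : β b₂ ≡ true
    open Join join public

  Refuted : ℕ → ℕ → ℕ → ℕ → Set
  Refuted a₁ a₂ b₁ b₂ = ∀ σ α β → Compatible σ α β a₁ a₂ b₁ b₂ → ⊥

  swapSides : ∀ {σ α β a₁ a₂ b₁ b₂} → Compatible σ α β a₁ a₂ b₁ b₂ → Compatible (not ∘ σ) α β a₂ a₁ b₂ b₁
  swapSides {σ} {α} {β} c = record
    { join = record
      { cross = λ {u} {v} u<n v<n σu σv → trans (E-sym u v) (trans
          (C.cross v<n u<n (not-false σv) (not-true σu))
          (commute (α v) (α u) (β v) (β u)))
      ; disj  = C.disj
      ; size₁ = C.size₂
      ; size₂ = ≤-trans C.size₁ (≤-reflexive (sumTo-cong n λ i _ → not-not (σ i)))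
      }
    ; a₁<n = C.a₂<n ; a₂<n = C.a₁<n ; b₁<n = C.b₂<n ; b₂<n = C.b₁<n
    ; σa₁ = cong not C.σa₂ ; σb₁ = cong not C.σb₂ ; σa₂ = cong not C.σa₁ ; σb₂ = cong not C.σb₁
    ; αa₁ = C.αa₂ ; αa₂ = C.αa₁ ; βb₁ = C.βb₂ ; βb₂ = C.βb₁
    }
    where
    module C = Compatible c
    not-false : ∀ {b} → not b ≡ false → b ≡ true
    not-false {true} _ = refl
    not-true : ∀ {b} → not b ≡ true → b ≡ false
    not-true {false} _ = refl
    not-not : ∀ b → bit b ≡ bit (not (not b))
    not-not false = refl
    not-not true  = refl
    commute : ∀ a b c d → (a ∧ b) ∨ (c ∧ d) ≡ (b ∧ a) ∨ (d ∧ c)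
    commute false false false false = refl
    commute false false false true  = refl
    commute false false true  false = refl
    commute false false true  true  = refl
    commute false true  false false = refl
    commute false true  false true  = refl
    commute false true  true  false = refl
    commute false true  true  true  = refl
    commute true  false false false = refl
    commute true  false false true  = refl
    commute true  false true  false = refl
    commute true  false true  true  = refl
    commute true  true  c     d     = refl

  swapLabels : ∀ {σ α β a₁ a₂ b₁ b₂} → Compatible σ α β a₁ a₂ b₁ b₂ → Compatible σ β α b₁ b₂ a₁ a₂
  swapLabels {σ} {α} {β} c = record
    { join = record
      { cross = λ {u} {v} u<n v<n σu σv → trans (C.cross u<n v<n σu σv) (∨-comm (α u ∧ α v) (β u ∧ β v))
      ; disj  = λ {v} v<n βv → ≢true⇒false λ αv → true≢false (trans (sym βv) (C.disj v<n αv))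
      ; size₁ = C.size₁
      ; size₂ = C.size₂
      }
    ; a₁<n = C.b₁<n ; a₂<n = C.b₂<n ; b₁<n = C.a₁<n ; b₂<n = C.a₂<n
    ; σa₁ = C.σb₁ ; σb₁ = C.σa₁ ; σa₂ = C.σb₂ ; σb₂ = C.σa₂
    ; αa₁ = C.βb₁ ; αa₂ = C.βb₂ ; βb₁ = C.αa₁ ; βb₂ = C.αa₂
    }
    where
    module C = Compatible c

  module _ (a₁ a₂ b₁ b₂ : ℕ) where

    ty₁ ty₂ : ℕ → ℕ
    ty₁ v = typeL (E v a₂) (E v b₂)
    ty₂ v = typeR (E v a₁) (E v b₁)

    Step : ℕ → ℕ → Set
    Step u v = E u v ≢ (ty₁ u ≡ᵇ ty₂ v)

    Closed : (ℕ → Bool) → Set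
    Closed τ = ∀ u v → u < n → v < n → τ u ≡ true → Step u v → τ v ≡ true

    -- The vertex `a₂` carries the label α and not β, hence the cross condition for `u` and `a₂`
    -- collapses to `α u`; symmetrically for `b₂`.
    compatible-types : ∀ {σ α β} → Compatible σ α β a₁ a₂ b₁ b₂ → ∀ {u} → u < n →
      σ u ≡ true → E u a₂ ≡ α u × E u b₂ ≡ β u
    compatible-types {σ} {α} {β} c {u} u<n σu =
      trans (C.cross u<n C.a₂<n σu C.σa₂) (left C.αa₂ (C.disj C.a₂<n C.αa₂) (α u) (β u)) ,
      trans (C.cross u<n C.b₂<n σu C.σb₂) (right (≢true⇒false λ αb₂ → true≢false (trans (sym C.βb₂) (C.disj C.b₂<n αb₂))) C.βb₂ (α u) (β u))
      where
      module C = Compatible c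
      left : ∀ {a b} → a ≡ true → b ≡ false → ∀ p q → (p ∧ a) ∨ (q ∧ b) ≡ p
      left refl refl false false = refl
      left refl refl false true  = refl
      left refl refl true  q     = refl
      right : ∀ {a b} → a ≡ false → b ≡ true → ∀ p q → (p ∧ a) ∨ (q ∧ b) ≡ q
      right refl refl false false = refl
      right refl refl false true  = refl
      right refl refl true  false = refl
      right refl refl true  true  = refl

    -- Closedness says that across the cut adjacency is agreement of codes. By `types-split` such an
    -- agreement is at 1 or at 2, and these two codes serve as the labels α and β.
    sound : ∀ {σ} → Closed σ → a₁ < n → a₂ < n → b₁ < n → b₂ < n →
      σ a₁ ≡ true → σ b₁ ≡ true → σ a₂ ≡ false → σ b₂ ≡ false →
      ty₁ a₁ ≡ 1 → ty₁ b₁ ≡ 2 →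
      3 ≤ sumTo n (λ v → bit (σ v)) → 3 ≤ sumTo n (λ v → bit (not (σ v))) →
      ∃[ α ] ∃[ β ] Compatible σ α β a₁ a₂ b₁ b₂
    sound {σ} closed a₁<n a₂<n b₁<n b₂<n σa₁ σb₁ σa₂ σb₂ ta tb size₁ size₂ =
      label 1 , label 2 , record
      { join = record
        { cross = λ {u} {v} u<n v<n σu σv → trans
            (agree u v u<n v<n σu σv)
            (trans (types-split (E u a₂) (E u b₂) (E v a₁) (E v b₁))
              (sym (cong₂ _∨_ (cong₂ _∧_ (label-in 1 σu) (label-out 1 σv))
                              (cong₂ _∧_ (label-in 2 σu) (label-out 2 σv)))))
        ; disj  = λ {v} _ → exclusive (σ v) (ty₁ v) (ty₂ v)
        ; size₁ = size₁
        ; size₂ = size₂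
        }
      ; a₁<n = a₁<n ; a₂<n = a₂<n ; b₁<n = b₁<n ; b₂<n = b₂<n
      ; σa₁ = σa₁ ; σb₁ = σb₁ ; σa₂ = σa₂ ; σb₂ = σb₂
      ; αa₁ = trans (label-in 1 σa₁) (≡⇒≡ᵇ-true ta)
      ; αa₂ = trans (label-out 1 σa₂) (≡⇒≡ᵇ-true ta₂)
      ; βb₁ = trans (label-in 2 σb₁) (≡⇒≡ᵇ-true tb)
      ; βb₂ = trans (label-out 2 σb₂) (≡⇒≡ᵇ-true tb₂)
      }
      where
      label : ℕ → ℕ → Bool
      label k u = (if σ u then ty₁ u else ty₂ u) ≡ᵇ k
      label-in : ∀ k {u} → σ u ≡ true → label k u ≡ (ty₁ u ≡ᵇ k)
      label-in k {u} σu = cong (λ b → (if b then ty₁ u else ty₂ u) ≡ᵇ k) σu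
      label-out : ∀ k {u} → σ u ≡ false → label k u ≡ (ty₂ u ≡ᵇ k)
      label-out k {u} σu = cong (λ b → (if b then ty₁ u else ty₂ u) ≡ᵇ k) σu
      exclusive : ∀ b x y → ((if b then x else y) ≡ᵇ 1) ≡ true → ((if b then x else y) ≡ᵇ 2) ≡ false
      exclusive true  (suc zero) y refl = refl
      exclusive false x (suc zero) refl = refl
      agree : ∀ u v → u < n → v < n → σ u ≡ true → σ v ≡ false → E u v ≡ (ty₁ u ≡ᵇ ty₂ v)
      agree u v u<n v<n σu σv with E u v ≟ᵇ (ty₁ u ≡ᵇ ty₂ v)
      ... | yes eq = eq
      ... | no ne with () ← trans (sym σv) (closed u v u<n v<n σu ne)
      -- The codes of `a₁` and `b₁` record all four adjacencies between the chosen vertices of the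
      -- two sides, so they also determine the codes of `a₂` and `b₂`.
      ta₂ : ty₂ a₂ ≡ 1
      ta₂ with typeL-1 (E a₁ a₂) (E a₁ b₂) ta | typeL-2 (E b₁ a₂) (E b₁ b₂) tb
      ... | p , _ | q , _ = cong₂ typeR (trans (E-sym a₂ a₁) p) (trans (E-sym a₂ b₁) q)
      tb₂ : ty₂ b₂ ≡ 2
      tb₂ with typeL-1 (E a₁ a₂) (E a₁ b₂) ta | typeL-2 (E b₁ a₂) (E b₁ b₂) tb
      ... | _ , p | _ , q = cong₂ typeR (trans (E-sym b₂ a₁) p) (trans (E-sym b₂ b₁) q)

  -- Converse of `sound`: if `v` were outside, the codes of `u` and `v` would be their true labels,
  -- and the cross condition would make adjacency equal to agreement, contrary to the forcing.
  compatible-closed : ∀ {σ α β a₁ a₂ b₁ b₂} → Compatible σ α β a₁ a₂ b₁ b₂ → Closed a₁ a₂ b₁ b₂ σ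
  compatible-closed {σ} {α} {β} {a₁} {a₂} {b₁} {b₂} c u v u<n v<n σu step with σ v in σv
  ... | true  = refl
  ... | false = ⊥-elim (step (trans (C.cross u<n v<n σu σv) (trans
        (types-agree (α u) (β u) (α v) (β v) (C.disj u<n) (C.disj v<n))
        (cong₂ _≡ᵇ_ (cong₂ typeL (sym (proj₁ tu)) (sym (proj₂ tu)))
                    (cong₂ typeR (sym (proj₁ tv)) (sym (proj₂ tv)))))))
    where
    module C = Compatible c
    tu = compatible-types a₁ a₂ b₁ b₂ c u<n σu
    tv = compatible-types a₂ a₁ b₂ b₁ (swapSides c) v<n (cong not σv)

  -- Justifies rejecting a tuple by the codes of `a₁` and `b₁` alone.
  compatible-ty₁ : ∀ {σ α β a₁ a₂ b₁ b₂} → Compatible σ α β a₁ a₂ b₁ b₂ →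
    ty₁ a₁ a₂ b₁ b₂ a₁ ≡ 1 × ty₁ a₁ a₂ b₁ b₂ b₁ ≡ 2
  compatible-ty₁ {a₁ = a₁} {a₂} {b₁} {b₂} c =
    cong₂ typeL (trans (proj₁ ta) C.αa₁) (trans (proj₂ ta) (C.disj C.a₁<n C.αa₁)) ,
    cong₂ typeL (trans (proj₁ tb) (Compatible.disj (swapLabels c) C.b₁<n C.βb₁)) (trans (proj₂ tb) C.βb₁)
    where
    module C = Compatible c
    ta = compatible-types a₁ a₂ b₁ b₂ c C.a₁<n C.σa₁
    tb = compatible-types a₁ a₂ b₁ b₂ c C.b₁<n C.σb₁

-- The program

-- Registers: 0 holds n, 1 the success flag, 2 and 3 the outer loop counters x and y,
-- 4 to 8 hold a₁, a₂, b₁, b₂, c, and the remaining ones are scratch.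
-- Arrays: 0 matrix, 1 labels, 2 degrees, 3 neighbour lists (row u starts at u * n),
-- 4 tree parents, 5 deleted vertices, 6 keys, 7 forest parents, 8 processed vertices,
-- 9 visited vertices, 10 queue, 11 and 12 types, 13 lists of unvisited vertices by type,
-- 14 lengths of these lists.

rowP : Prog
rowP =
  for 17 (var 0)
    (20 ≔ var 18 ⊕ var 17 ⨾ 10 ≔ load 0 at var 20 ⨾
     cond (var 10 ≐ lit 1)
       (20 ≔ var 18 ⊕ var 16 ⨾ store 3 at var 20 value var 17 ⨾ 16 ≔ var 16 ⊕ lit 1)
       skip)

neighboursP : Prog
neighboursP =
  for 9 (var 0)
    (18 ≔ var 9 ⊗ var 0 ⨾ 16 ≔ atom (lit 0) ⨾
     rowP ⨾
     store 2 at var 9 value var 16)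

pickStepP : Prog
pickStepP =
  10 ≔ load 8 at var 9 ⨾
  cond (var 10 ≐ lit 0)
    (10 ≔ load 6 at var 9 ⨾
     cond (var 10 ≺ var 14) (13 ≔ atom (var 9) ⨾ 14 ≔ atom (var 10)) skip)
    skip

-- The value n in register 13 means that no vertex is left. The key to beat starts at n + 2, since
-- unreached vertices have key n + 1 and must be eligible under the strict comparison.
pickP : Prog
pickP = 13 ≔ atom (var 0) ⨾ 14 ≔ var 0 ⊕ lit 2 ⨾ for 9 (var 0) pickStepP

-- Deletion is by truncated subtraction: register 10 ends as 1 exactly if the matrix entry is 1 and
-- neither end is marked in array 5. This is the expression in `Live`. Only vertices with the key n
-- + 1 of register 15 are given a new key and parent.
relaxP : Prog
relaxP =
  for 9 (var 0)
    (20 ≔ var 18 ⊕ var 9 ⨾ 10 ≔ load 0 at var 20 ⨾ 10 ≔ var 10 ⊖ var 19 ⨾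
     20 ≔ load 5 at var 9 ⨾ 10 ≔ var 10 ⊖ var 20 ⨾
     cond (var 10 ≐ lit 1)
       (10 ≔ load 6 at var 9 ⨾
        cond (var 10 ≐ var 15)
          (store 6 at var 9 value var 16 ⨾ store 7 at var 9 value var 13)
          skip)
       skip)

processP : Prog
processP =
  store 8 at var 13 value lit 1 ⨾
  16 ≔ var 14 ⊕ lit 1 ⨾ 18 ≔ var 13 ⊗ var 0 ⨾ 19 ≔ load 5 at var 13 ⨾
  relaxP ⨾ pickP

-- If the least key is n + 1, every reached vertex has been processed, and the picked vertex becomes
-- the root of a new tree.
growP : Prog
growP =
  cond (var 14 ≐ var 15) (14 ≔ atom (lit 0) ⨾ store 6 at var 13 value lit 0) skip ⨾
  processP

forestP : Prog
forestP =
  15 ≔ var 0 ⊕ lit 1 ⨾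
  for 9 (var 0)
    (store 6 at var 9 value var 15 ⨾ store 7 at var 9 value var 9 ⨾ store 8 at var 9 value lit 0) ⨾
  pickP ⨾
  while (var 13 ≺ var 0) growP

pushP : Prog
pushP =
  10 ≔ load 9 at var 9 ⨾
  cond (var 10 ≐ lit 0)
    (store 9 at var 9 value lit 1 ⨾ store 10 at var 11 value var 9 ⨾ 11 ≔ var 11 ⊕ lit 1)
    skip

typesP : Prog
typesP =
  for 9 (var 0)
    (store 9 at var 9 value lit 0 ⨾
     20 ≔ var 9 ⊗ var 0 ⨾
     21 ≔ var 20 ⊕ var 5 ⨾ 21 ≔ load 0 at var 21 ⨾
     22 ≔ var 20 ⊕ var 7 ⨾ 22 ≔ load 0 at var 22 ⨾ 22 ≔ lit 2 ⊗ var 22 ⨾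
     21 ≔ var 21 ⊕ var 22 ⨾ store 11 at var 9 value var 21 ⨾
     21 ≔ var 20 ⊕ var 4 ⨾ 21 ≔ load 0 at var 21 ⨾
     22 ≔ var 20 ⊕ var 6 ⨾ 22 ≔ load 0 at var 22 ⨾
     cond (var 21 ≐ var 22)
       (store 12 at var 9 value lit 4)
       (22 ≔ lit 2 ⊗ var 22 ⨾ 21 ≔ var 21 ⊕ var 22 ⨾ store 12 at var 9 value var 21))

fillListsP : Prog
fillListsP =
  for 9 (var 0)
    (14 ≔ load 12 at var 9 ⨾ 16 ≔ load 14 at var 14 ⨾
     15 ≔ var 14 ⊗ var 0 ⨾ 15 ≔ var 15 ⊕ var 16 ⨾
     store 13 at var 15 value var 9 ⨾ 16 ≔ var 16 ⊕ lit 1 ⨾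
     store 14 at var 14 value var 16)

listsP : Prog
listsP = for 14 (lit 5) (store 14 at var 14 value lit 0) ⨾ fillListsP

scanListP : Prog
scanListP =
  for 17 (var 16)
    (20 ≔ var 15 ⊕ var 17 ⨾ 9 ≔ load 13 at var 20 ⨾
     20 ≔ var 18 ⊕ var 9 ⨾ 10 ≔ load 0 at var 20 ⨾
     cond (var 10 ≐ lit 0) pushP skip)

scanRowP : Prog
scanRowP =
  for 17 (var 19)
    (20 ≔ var 18 ⊕ var 17 ⨾ 9 ≔ load 3 at var 20 ⨾ 10 ≔ load 12 at var 9 ⨾
     cond (var 10 ≐ var 14)
       (20 ≔ var 15 ⊕ var 16 ⨾ store 13 at var 20 value var 9 ⨾ 16 ≔ var 16 ⊕ lit 1)
       pushP)

-- The list of the type of the processed vertex is scanned to its end before it is overwritten in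
-- place by the neighbours of that type. These may include visited vertices; `pushP` ignores them
-- when they are met again.
roundP : Prog
roundP =
  13 ≔ load 10 at var 12 ⨾ 12 ≔ var 12 ⊕ lit 1 ⨾
  14 ≔ load 11 at var 13 ⨾ 15 ≔ var 14 ⊗ var 0 ⨾ 16 ≔ load 14 at var 14 ⨾
  18 ≔ var 13 ⊗ var 0 ⨾ 19 ≔ load 2 at var 13 ⨾
  scanListP ⨾
  16 ≔ atom (lit 0) ⨾
  scanRowP ⨾
  store 14 at var 14 value var 16

closureP : Prog
closureP =
  typesP ⨾ listsP ⨾
  11 ≔ atom (lit 0) ⨾ 12 ≔ atom (lit 0) ⨾
  9 ≔ atom (var 4) ⨾ pushP ⨾ 9 ≔ atom (var 6) ⨾ pushP ⨾ 9 ≔ atom (var 8) ⨾ pushP ⨾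
  while (var 12 ≺ var 11) roundP

labelP : Prog
labelP =
  for 9 (var 0)
    -- Visited vertices get the label 2 - 1 = 1, the others the label 2.
    (10 ≔ load 9 at var 9 ⨾ 10 ≔ lit 2 ⊖ var 10 ⨾ store 1 at var 9 value var 10) ⨾
  1 ≔ atom (lit 1)

acceptP : Prog
acceptP =
  10 ≔ load 11 at var 4 ⨾ cond (var 10 ≐ lit 1)
    (10 ≔ load 11 at var 6 ⨾ cond (var 10 ≐ lit 2)
      (10 ≔ load 9 at var 5 ⨾ cond (var 10 ≐ lit 0)
        (10 ≔ load 9 at var 7 ⨾ cond (var 10 ≐ lit 0)
          -- Register 11 counts the visited vertices. This test and the next ask for three visited
          -- and three unvisited ones.
          (cond (lit 2 ≺ var 11)
            (10 ≔ var 11 ⊕ lit 2 ⨾ cond (var 10 ≺ var 0) labelP skip)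
            skip)
          skip)
        skip)
      skip)
    skip

attemptP : Prog
attemptP = cond (var 1 ≐ lit 0) (closureP ⨾ acceptP) skip

-- Among five vertices at least one differs from all four edge ends. A value of `c` that coincides
-- with an edge end does no harm, since acceptance checks everything that `sound` requires.
attemptsP : Prog
attemptsP = for 8 (lit 5) attemptP

tupleP : Prog
tupleP =
  attemptsP ⨾
  20 ≔ atom (var 4) ⨾ 4 ≔ atom (var 5) ⨾ 5 ≔ atom (var 20) ⨾
  20 ≔ atom (var 6) ⨾ 6 ≔ atom (var 7) ⨾ 7 ≔ atom (var 20) ⨾
  attemptsP

pairP : Prog
pairP =
  5 ≔ atom (var 2) ⨾ 4 ≔ load 4 at var 2 ⨾ 7 ≔ atom (var 3) ⨾ 6 ≔ load 4 at var 3 ⨾ tupleP ⨾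
  5 ≔ atom (var 2) ⨾ 4 ≔ load 4 at var 2 ⨾ 6 ≔ atom (var 3) ⨾ 7 ≔ load 4 at var 3 ⨾ tupleP ⨾
  5 ≔ atom (var 2) ⨾ 4 ≔ load 4 at var 2 ⨾ 7 ≔ atom (var 3) ⨾ 6 ≔ load 7 at var 3 ⨾ tupleP ⨾
  5 ≔ atom (var 2) ⨾ 4 ≔ load 4 at var 2 ⨾ 6 ≔ atom (var 3) ⨾ 7 ≔ load 7 at var 3 ⨾ tupleP ⨾
  -- Here x plays the role of b₂ and y that of b₁, while the A-edge joins the parent of x to its
  -- grandparent.
  5 ≔ load 4 at var 2 ⨾ 4 ≔ load 4 at var 5 ⨾ 6 ≔ atom (var 3) ⨾ 7 ≔ atom (var 2) ⨾ tupleP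

deleteP : Prog
deleteP =
  for 9 (var 0)
    (20 ≔ var 9 ⊗ var 0 ⨾ 20 ≔ var 20 ⊕ var 2 ⨾ 10 ≔ load 0 at var 20 ⨾ store 5 at var 9 value var 10)

-- Array 5 is still zero at this point, so nothing is deleted. The parents are copied because later
-- forests overwrite array 7.
treeP : Prog
treeP =
  forestP ⨾
  for 9 (var 0) (10 ≔ load 7 at var 9 ⨾ store 4 at var 9 value var 10)

vertexP : Prog
vertexP = deleteP ⨾ forestP ⨾ for 3 (var 0) pairP

searchP : Prog
searchP = neighboursP ⨾ treeP ⨾ for 2 (var 0) vertexP

twoJoinP : Prog
-- Two sides of three vertices need n ≥ 6. For smaller n the success flag keeps its initial value 0,
-- which is the right answer.
twoJoinP = cond (lit 5 ≺ var 0) searchP skip ⨾ 0 ≔ atom (var 1)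

-- Computing closed sets

module Closures (n : ℕ) (E : ℕ → ℕ → Bool) (E-sym : ∀ u v → E u v ≡ E v u)
                (a₁ a₂ b₁ b₂ c : ℕ) (w : ℕ → ℕ) where

  open Joins n E E-sym

  types₁ types₂ : ℕ → ℕ
  types₁ = ty₁ a₁ a₂ b₁ b₂
  types₂ = ty₂ a₁ a₂ b₁ b₂

  Forces : ℕ → ℕ → Set
  Forces = Step a₁ a₂ b₁ b₂

  -- The smallest closed set as an intersection. In this form a visited vertex lies in `σ` for every
  -- compatible join with `c` on its first side.
  Forced : ℕ → Set
  Forced v = ∀ τ → Closed a₁ a₂ b₁ b₂ τ → τ a₁ ≡ true → τ b₁ ≡ true → τ c ≡ true → τ v ≡ true

  forced-step : ∀ {u v} → u < n → v < n → Forced u → Forces u v → Forced v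
  forced-step u<n v<n fu st τ cl p q r = cl _ _ u<n v<n (fu τ cl p q r) st

  -- `total` and `weight` say through sums that no vertex is queued twice: the entries account
  -- exactly for the number and the weight of the visited vertices. The second identity bounds the
  -- work of all rounds together.
  record Queue (vis Q : ℕ → ℕ) (tl : ℕ) : Set where
    field
      binary   : ∀ {v} → v < n → vis v ≡ 0 ⊎ vis v ≡ 1
      entry    : ∀ {i} → i < tl → Q i < n × vis (Q i) ≡ 1
      index    : ∀ {v} → v < n → vis v ≡ 1 → ∃[ i ] (i < tl × Q i ≡ v)
      total    : sumTo n vis ≡ tl
      weight   : sumTo tl (λ i → w (Q i)) + sumTo n (λ v → (1 ∸ vis v) * w v) ≡ sumTo n w
      forced   : ∀ {v} → v < n → vis v ≡ 1 → Forced v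

    tl≤n : tl ≤ n
    tl≤n = begin
      tl                 ≡⟨ sym total ⟩
      sumTo n vis        ≤⟨ sumTo-mono n (λ i i<n → ≤1 (binary i<n)) ⟩
      sumTo n (λ _ → 1)  ≡⟨ sumTo-const n 1 ⟩
      n * 1              ≡⟨ *-identityʳ n ⟩
      n                  ∎
      where
      open ≤-Reasoning
      ≤1 : ∀ {x} → x ≡ 0 ⊎ x ≡ 1 → x ≤ 1
      ≤1 (inj₁ refl) = z≤n
      ≤1 (inj₂ refl) = ≤-refl

  record Grow (vis Q : ℕ → ℕ) (tl : ℕ) (vis′ Q′ : ℕ → ℕ) (tl′ : ℕ) : Set where
    field
      longer : tl ≤ tl′
      prefix : ∀ {i} → i < tl → Q′ i ≡ Q i
      mono   : ∀ {v} → vis v ≡ 1 → vis′ v ≡ 1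
  open Grow public

  Grow-refl : ∀ {vis Q tl} → Grow vis Q tl vis Q tl
  Grow-refl = record { longer = ≤-refl ; prefix = λ _ → refl ; mono = id }

  Grow-trans : ∀ {vis Q tl vis′ Q′ tl′ vis″ Q″ tl″} →
    Grow vis Q tl vis′ Q′ tl′ → Grow vis′ Q′ tl′ vis″ Q″ tl″ → Grow vis Q tl vis″ Q″ tl″
  Grow-trans g h = record
    { longer = ≤-trans (longer g) (longer h)
    ; prefix = λ i< → trans (prefix h (<-≤-trans i< (longer g))) (prefix g i<)
    ; mono   = mono h ∘ mono g
    }

  push-grow : ∀ vis Q tl v → Grow vis Q tl (update vis v 1) (update Q tl v) (tl + 1)
  push-grow vis Q tl v = record
    { longer = m≤m+n tl 1
    ; prefix = λ {i} i<tl → update-other Q tl v i (<⇒≢ i<tl ∘ sym)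
    ; mono   = λ {x} → mono′ x
    }
    where
    mono′ : ∀ x → vis x ≡ 1 → update vis v 1 x ≡ 1
    mono′ x e with v ≟ x
    ... | yes refl = update-same vis v 1
    ... | no v≢x   = trans (update-other vis v 1 x v≢x) e

  push-queue : ∀ {vis Q tl v} → Queue vis Q tl → v < n → vis v ≡ 0 → Forced v →
    Queue (update vis v 1) (update Q tl v) (tl + 1)
  push-queue {vis} {Q} {tl} {v} q v<n new fv = record
    { binary = λ {x} x<n → binary′ x x<n
    ; entry  = λ {i} i< → entry′ i i<
    ; index  = λ {x} → index′ x
    ; total  = +-cancelʳ-≡ 0 (sumTo n vis′) (tl + 1)
        (trans (cong (sumTo n vis′ +_) (sym new)) (trans (sym (sumTo-change n vis vis′ v<n other))
          (trans (cong₂ _+_ total (update-same vis v 1)) (sym (+-identityʳ (tl + 1))))))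
    ; weight = weight′
    ; forced = λ {x} → forced′ x
    }
    where
    open Queue q
    open ≡-Reasoning
    vis′ = update vis v 1
    Q′   = update Q tl v
    other : ∀ i → i < n → i ≢ v → vis i ≡ vis′ i
    other i _ i≢v = sym (update-other vis v 1 i (i≢v ∘ sym))
    binary′ : ∀ x → x < n → vis′ x ≡ 0 ⊎ vis′ x ≡ 1
    binary′ x x<n with v ≟ x
    ... | yes refl = inj₂ (update-same vis v 1)
    ... | no v≢x rewrite update-other vis v 1 x v≢x = binary x<n
    entry′ : ∀ i → i < tl + 1 → Q′ i < n × vis′ (Q′ i) ≡ 1
    entry′ i i< with tl ≟ i
    ... | yes refl rewrite update-same Q tl v = v<n , update-same vis v 1
    ... | no tl≢i rewrite update-other Q tl v i tl≢i =
      let i<tl = ≤∧≢⇒< (≤-pred (subst (suc i ≤_) (+-comm tl 1) i<)) (tl≢i ∘ sym)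
      in proj₁ (entry i<tl) , mono (push-grow vis Q tl v) (proj₂ (entry i<tl))
    index′ : ∀ x → x < n → vis′ x ≡ 1 → ∃[ i ] (i < tl + 1 × Q′ i ≡ x)
    index′ x x<n e with v ≟ x
    ... | yes refl = tl , m<m+n tl (s≤s z≤n) , update-same Q tl v
    ... | no v≢x with index x<n (trans (sym (update-other vis v 1 x v≢x)) e)
    ... | i , i<tl , refl = i , <-≤-trans i<tl (m≤m+n tl 1) , prefix (push-grow vis Q tl v) i<tl
    forced′ : ∀ x → x < n → vis′ x ≡ 1 → Forced x
    forced′ x x<n e with v ≟ x
    ... | yes refl = fv
    ... | no v≢x   = forced x<n (trans (sym (update-other vis v 1 x v≢x)) e)
    sumQ = sumTo tl (λ i → w (Q i))
    g g′ : ℕ → ℕ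
    g  x = (1 ∸ vis x) * w x
    g′ x = (1 ∸ vis′ x) * w x
    drop : sumTo n g ≡ sumTo n g′ + w v
    drop = begin
      sumTo n g          ≡⟨ sym (+-identityʳ (sumTo n g)) ⟩
      sumTo n g + 0      ≡⟨ cong (λ z → sumTo n g + (1 ∸ z) * w v) (sym (update-same vis v 1)) ⟩
      sumTo n g + g′ v   ≡⟨ sumTo-change n g g′ v<n (λ i i<n i≢v → cong (λ z → (1 ∸ z) * w i) (other i i<n i≢v)) ⟩
      sumTo n g′ + g v   ≡⟨ cong (λ z → sumTo n g′ + (1 ∸ z) * w v) new ⟩
      sumTo n g′ + 1 * w v ≡⟨ cong (sumTo n g′ +_) (*-identityˡ (w v)) ⟩
      sumTo n g′ + w v   ∎
    weight′ : sumTo (tl + 1) (λ i → w (Q′ i)) + sumTo n g′ ≡ sumTo n w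
    weight′ = begin
      sumTo (tl + 1) (λ i → w (Q′ i)) + sumTo n g′
        ≡⟨ cong (λ k → sumTo k (λ i → w (Q′ i)) + sumTo n g′) (+-comm tl 1) ⟩
      sumTo tl (λ i → w (Q′ i)) + w (Q′ tl) + sumTo n g′
        ≡⟨ cong₂ (λ x y → x + w y + sumTo n g′)
             (sumTo-cong tl λ i i<tl → cong w (prefix (push-grow vis Q tl v) i<tl)) (update-same Q tl v) ⟩
      sumQ + w v + sumTo n g′
        ≡⟨ shuffle sumQ (w v) (sumTo n g′) ⟩
      sumQ + (sumTo n g′ + w v)
        ≡⟨ cong (sumQ +_) (sym drop) ⟩
      sumQ + sumTo n g
        ≡⟨ weight ⟩
      sumTo n w ∎
      where
      shuffle : ∀ a b c → a + b + c ≡ a + (c + b)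
      shuffle = solve-∀

  empty-queue : ∀ {vis Q} → (∀ {v} → v < n → vis v ≡ 0) → Queue vis Q 0
  empty-queue {vis} none = record
    { binary = λ v<n → inj₁ (none v<n)
    ; entry  = λ ()
    ; index  = λ v<n e → ⊥-elim (0≢1+n (trans (sym (none v<n)) e))
    ; total  = trans (sumTo-cong n λ i i<n → none i<n) (trans (sumTo-const n 0) (*-zeroʳ n))
    ; weight = sumTo-cong n λ i i<n → trans (cong (λ z → (1 ∸ z) * w i) (none i<n)) (*-identityˡ (w i))
    ; forced = λ v<n e → ⊥-elim (0≢1+n (trans (sym (none v<n)) e))
    }

  -- Every unvisited vertex is on the list of its type, but a list may also hold visited ones. Hence
  -- visiting a vertex requires no deletion.
  record Lists (vis len L : ℕ → ℕ) : Set where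
    field
      member  : ∀ {t v} → t < 5 → v < n → vis v ≡ 0 → types₂ v ≡ t → ∃[ i ] (i < len t × L (t * n + i) ≡ v)
      entries : ∀ {t i} → t < 5 → i < len t → L (t * n + i) < n × types₂ (L (t * n + i)) ≡ t
      bounded : ∀ {t} → t < 5 → len t ≤ n

  -- `rest` is the weight of the vertices that have not been processed. The potential charges for it
  -- and for all entries still on lists, visited or not, as any of them may be scanned.
  record Main (K : ℕ) (vis Q L len : ℕ → ℕ) (tl hd φ : ℕ) : Set where
    field
      queue     : Queue vis Q tl
      hd≤tl     : hd ≤ tl
      scanned   : ∀ {i v} → i < hd → v < n → Forces (Q i) v → vis v ≡ 1
      lists     : Lists vis len L
      seed-a    : vis a₁ ≡ 1
      seed-b    : vis b₁ ≡ 1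
      seed-c    : vis c ≡ 1
      rest      : ℕ
      rest-sum  : sumTo hd (λ i → w (Q i)) + rest ≡ sumTo n w
      potential : φ ≡ K * (rest + sumTo 5 len)

  record Result (vis : ℕ → ℕ) (tl : ℕ) : Set where
    field
      closed : Closed a₁ a₂ b₁ b₂ (λ v → vis v ≡ᵇ 1)
      queue  : ∃[ Q ] Queue vis Q tl
      seed-a : vis a₁ ≡ 1
      seed-b : vis b₁ ≡ 1
      seed-c : vis c ≡ 1

  finished : ∀ {K vis Q L len tl hd φ} → Main K vis Q L len tl hd φ → tl ≤ hd → Result vis tl
  finished {vis = vis} {Q} {tl = tl} {hd} m tl≤hd = record
    { closed = closed ; queue = Q , queue ; seed-a = seed-a ; seed-b = seed-b ; seed-c = seed-c }
    where
    open Main m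
    open Queue queue
    closed : Closed a₁ a₂ b₁ b₂ (λ v → vis v ≡ᵇ 1)
    closed u v u<n v<n vu st with index u<n (≡ᵇ-true vu)
    ... | i , i<tl , refl = ≡⇒≡ᵇ-true (scanned (<-≤-trans i<tl tl≤hd) v<n st)

  -- One round: u = Q hd is processed, pushing what it forces and rebuilding the list of its type.
  module Round {K vis₀ Q₀ L₀ len₀ tl₀ hd φ} (m : Main K vis₀ Q₀ L₀ len₀ tl₀ hd φ) (hd<tl : hd < tl₀) where
    open Main m
    open Queue queue

    u t : ℕ
    u = Q₀ hd
    t = types₁ u

    u<n : u < n
    u<n = proj₁ (entry hd<tl)

    forced-u : Forced u
    forced-u = forced u<n (proj₂ (entry hd<tl))

    t<5 : t < 5
    t<5 = m<n⇒m<1+n (typeL<4 (E u a₂) (E u b₂))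

    far-forced : ∀ {v} → v < n → types₂ v ≡ t → E u v ≡ false → Forces u v
    far-forced v<n tv Euv eq with () ← trans (sym Euv) (trans eq (≡⇒≡ᵇ-true (sym tv)))

    near-forced : ∀ {v} → v < n → types₂ v ≢ t → E u v ≡ true → Forces u v
    near-forced v<n tv Euv eq with () ← trans (sym Euv) (trans eq (≢⇒≡ᵇ-false (tv ∘ sym)))

    record ListScan (i : ℕ) (vis Q : ℕ → ℕ) (tl : ℕ) : Set where
      field
        queue  : Queue vis Q tl
        grow   : Grow vis₀ Q₀ tl₀ vis Q tl
        pushed : ∀ {j} → j < i → E u (L₀ (t * n + j)) ≡ false → vis (L₀ (t * n + j)) ≡ 1

    record RowScan (nbr : ℕ → ℕ) (j : ℕ) (vis Q L : ℕ → ℕ) (tl l : ℕ) : Set where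
      field
        queue   : Queue vis Q tl
        grow    : Grow vis₀ Q₀ tl₀ vis Q tl
        far     : ∀ {j} → j < len₀ t → E u (L₀ (t * n + j)) ≡ false → vis (L₀ (t * n + j)) ≡ 1
        l≤j     : l ≤ j
        entries : ∀ {i} → i < l → L (t * n + i) < n × types₂ (L (t * n + i)) ≡ t
        kept    : ∀ {i} → i < j → types₂ (nbr (u * n + i)) ≡ t →
                  ∃[ k ] (k < l × L (t * n + k) ≡ nbr (u * n + i))
        pushed  : ∀ {i} → i < j → types₂ (nbr (u * n + i)) ≢ t → vis (nbr (u * n + i)) ≡ 1
        other   : ∀ {t′ i} → t′ ≢ t → i < n → L (t′ * n + i) ≡ L₀ (t′ * n + i)

    -- The neighbours of `u` of type `t` form a valid new list: a non-neighbour of type `t` was on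
    -- the old list unless visited before, and the scan of that list has pushed it.
    next : ∀ {nbr vis Q L tl l} d →
      (∀ {v} → v < n → E u v ≡ true → ∃[ i ] (i < d × nbr (u * n + i) ≡ v)) →
      d ≤ n → RowScan nbr d vis Q L tl l →
      ∃[ r ] (w u + r ≡ rest ×
        Main K vis Q L (update len₀ t l) tl (hd + 1) (K * (r + sumTo 5 (update len₀ t l))))
    next {nbr} {vis} {Q} {L} {tl} {l} d row d≤n rs with spent
      where
      before : sumTo hd (λ i → w (Q i)) ≡ sumTo hd (λ i → w (Q₀ i))
      before = sumTo-cong hd λ i i<hd → cong w (prefix (RowScan.grow rs) (<-trans i<hd hd<tl))
      -- The entry at `hd` precedes the tail of the queue, and by `weight` the entries up to the
      -- tail weigh at most as much as all vertices. So `w u` can be taken out of `rest`.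
      suc≤ : sumTo (suc hd) (λ i → w (Q i)) ≤ sumTo n w
      suc≤ = ≤-trans (sumTo-extend (λ i → w (Q i)) (≤-trans hd<tl (longer (RowScan.grow rs))))
               (≤-trans (m≤m+n _ _) (≤-reflexive (Queue.weight (RowScan.queue rs))))
      spent : ∃[ r ] (w u + r ≡ rest × sumTo (hd + 1) (λ i → w (Q i)) + r ≡ sumTo n w)
      spent = r , +-cancelˡ-≡ (sumTo hd (λ i → w (Q₀ i))) _ _ (trans
                 (trans (sym (+-assoc (sumTo hd (λ i → w (Q₀ i))) (w u) r))
                   (cong (_+ r) (cong₂ _+_ (sym before) (cong w (sym (prefix (RowScan.grow rs) hd<tl))))))
                 (trans e (sym rest-sum)))
               , trans (cong (λ k → sumTo k (λ i → w (Q i)) + r) (+-comm hd 1)) e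
        where
        r = sumTo n w ∸ sumTo (suc hd) (λ i → w (Q i))
        e : sumTo (suc hd) (λ i → w (Q i)) + r ≡ sumTo n w
        e = m+[n∸m]≡n suc≤
    ... | r , wr , sr = r , wr , record
      { queue     = R.queue
      ; hd≤tl     = ≤-trans (≤-reflexive (+-comm hd 1)) (≤-trans hd<tl (longer R.grow))
      ; scanned   = scanned′
      ; lists     = record { member = member′ ; entries = entries′ ; bounded = bounded′ }
      ; seed-a    = mono R.grow seed-a
      ; seed-b    = mono R.grow seed-b
      ; seed-c    = mono R.grow seed-c
      ; rest      = r
      ; rest-sum  = sr
      ; potential = refl
      }
      where
      module R = RowScan rs
      module V = Queue R.queue
      len = update len₀ t l
      same : len t ≡ l
      same = update-same len₀ t l
      -- An unvisited vertex of the type of `u` must now be adjacent to `u`. Both the completeness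
      -- of the new list and the absence of forced unvisited vertices of this type follow from this.
      near : ∀ {v} → v < n → vis v ≡ 0 → types₂ v ≡ t → E u v ≡ true
      near {v} v<n new tv with E u v in eq
      ... | true  = refl
      ... | false with binary v<n
      ... | inj₂ old with () ← trans (sym new) (mono R.grow old)
      ... | inj₁ new₀ with Lists.member lists t<5 v<n new₀ tv
      ... | i , i< , refl with () ← trans (sym new) (R.far i< eq)
      scanned′ : ∀ {i v} → i < hd + 1 → v < n → Forces (Q i) v → vis v ≡ 1
      scanned′ {i} {v} i< v<n st with i ≟ hd
      ... | no i≢hd = mono R.grow (scanned i<hd v<n (subst (λ x → Forces x v) (prefix R.grow (<-trans i<hd hd<tl)) st))
        where
        i<hd : i < hd
        i<hd = ≤∧≢⇒< (≤-pred (subst (suc i ≤_) (+-comm hd 1) i<)) i≢hd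
      ... | yes refl with V.binary v<n
      ... | inj₂ e = e
      ... | inj₁ new with types₂ v ≟ t
      ... | yes tv = ⊥-elim (st′ (trans (near v<n new tv) (sym (≡⇒≡ᵇ-true (sym tv)))))
        where
        st′ : Forces u v
        st′ = subst (λ x → Forces x v) (prefix R.grow hd<tl) st
      ... | no tv with E u v in eq
      ... | true with row v<n eq
      ...   | i , i<d , refl = R.pushed i<d tv
      scanned′ {i} {v} i< v<n st | yes refl | inj₁ new | no tv | false =
        ⊥-elim (subst (λ x → Forces x v) (prefix R.grow hd<tl) st (trans eq (sym (≢⇒≡ᵇ-false (tv ∘ sym)))))
      member′ : ∀ {t′ v} → t′ < 5 → v < n → vis v ≡ 0 → types₂ v ≡ t′ → ∃[ i ] (i < len t′ × L (t′ * n + i) ≡ v)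
      member′ {t′} {v} t′<5 v<n new tv with t ≟ t′
      ... | yes refl with row v<n (near v<n new tv)
      ...   | i , i<d , refl with R.kept i<d tv
      ...     | k , k<l , e = k , subst (k <_) (sym same) k<l , e
      member′ {t′} {v} t′<5 v<n new tv | no t≢ with binary v<n
      ... | inj₂ old with () ← trans (sym new) (mono R.grow old)
      ... | inj₁ new₀ with Lists.member lists t′<5 v<n new₀ tv
      ... | i , i< , e = i , subst (i <_) (sym (update-other len₀ t l t′ t≢)) i<
            , trans (R.other (t≢ ∘ sym) (<-≤-trans i< (Lists.bounded lists t′<5))) e
      entries′ : ∀ {t′ i} → t′ < 5 → i < len t′ → L (t′ * n + i) < n × types₂ (L (t′ * n + i)) ≡ t′
      entries′ {t′} {i} t′<5 i< with t ≟ t′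
      ... | yes refl = R.entries (subst (i <_) same i<)
      ... | no t≢ = let i<₀ = subst (i <_) (update-other len₀ t l t′ t≢) i<
                        e = R.other (t≢ ∘ sym) (<-≤-trans i<₀ (Lists.bounded lists t′<5))
                    in subst (λ x → x < n × types₂ x ≡ t′) (sym e) (Lists.entries lists t′<5 i<₀)
      bounded′ : ∀ {t′} → t′ < 5 → len t′ ≤ n
      bounded′ {t′} t′<5 with t ≟ t′
      ... | yes refl = subst (_≤ n) (sym same) (≤-trans R.l≤j d≤n)
      ... | no t≢    = subst (_≤ n) (sym (update-other len₀ t l t′ t≢)) (Lists.bounded lists t′<5)

update-extend : ∀ (P : ℕ → ℕ → Set) {f : ℕ → ℕ} {i w} →
  (∀ {v} → v < i → P v (f v)) → P i w → ∀ {v} → v < suc i → P v (update f i w v)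
update-extend P {f} {i} {w} before now {v} v<1+i with i ≟ v
... | yes refl = subst (P v) (sym (update-same f v w)) now
... | no i≢v   = subst (P v) (sym (update-other f i w v i≢v)) (before (≤∧≢⇒< (≤-pred v<1+i) (i≢v ∘ sym)))

-- The closure program: correctness and running time

module Setting (n : ℕ) (E : ℕ → ℕ → Bool) (E-sym : ∀ u v → E u v ≡ E v u)
               (W : ℕ) (big : n * n + (5 * n + 9) ≤ W) where

  open Logic W (≤-trans (m≤n+m 9 (n * n + 5 * n)) (≤-trans (≤-reflexive (+-assoc (n * n) (5 * n) 9)) big)) public

  -- In the bound on `W` the summand `n * n` is for cells of the matrix, `5 * n` for the cells of
  -- the five lists, and 9 for literals and small offsets.
  fits-linear : ∀ {x} → x ≤ 5 * n + 8 → x < W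
  fits-linear {x} x≤ = begin-strict
    x                     ≤⟨ x≤ ⟩
    5 * n + 8             <⟨ +-monoʳ-< (5 * n) ≤-refl ⟩
    5 * n + 9             ≤⟨ m≤n+m (5 * n + 9) (n * n) ⟩
    n * n + (5 * n + 9)   ≤⟨ big ⟩
    W                     ∎
    where open ≤-Reasoning

  fits-small : ∀ {x} k {_ : T (k <ᵇ 9)} → x ≤ k → x < W
  fits-small k {k<9} x≤k = fits-linear (≤-trans x≤k (≤-trans (≤-pred (<ᵇ⇒< k 9 k<9)) (m≤n+m 8 (5 * n))))

  fits-square : ∀ {x} → x ≤ n * n → x < W
  fits-square {x} x≤ = begin-strict
    x                     ≤⟨ x≤ ⟩
    n * n                 <⟨ m<m+n (n * n) (s≤s z≤n) ⟩
    n * n + 9             ≤⟨ +-monoʳ-≤ (n * n) (m≤n+m 9 (5 * n)) ⟩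
    n * n + (5 * n + 9)   ≤⟨ big ⟩
    W                     ∎
    where open ≤-Reasoning

  fits-vertex : ∀ {x} → x ≤ n → x < W
  fits-vertex {x} x≤ = fits-linear (≤-trans x≤ (≤-trans (m≤m+n n (4 * n)) (m≤m+n (5 * n) 8)))

  fits-next : ∀ {x} → x ≤ n → x + 1 < W
  fits-next {x} x≤ = fits-linear (+-mono-≤ (≤-trans x≤ (m≤m+n n (4 * n))) (s≤s z≤n))

  fits-cell : ∀ {u v} → u < n → v < n → u * n + v < W
  fits-cell {u} u<n v<n = fits-square (<⇒≤ (cell-< u u<n v<n))

  fits-row : ∀ {u} → u < n → u * n < W
  fits-row u<n = fits-square (*-monoˡ-≤ n (<⇒≤ u<n))

  fits-list : ∀ {t i} → t < 5 → i < n → t * n + i < W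
  fits-list {t} t<5 i<n = fits-linear (≤-trans (<⇒≤ (cell-< t t<5 i<n)) (m≤m+n (5 * n) 8))

  record Adjacency (n₀ : ℕ) (M deg nbr : ℕ → ℕ) : Set where
    field
      size     : n₀ ≡ n
      cell     : ∀ {u v} → u < n → v < n → M (u * n + v) ≡ bit (E u v)
      degree   : ∀ {u} → u < n → deg u ≡ sumTo n (λ v → bit (E u v))
      near     : ∀ {u i} → u < n → i < deg u → nbr (u * n + i) < n × E u (nbr (u * n + i)) ≡ true
      listed   : ∀ {u v} → u < n → v < n → E u v ≡ true → ∃[ i ] (i < deg u × nbr (u * n + i) ≡ v)

    degree≤n : ∀ {u} → u < n → deg u ≤ n
    degree≤n {u} u<n = ≤-trans (≤-reflexive (degree u<n))
      (≤-trans (sumTo-mono n λ i _ → bit≤1 (E u i)) (≤-reflexive (trans (sumTo-const n 1) (*-identityʳ n))))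

  Adjacent-lists : State → Set
  Adjacent-lists s = Adjacency (reg s 0) (arr s 0) (arr s 2) (arr s 3)

  keep-graph : ∀ {p s s′} → Frame p s s′ → {NotReg p 0 × NotArr p 0 × NotArr p 2 × NotArr p 3} →
    Adjacent-lists s → Adjacent-lists s′
  keep-graph f {k₀ , k₁ , k₂ , k₃} a
    rewrite regF f 0 (T-not k₀) | arrF f 0 (T-not k₁) | arrF f 2 (T-not k₂) | arrF f 3 (T-not k₃) = a

  -- The summand 1 pays for the fixed cost of processing v, and twice its degree for scanning
  -- its row and for the list that replaces the list of its type.
  weight : ℕ → ℕ
  weight v = 1 + 2 * sumTo n (λ x → bit (E v x))

  edgeEnds : ℕ
  edgeEnds = sumTo n (λ v → sumTo n (λ x → bit (E v x)))

  -- The main loop accounts for 16 * (n + 2 * `edgeEnds` + 5 * n), from the total weight and at most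
  -- n entries on each of five lists. The remaining 28 * n is for computing the types and filling
  -- the lists.
  closureTime : ℕ
  closureTime = 42 + 124 * n + 32 * edgeEnds

  module Closing {a₁ a₂ b₁ b₂ c : ℕ} (a₁<n : a₁ < n) (a₂<n : a₂ < n) (b₁<n : b₁ < n) (b₂<n : b₂ < n) (c<n : c < n) where

    open Joins n E E-sym
    open Closures n E E-sym a₁ a₂ b₁ b₂ c weight

    record Seeds (r₄ r₅ r₆ r₇ r₈ : ℕ) : Set where
      constructor seeds
      field
        r₄≡ : r₄ ≡ a₁
        r₅≡ : r₅ ≡ a₂
        r₆≡ : r₆ ≡ b₁
        r₇≡ : r₇ ≡ b₂
        r₈≡ : r₈ ≡ c

    HasSeeds : State → Set
    HasSeeds s = Seeds (reg s 4) (reg s 5) (reg s 6) (reg s 7) (reg s 8)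

    keep-seeds : ∀ {p s s′} → Frame p s s′ → {NotReg p 4 × NotReg p 5 × NotReg p 6 × NotReg p 7 × NotReg p 8} →
      HasSeeds s → HasSeeds s′
    keep-seeds f {k₄ , k₅ , k₆ , k₇ , k₈} h rewrite regF f 4 (T-not k₄) | regF f 5 (T-not k₅) | regF f 6 (T-not k₆)
      | regF f 7 (T-not k₇) | regF f 8 (T-not k₈) = h

    record Typed (k : ℕ) (t₁ t₂ : ℕ → ℕ) : Set where
      field
        typed₁ : ∀ {v} → v < k → t₁ v ≡ types₁ v
        typed₂ : ∀ {v} → v < k → t₂ v ≡ types₂ v
    open Typed

    HasTypes : State → Set
    HasTypes s = Typed n (arr s 11) (arr s 12)

    keep-types : ∀ {p s s′} → Frame p s s′ → {NotArr p 11 × NotArr p 12} → HasTypes s → HasTypes s′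
    keep-types f {k₁ , k₂} h rewrite arrF f 11 (T-not k₁) | arrF f 12 (T-not k₂) = h

    typesTime : ℕ
    typesTime = suc (suc (n * suc (17 + 1)))

    types-run : ∀ {s} → Adjacent-lists s → HasSeeds s →
      Run typesP s typesTime (λ s′ → HasTypes s′ × (∀ {v} → v < n → arr s′ 9 v ≡ 0))
    types-run {s₀} adj₀ sd₀ = forR n 17 J (fits-vertex ≤-refl)
      (λ s f → trans (regF f 0 refl) (Adjacency.size adj₀)) refl body
      (record { typed₁ = λ () ; typed₂ = λ () } , λ ())
      (λ s f j → j)
      where
      J : ℕ → State → Set
      J i s = Typed i (arr s 11) (arr s 12) × (∀ {v} → v < i → arr s 9 v ≡ 0)
      body : ∀ i s → i < n → Frame typesP s₀ s → Small W s → reg s 9 ≡ i → J i s → Run _ s 17 (λ s′ → J (suc i) (setReg s′ 9 (suc i)))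
      body i s i<n f sm ri (ty , z) =
        put i 0 ri refl tt
        (set (i * n) (cong₂ _*_ ri A.size) (fits-row i<n)
        (set (i * n + a₂) (cong (i * n +_) r₅≡) (fits-cell i<n a₂<n)
        (set (bit (E i a₂)) (A.cell i<n a₂<n) tt
        (set (i * n + b₂) (cong (i * n +_) r₇≡) (fits-cell i<n b₂<n)
        (set (bit (E i b₂)) (A.cell i<n b₂<n) tt
        (set (2 * bit (E i b₂)) refl (fits-small 2 (*-monoʳ-≤ 2 (bit≤1 (E i b₂))))
        (set (types₁ i) refl (fits-small 4 (<⇒≤ (typeL<4 (E i a₂) (E i b₂))))
        (put i (types₁ i) ri refl tt
        (set (i * n + a₁) (cong (i * n +_) r₄≡) (fits-cell i<n a₁<n)
        (set (bit (E i a₁)) (A.cell i<n a₁<n) tt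
        (set (i * n + b₁) (cong (i * n +_) r₆≡) (fits-cell i<n b₁<n)
        (set (bit (E i b₁)) (A.cell i<n b₁<n) tt
        (condR
          (λ eq → storeR i 4 ri refl tt (done (sym (choose eq))))
          (λ ne → set (2 * bit (E i b₁)) refl (fits-small 2 (*-monoʳ-≤ 2 (bit≤1 (E i b₁))))
                 (set (typeL (E i a₁) (E i b₁)) refl (fits-small 4 (<⇒≤ (typeL<4 (E i a₁) (E i b₁))))
                 (storeR i (typeL (E i a₁) (E i b₁)) ri refl tt (done (sym (choose ne)))))))))))))))))))
        where
        module A = Adjacency (keep-graph f adj₀)
        open Seeds (keep-seeds f sd₀)
        choose : ∀ {b} → (bit (E i a₁) ≡ᵇ bit (E i b₁)) ≡ b → types₂ i ≡ (if b then 4 else typeL (E i a₁) (E i b₁))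
        choose = cong (λ b → if b then 4 else typeL (E i a₁) (E i b₁))
        done : ∀ {x} → x ≡ types₂ i →
          Typed (suc i) (update (arr s 11) i (types₁ i)) (update (arr s 12) i x) × (∀ {v} → v < suc i → update (arr s 9) i 0 v ≡ 0)
        done e = record { typed₁ = update-extend (λ v x → x ≡ types₁ v) (typed₁ ty) refl
                        ; typed₂ = update-extend (λ v x → x ≡ types₂ v) (typed₂ ty) e }
               , update-extend (λ v x → x ≡ 0) z refl

    record Built (i : ℕ) (L len : ℕ → ℕ) : Set where
      field
        member  : ∀ {t v} → t < 5 → v < i → types₂ v ≡ t → ∃[ k ] (k < len t × L (t * n + k) ≡ v)
        entries : ∀ {t k} → t < 5 → k < len t → L (t * n + k) < n × types₂ (L (t * n + k)) ≡ t
        bounded : ∀ {t} → t < 5 → len t ≤ i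

    types₂<5 : ∀ v → types₂ v < 5
    types₂<5 v = typeR<5 (E v a₁) (E v b₁)

    -- A list holds at most `i` < n entries, so the new cell lies within the block of its type: it
    -- differs from cells of other blocks by `cell-injective` and from older cells of its own block
    -- by the offset.
    built-step : ∀ {i L len} → i < n → Built i L len →
      Built (suc i) (update L (types₂ i * n + len (types₂ i)) i) (update len (types₂ i) (len (types₂ i) + 1))
    built-step {i} {L} {len} i<n b = record { member = member′ ; entries = entries′ ; bounded = bounded′ }
      where
      open Built b
      t = types₂ i
      l = len t
      l<n : l < n
      l<n = ≤-<-trans (bounded (types₂<5 i)) i<n
      L′ = update L (t * n + l) i
      len′ = update len t (l + 1)
      apart : ∀ {t′ k} → t′ < 5 → k < len t′ → t * n + l ≢ t′ * n + k
      apart {t′} {k} t′<5 k< e with cell-injective t t′ l<n (<-trans (<-≤-trans k< (bounded t′<5)) i<n) e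
      ... | refl = <⇒≢ k< (sym (+-cancelˡ-≡ (t * n) l k e))
      old : ∀ {t′ k} → t′ < 5 → k < len t′ → L′ (t′ * n + k) ≡ L (t′ * n + k)
      old t′<5 k< = update-other L (t * n + l) i _ (apart t′<5 k<)
      len≤ : ∀ t′ → len t′ ≤ len′ t′
      len≤ t′ with t ≟ t′
      ... | yes refl = ≤-trans (m≤m+n l 1) (≤-reflexive (sym (update-same len t (l + 1))))
      ... | no t≢    = ≤-reflexive (sym (update-other len t (l + 1) t′ t≢))
      member′ : ∀ {t′ v} → t′ < 5 → v < suc i → types₂ v ≡ t′ → ∃[ k ] (k < len′ t′ × L′ (t′ * n + k) ≡ v)
      member′ {t′} {v} t′<5 v< tv with v ≟ i
      ... | no v≢i with member t′<5 (≤∧≢⇒< (≤-pred v<) v≢i) tv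
      ...   | k , k< , e = k , <-≤-trans k< (len≤ t′) , trans (old t′<5 k<) e
      member′ t′<5 v< refl | yes refl =
        l , ≤-trans (m<m+n l (s≤s z≤n)) (≤-reflexive (sym (update-same len t (l + 1)))) , update-same L (t * n + l) i
      entries′ : ∀ {t′ k} → t′ < 5 → k < len′ t′ → L′ (t′ * n + k) < n × types₂ (L′ (t′ * n + k)) ≡ t′
      entries′ {t′} {k} t′<5 k< with t ≟ t′
      ... | no t≢ = let k<₀ = subst (k <_) (update-other len t (l + 1) t′ t≢) k<
                    in subst (λ x → x < n × types₂ x ≡ t′) (sym (old t′<5 k<₀)) (entries t′<5 k<₀)
      ... | yes refl with k ≟ l
      ...   | yes refl = subst (λ x → x < n × types₂ x ≡ t) (sym (update-same L (t * n + l) i)) (i<n , refl)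
      ...   | no k≢l = let k<₀ = ≤∧≢⇒< (≤-pred (subst (k <_) (trans (update-same len t (l + 1)) (+-comm l 1)) k<)) k≢l
                       in subst (λ x → x < n × types₂ x ≡ t′) (sym (old t′<5 k<₀)) (entries t′<5 k<₀)
      bounded′ : ∀ {t′} → t′ < 5 → len′ t′ ≤ suc i
      bounded′ {t′} t′<5 with t ≟ t′
      ... | yes refl = ≤-trans (≤-reflexive (trans (update-same len t (l + 1)) (+-comm l 1))) (s≤s (bounded t′<5))
      ... | no t≢    = ≤-trans (≤-reflexive (update-other len t (l + 1) t′ t≢)) (m≤n⇒m≤1+n (bounded t′<5))

    listsTime : ℕ
    listsTime = 12 + 5 + (suc (suc (n * suc (7 + 1))))

    lists-run : ∀ {s} → Adjacent-lists s → HasTypes s →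
      Run listsP s listsTime (λ s′ → Built n (arr s′ 13) (arr s′ 14))
    lists-run {s₀} adj₀ ht₀ = seqR
      (forR 5 1 (λ i s → ∀ t → t < i → arr s 14 t ≡ 0) (fits-small 5 ≤-refl) (λ _ _ → refl) refl
        (λ i s i<5 f sm ri z → storeR i 0 ri refl tt (λ t → update-extend (λ _ x → x ≡ 0) (z _) refl))
        (λ _ ())
        (λ s f z → forR n 7 (λ i s → Built i (arr s 13) (arr s 14)) (fits-vertex ≤-refl)
          (λ s′ f′ → trans (regF f′ 0 refl) (trans (regF f 0 refl) (Adjacency.size adj₀))) refl
          (λ i s′ i<n f′ → body s (keep-graph f adj₀) (keep-types f ht₀) i s′ i<n f′)
          (record { member = λ _ () ; entries = λ {t} {k} t<5 k< → ⊥-elim (n≮0 (subst (k <_) (z _ t<5) k<)) ; bounded = λ t<5 → ≤-reflexive (z _ t<5) })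
          (λ _ _ b → b)))
      where
      body : ∀ s₁ → Adjacent-lists s₁ → HasTypes s₁ → ∀ i s → i < n → Frame fillListsP s₁ s → Small W s → reg s 9 ≡ i →
        Built i (arr s 13) (arr s 14) → Run _ s 7 (λ s′ → Built (suc i) (arr s′ 13) (arr s′ 14))
      body s₁ adj ht i s i<n f sm ri b =
        set t (trans (cong (arr s 12) ri) (typed₂ (keep-types f ht) i<n)) tt
        (set l refl tt
        (set (t * n) (cong (t *_) A.size) (fits-linear (≤-trans (*-monoˡ-≤ n (<⇒≤ (types₂<5 i))) (m≤m+n (5 * n) 8)))
        (set (t * n + l) refl (fits-list (types₂<5 i) l<n)
        (put (t * n + l) i refl ri tt
        (set (l + 1) refl (fits-next (<⇒≤ l<n))
        (storeR t (l + 1) refl refl tt (built-step i<n b)))))))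
        where
        module A = Adjacency (keep-graph f adj)
        t = types₂ i
        l = arr s 14 t
        l<n : l < n
        l<n = ≤-<-trans (Built.bounded b (types₂<5 i)) i<n

    QueueOf : State → Set
    QueueOf s = Queue (arr s 9) (arr s 10) (reg s 11)

    push-run : ∀ {s v} → reg s 9 ≡ v → v < n → Forced v → QueueOf s →
      Run pushP s 5 (λ s′ → QueueOf s′ × Grow (arr s 9) (arr s 10) (reg s 11) (arr s′ 9) (arr s′ 10) (reg s′ 11) × arr s′ 9 v ≡ 1)
    push-run {s} {v} rv v<n fv q =
      set (arr s 9 v) (cong (arr s 9) rv) tt
      (condR
        (λ new → put v 1 rv refl tt
                (put (reg s 11) v refl rv tt
                (assignR (reg s 11 + 1) refl (fits-next (Queue.tl≤n q))
                  (push-queue q v<n (≡ᵇ-true new) fv , push-grow _ _ _ v , update-same (arr s 9) v 1))))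
        (λ old → skipR (q , Grow-refl , visited (Queue.binary q v<n) old)))
      where
      visited : ∀ {x} → x ≡ 0 ⊎ x ≡ 1 → (x ≡ᵇ 0) ≡ false → x ≡ 1
      visited (inj₂ e) _ = e
      visited (inj₁ refl) ()

    bit-zero : ∀ b → (bit b ≡ᵇ 0) ≡ true → b ≡ false
    bit-zero false _ = refl

    bit-nonzero : ∀ b → (bit b ≡ᵇ 0) ≡ false → b ≡ true
    bit-nonzero true _ = refl

    split-last : ∀ {P : ℕ → Set} {i} → (∀ {j} → j < i → P j) → P i → ∀ {j} → j < suc i → P j
    split-last before now = below-suc (λ _ → before) now _

    module RoundRun {K vis₀ Q₀ L₀ len₀ tl₀ hd φ} (m : Main K vis₀ Q₀ L₀ len₀ tl₀ hd φ) (hd<tl : hd < tl₀) where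
      open Round m hd<tl

      scan-list-run : ∀ {s₀} → Adjacent-lists s₀ → arr s₀ 13 ≡ L₀ →
        reg s₀ 15 ≡ t * n → reg s₀ 16 ≡ len₀ t → reg s₀ 18 ≡ u * n →
        ListScan 0 (arr s₀ 9) (arr s₀ 10) (reg s₀ 11) →
        Run scanListP s₀ (suc (suc (len₀ t * suc (10 + 1)))) (λ s → ListScan (len₀ t) (arr s 9) (arr s 10) (reg s 11))
      scan-list-run {s₀} adj₀ lists≡ r₁₅ r₁₆ r₁₈ j₀ =
        forR (len₀ t) 10 (λ i s → ListScan i (arr s 9) (arr s 10) (reg s 11)) (fits-vertex (Lists.bounded (Main.lists m) t<5))
          (λ s f → trans (regF f 16 refl) r₁₆) refl body j₀ (λ _ _ j → j)
        where
        body : ∀ i s → i < len₀ t → Frame scanListP s₀ s → Small W s → reg s 17 ≡ i →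
          ListScan i (arr s 9) (arr s 10) (reg s 11) → Run _ s 10 (λ s′ → ListScan (suc i) (arr s′ 9) (arr s′ 10) (reg s′ 11))
        body i s i< f sm ri j =
          set (t * n + i) (cong₂ _+_ (trans (regF f 15 refl) r₁₅) ri) (fits-list t<5 (<-≤-trans i< (Lists.bounded (Main.lists m) t<5)))
          (set x (cong (λ g → g (t * n + i)) (trans (arrF f 13 refl) lists≡)) tt
          (set (u * n + x) (cong (_+ x) (trans (regF f 18 refl) r₁₈)) (fits-cell u<n x<n)
          (set (bit (E u x)) (Adjacency.cell (keep-graph f adj₀) u<n x<n) tt
          (condR
            (λ far → weaken ≤-refl
              (λ s′ _ _ (q , g , v) → record
                { queue = q ; grow = Grow-trans (ListScan.grow j) g
                ; pushed = split-last (λ j< e → mono g (ListScan.pushed j j< e)) (λ _ → v) })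
              (push-run refl x<n (forced-step u<n x<n forced-u (far-forced x<n tx (bit-zero (E u x) far))) (ListScan.queue j)))
            (λ near → skipR (record
              { queue = ListScan.queue j ; grow = ListScan.grow j
              ; pushed = split-last (ListScan.pushed j) (λ e → ⊥-elim (true≢false (trans (sym (bit-nonzero (E u x) near)) e))) }))))))
          where
          x = L₀ (t * n + i)
          x<n : x < n
          x<n = proj₁ (Lists.entries (Main.lists m) t<5 i<)
          tx : types₂ x ≡ t
          tx = proj₂ (Lists.entries (Main.lists m) t<5 i<)

      -- The new list has at most as many entries as the row cells read so far, so the write stays
      -- within the block of `t` and leaves the other lists intact.
      keep-entry : ∀ {L nbr : ℕ → ℕ} {j x l} → l ≤ j → j < n → types₂ x ≡ t → x < n → nbr (u * n + j) ≡ x → ∀ {vis Q tl} →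
        RowScan nbr j vis Q L tl l → RowScan nbr (suc j) vis Q (update L (t * n + l) x) tl (l + 1)
      keep-entry {L} {nbr} {j} {x} {l} l≤j j<n tx x<n nx {vis} r = record
        { queue   = R.queue
        ; grow    = R.grow
        ; far     = R.far
        ; l≤j     = ≤-trans (≤-reflexive (+-comm l 1)) (s≤s l≤j)
        ; entries = λ {i} i< → split-last {λ i → L′ (t * n + i) < n × types₂ (L′ (t * n + i)) ≡ t}
                      (λ k< → subst (λ y → y < n × types₂ y ≡ t) (sym (old k<)) (R.entries k<))
                      (subst (λ y → y < n × types₂ y ≡ t) (sym (update-same L (t * n + l) x)) (x<n , tx))
                      (subst (i <_) (+-comm l 1) i<)
        ; kept    = split-last {λ i → types₂ (nbr (u * n + i)) ≡ t → ∃[ k ] (k < l + 1 × L′ (t * n + k) ≡ nbr (u * n + i))}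
                      (λ i< ti → let (k , k< , e) = R.kept i< ti in k , <-≤-trans k< (m≤m+n l 1) , trans (old k<) e)
                      (λ _ → l , m<m+n l (s≤s z≤n) , trans (update-same L (t * n + l) x) (sym nx))
        ; pushed  = split-last {λ i → types₂ (nbr (u * n + i)) ≢ t → vis (nbr (u * n + i)) ≡ 1} R.pushed
                      (λ ne → ⊥-elim (ne (trans (cong types₂ nx) tx)))
        ; other   = λ {t′} {i} t′≢t i<n → trans
                      (update-other L (t * n + l) x (t′ * n + i) (t′≢t ∘ sym ∘ cell-injective t t′ (≤-<-trans l≤j j<n) i<n))
                      (R.other t′≢t i<n)
        }
        where
        module R = RowScan r
        L′ = update L (t * n + l) x
        old : ∀ {k} → k < l → L′ (t * n + k) ≡ L (t * n + k)
        old k< = update-other L (t * n + l) x _ λ e → <⇒≢ k< (sym (+-cancelˡ-≡ (t * n) _ _ e))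

      scan-row-run : ∀ {s₀} → Adjacent-lists s₀ → HasTypes s₀ →
        reg s₀ 14 ≡ t → reg s₀ 15 ≡ t * n → reg s₀ 18 ≡ u * n → reg s₀ 19 ≡ arr s₀ 2 u →
        RowScan (arr s₀ 3) 0 (arr s₀ 9) (arr s₀ 10) (arr s₀ 13) (reg s₀ 11) (reg s₀ 16) →
        Run scanRowP s₀ (suc (suc (arr s₀ 2 u * suc (9 + 1))))
          (λ s → RowScan (arr s₀ 3) (arr s₀ 2 u) (arr s 9) (arr s 10) (arr s 13) (reg s 11) (reg s 16))
      scan-row-run {s₀} adj₀ ht₀ r₁₄ r₁₅ r₁₈ r₁₉ j₀ =
        forR d 9 J (fits-vertex (A₀.degree≤n u<n)) (λ s f → trans (regF f 19 refl) r₁₉) refl body j₀ (λ _ _ j → j)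
        where
        module A₀ = Adjacency adj₀
        d = arr s₀ 2 u
        nbr = arr s₀ 3
        J : ℕ → State → Set
        J j s = RowScan nbr j (arr s 9) (arr s 10) (arr s 13) (reg s 11) (reg s 16)
        body : ∀ j s → j < d → Frame scanRowP s₀ s → Small W s → reg s 17 ≡ j → J j s → Run _ s 9 (λ s′ → J (suc j) (setReg s′ 17 (suc j)))
        body j s j< f sm rj r =
          set (u * n + j) (cong₂ _+_ (trans (regF f 18 refl) r₁₈) rj) (fits-cell u<n j<n)
          (set x (cong (λ g → g (u * n + j)) (arrF f 3 refl)) tt
          (set (types₂ x) (typed₂ (keep-types f ht₀) x<n) tt
          (condR
            (λ eq → let tx = trans (≡ᵇ-true eq) (trans (regF f 14 refl) r₁₄) in
              set (t * n + reg s 16) (cong (_+ reg s 16) (trans (regF f 15 refl) r₁₅)) (fits-list t<5 (≤-<-trans R.l≤j j<n))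
              (put (t * n + reg s 16) x refl refl tt
              (assignR (reg s 16 + 1) refl (fits-next (≤-trans R.l≤j (<⇒≤ j<n)))
                (keep-entry R.l≤j j<n tx x<n refl r))))
            (λ ne → let tx = λ e → ≡ᵇ-false ne (trans e (sym (trans (regF f 14 refl) r₁₄))) in
              weaken ≤-refl
                (λ s′ f′ _ (q , g , v) → subst₂ (λ L l → RowScan nbr (suc j) (arr s′ 9) (arr s′ 10) L (reg s′ 11) l)
                  (sym (arrF f′ 13 refl)) (sym (regF f′ 16 refl)) (record
                  { queue   = q
                  ; grow    = Grow-trans R.grow g
                  ; far     = λ k< e → mono g (R.far k< e)
                  ; l≤j     = m≤n⇒m≤1+n R.l≤j
                  ; entries = R.entries
                  ; kept    = split-last {λ i → types₂ (nbr (u * n + i)) ≡ t → ∃[ k ] (k < reg s 16 × arr s 13 (t * n + k) ≡ nbr (u * n + i))}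
                                R.kept (⊥-elim ∘ tx)
                  ; pushed  = split-last {λ i → types₂ (nbr (u * n + i)) ≢ t → arr s′ 9 (nbr (u * n + i)) ≡ 1}
                                (λ i< e → mono g (R.pushed i< e)) (λ _ → v)
                  ; other   = R.other
                  }))
                (push-run refl x<n (forced-step u<n x<n forced-u (near-forced x<n tx (proj₂ (A₀.near u<n j<)))) R.queue)))))
          where
          module R = RowScan r
          x = nbr (u * n + j)
          x<n : x < n
          x<n = proj₁ (A₀.near u<n j<)
          j<n : j < n
          j<n = <-≤-trans j< (A₀.degree≤n u<n)

    MainOf : ℕ → State → Set
    MainOf φ s = Main 16 (arr s 9) (arr s 10) (arr s 13) (arr s 14) (reg s 11) (reg s 12) φ

    roundTime : ℕ → ℕ → ℕ
    roundTime l d = 7 + (suc (suc (l * suc (10 + 1))) + (1 + (suc (suc (d * suc (9 + 1))) + 1)))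

    -- Origin of the factor 16. A round and its test cost 14 + 12 * l + 11 * d. Giving up the old
    -- list releases 16 * l, which covers 12 * l. The weight 1 + 2 * d of the processed vertex
    -- releases 16 + 32 * d, which covers 14, 11 * d and the potential of the new list, at most 16 *
    -- d.
    round-paid : ∀ {l d l′ r S S′} → S′ + l ≡ S + l′ → l′ ≤ d →
      suc (roundTime l d + 16 * (r + S′)) ≤ 16 * (1 + 2 * d + r + S)
    round-paid {l} {d} {l′} {r} {S} {S′} e l′≤d = +-cancelʳ-≤ (16 * l) _ _ (begin
      suc (roundTime l d + 16 * (r + S′)) + 16 * l
        ≡⟨ expand l d r S′ ⟩
      14 + 12 * l + 11 * d + 16 * r + 16 * (S′ + l)
        ≡⟨ cong (λ z → 14 + 12 * l + 11 * d + 16 * r + 16 * z) e ⟩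
      14 + 12 * l + 11 * d + 16 * r + 16 * (S + l′)
        ≤⟨ +-monoʳ-≤ (14 + 12 * l + 11 * d + 16 * r) (*-monoʳ-≤ 16 (+-monoʳ-≤ S l′≤d)) ⟩
      14 + 12 * l + 11 * d + 16 * r + 16 * (S + d)
        ≤⟨ m≤m+n _ (2 + 4 * l + 5 * d) ⟩
      14 + 12 * l + 11 * d + 16 * r + 16 * (S + d) + (2 + 4 * l + 5 * d)
        ≡⟨ collect l d r S ⟩
      16 * (1 + 2 * d + r + S) + 16 * l ∎)
      where
      open ≤-Reasoning
      expand : ∀ l d r S′ → suc (7 + (suc (suc (l * 12)) + (1 + (suc (suc (d * 11)) + 1))) + 16 * (r + S′)) + 16 * l
        ≡ 14 + 12 * l + 11 * d + 16 * r + 16 * (S′ + l)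
      expand = solve-∀
      collect : ∀ l d r S → 14 + 12 * l + 11 * d + 16 * r + 16 * (S + d) + (2 + 4 * l + 5 * d) ≡ 16 * (1 + 2 * d + r + S) + 16 * l
      collect = solve-∀

    round-run : ∀ {s φ} → Adjacent-lists s → HasTypes s → MainOf φ s → reg s 12 < reg s 11 →
      ∃[ B ] Run roundP s B (λ s′ → ∃[ φ′ ] (suc (B + φ′) ≤ φ × MainOf φ′ s′))
    round-run {s} {φ} adj ht m hd<tl = roundTime (arr s 14 t) (arr s 2 u) ,
      set u refl tt
      (set (hd + 1) refl (fits-next (≤-trans (<⇒≤ hd<tl) (Queue.tl≤n (Main.queue m))))
      (set t (typed₁ ht u<n) tt
      (set (t * n) (cong (t *_) A.size) (fits-linear (≤-trans (*-monoˡ-≤ n (<⇒≤ t<5)) (m≤m+n (5 * n) 8)))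
      (set (arr s 14 t) refl tt
      (set (u * n) (cong (u *_) A.size) (fits-row u<n)
      (set (arr s 2 u) refl tt
      (seqR (weaken ≤-refl rest
        (scan-list-run adj refl refl refl refl record { queue = Main.queue m ; grow = Grow-refl ; pushed = λ () })))))))))
      where
      module A = Adjacency adj
      hd = reg s 12
      open RoundRun m hd<tl
      open Round m hd<tl
      s₁ : State
      s₁ = setReg (setReg (setReg (setReg (setReg (setReg (setReg s 13 u) 12 (hd + 1)) 14 t) 15 (t * n)) 16 (arr s 14 t)) 18 (u * n)) 19 (arr s 2 u)
      Post : State → Set
      Post s′ = ∃[ φ′ ] (suc (roundTime (arr s 14 t) (arr s 2 u) + φ′) ≤ φ × MainOf φ′ s′)
      finish : ∀ s₂ s₃ → Frame scanListP s₁ s₂ → Frame scanRowP (setReg s₂ 16 0) s₃ →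
        RowScan (arr s₂ 3) (arr s₂ 2 u) (arr s₃ 9) (arr s₃ 10) (arr s₃ 13) (reg s₃ 11) (reg s₃ 16) →
        Post (setArr s₃ 14 t (reg s₃ 16))
      finish s₂ s₃ f g rs with next (arr s₂ 2 u) (Adjacency.listed adj₂ u<n) (Adjacency.degree≤n adj₂ u<n) rs
        where
        adj₂ : Adjacent-lists s₂
        adj₂ = keep-graph f adj
      ... | r , wr , m′ = _ , paid , subst₂ (λ len h → Main 16 (arr s₃ 9) (arr s₃ 10) (arr s₃ 13) (update len t l′) (reg s₃ 11) h (16 * (r + S′)))
          (sym (trans (arrF g 14 refl) (arrF f 14 refl))) (sym (trans (regF g 12 refl) (regF f 12 refl))) m′
        where
        l′ = reg s₃ 16
        S′ = sumTo 5 (update (arr s 14) t l′)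
        d≡ : arr s 2 u ≡ arr s₂ 2 u
        d≡ = cong (λ h → h u) (sym (arrF f 2 refl))
        paid : suc (roundTime (arr s 14 t) (arr s 2 u) + 16 * (r + S′)) ≤ φ
        paid = ≤-trans (round-paid {arr s 14 t} {arr s 2 u} {l′} {r} {sumTo 5 (arr s 14)} {S′}
            (trans (sumTo-change 5 (update (arr s 14) t l′) (arr s 14) t<5 (λ i _ i≢t → update-other (arr s 14) t l′ i (i≢t ∘ sym)))
                   (cong (sumTo 5 (arr s 14) +_) (update-same (arr s 14) t l′)))
            (subst (l′ ≤_) (sym d≡) (RowScan.l≤j rs)))
          (≤-reflexive (trans (cong (λ z → 16 * (z + sumTo 5 (arr s 14)))
            (trans (cong (λ z → 1 + 2 * z + r) (A.degree u<n)) wr)) (sym (Main.potential m))))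
      rest : ∀ s₂ → Frame scanListP s₁ s₂ → Small W s₂ → ListScan (arr s 14 t) (arr s₂ 9) (arr s₂ 10) (reg s₂ 11) →
        Run _ s₂ _ Post
      rest s₂ f _ ls =
        set 0 refl tt (seqR (weaken (≤-reflexive (cong (λ z → suc (suc (z u * 11))) (arrF f 2 refl)))
          (λ s₃ g _ rs → storeR t (reg s₃ 16) (trans (regF g 14 refl) (regF f 14 refl)) refl tt (finish s₂ s₃ f g rs))
          (scan-row-run (keep-graph f adj) (keep-types f ht)
            (regF f 14 refl) (regF f 15 refl) (regF f 18 refl)
            (trans (regF f 19 refl) (cong (λ h → h u) (sym (arrF f 2 refl))))
            (record { queue = ListScan.queue ls ; grow = ListScan.grow ls ; far = ListScan.pushed ls ; l≤j = z≤n
                    ; entries = λ () ; kept = λ () ; pushed = λ ()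
                    ; other = λ _ _ → cong (λ h → h _) (arrF f 13 refl) }))))

    weight-sum : sumTo n weight ≡ n + 2 * edgeEnds
    weight-sum = trans (sumTo-+ n (λ _ → 1) _)
      (cong₂ _+_ (trans (sumTo-const n 1) (*-identityʳ n)) (sumTo-* n 2 _))

    closure-run : ∀ {s} → Adjacent-lists s → HasSeeds s →
      Run closureP s closureTime (λ s′ → Result (arr s′ 9) (reg s′ 11) × HasTypes s′)
    closure-run {s₀} adj₀ sd₀ = within time≤
      (seqR (weaken ≤-refl (λ s₁ f₁ _ (ht₁ , none) →
       let adj₁ = keep-graph f₁ adj₀
           sd₁ = keep-seeds f₁ sd₀ in
       seqR (weaken ≤-refl (λ s₂ f₂ _ built →
       let adj₂ = keep-graph f₂ adj₁
           sd₂ = keep-seeds f₂ sd₁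
           ht₂ = keep-types f₂ ht₁ in
       set 0 refl tt (set 0 refl tt
       (set a₁ (Seeds.r₄≡ sd₂) tt
       (seqR (weaken ≤-refl (λ s₃ f₃ _ (q₃ , g₃ , v₃) →
       let sd₃ = keep-seeds f₃ sd₂ in
       set b₁ (Seeds.r₆≡ sd₃) tt
       (seqR (weaken ≤-refl (λ s₄ f₄ _ (q₄ , g₄ , v₄) →
       let sd₄ = keep-seeds f₄ sd₃ in
       set c (Seeds.r₈≡ sd₄) tt
       (seqR (weaken ≤-refl (λ s₅ f₅ _ (q₅ , g₅ , v₅) →
       let adj₅ = keep-graph f₅ (keep-graph f₄ (keep-graph f₃ adj₂))
           ht₅ = keep-types f₅ (keep-types f₄ (keep-types f₃ ht₂))
           built₅ = subst₂ (Built n) (sym (trans (arrF f₅ 13 refl) (trans (arrF f₄ 13 refl) (arrF f₃ 13 refl))))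
                                     (sym (trans (arrF f₅ 14 refl) (trans (arrF f₄ 14 refl) (arrF f₃ 14 refl)))) built
           hd₅ = trans (regF f₅ 12 refl) (trans (regF f₄ 12 refl) (regF f₃ 12 refl)) in
       loop adj₅ ht₅ built₅ hd₅ q₅ (mono g₅ (mono g₄ v₃)) (mono g₅ v₄) v₅)
       (push-run refl c<n (λ _ _ _ _ r → r) q₄))))
       (push-run refl b₁<n (λ _ _ _ q _ → q) q₃))))
       (push-run refl a₁<n (λ _ _ p _ _ → p)
          (empty-queue (λ v<n → trans (cong (λ g → g _) (arrF f₂ 9 refl)) (none v<n)))))))))
       (lists-run adj₁ ht₁)))
      (types-run adj₀ sd₀)))
      where
      loopTime : ℕ
      loopTime = suc (16 * (sumTo n weight + sumTo 5 (λ _ → n)))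
      loop : ∀ {s} → Adjacent-lists s → HasTypes s → Built n (arr s 13) (arr s 14) → reg s 12 ≡ 0 →
        QueueOf s → arr s 9 a₁ ≡ 1 → arr s 9 b₁ ≡ 1 → arr s 9 c ≡ 1 →
        Run (while (var 12 ≺ var 11) roundP) s loopTime (λ s′ → Result (arr s′ 9) (reg s′ 11) × HasTypes s′)
      loop {s} adj ht built hd≡ q va vb vc =
        -- At the start nothing has been processed, so `rest` is the whole weight, and each list has
        -- at most n entries.
        within (s≤s (*-monoʳ-≤ 16 (+-monoʳ-≤ (sumTo n weight) (sumTo-mono 5 (λ t t<5 → Built.bounded built t<5)))))
        (whileR MainOf
          (λ φ s′ f _ m hd< → round-run (keep-graph f adj) (keep-types f ht) m (<ᵇ-true {reg s′ 12} hd<))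
          (λ φ s′ f _ m hd≮ → finished m (<ᵇ-false {reg s′ 12} hd≮) , keep-types f ht)
          (record
            { queue = q
            ; hd≤tl = subst (_≤ reg s 11) (sym hd≡) z≤n
            ; scanned = λ {i} i< → ⊥-elim (n≮0 (subst (i <_) hd≡ i<))
            ; lists = record { member = λ t<5 v<n _ → Built.member built t<5 v<n ; entries = Built.entries built ; bounded = Built.bounded built }
            ; seed-a = va ; seed-b = vb ; seed-c = vc
            ; rest = sumTo n weight
            ; rest-sum = cong (λ h → sumTo h (λ i → weight (arr s 10 i)) + sumTo n weight) hd≡
            ; potential = refl
            }))
      time≤ : typesTime + (listsTime + (3 + (5 + (1 + (5 + (1 + (5 + loopTime))))))) ≤ closureTime
      time≤ = ≤-reflexive (trans
        (cong (λ z → typesTime + (listsTime + (3 + (5 + (1 + (5 + (1 + (5 + suc (16 * (z + sumTo 5 (λ _ → n)))))))))))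
          weight-sum) (count n edgeEnds))
        where
        count : ∀ n D → suc (suc (n * 19)) + ((17 + suc (suc (n * 9))) + (3 + (5 + (1 + (5 + (1 + (5 +
          suc (16 * (n + 2 * D + (0 + n + n + n + n + n)))))))))) ≡ 42 + 124 * n + 32 * D
        count = solve-∀

-- Testing one pair of edges

module Tuples (n : ℕ) (E : ℕ → ℕ → Bool) (E-sym : ∀ u v → E u v ≡ E v u)
              (W : ℕ) (big : n * n + (5 * n + 9) ≤ W) (5<n : 5 < n) where

  open Setting n E E-sym W big
  open Joins n E E-sym

  Good : (ℕ → ℕ) → Set
  Good label = ∃[ σ ] ∃[ α ] ∃[ β ] ∃[ a₁ ] ∃[ a₂ ] ∃[ b₁ ] ∃[ b₂ ]
    (Compatible σ α β a₁ a₂ b₁ b₂ × (∀ v → v < n → label v ≡ (if σ v then 1 else 2)))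

  -- `R` collects the refutations obtained so far. It is dropped once a join has been found, because
  -- all later attempts then leave flag and labels alone.
  data Status (flag : ℕ) (label : ℕ → ℕ) (R : Set) : Set where
    found  : flag ≡ 1 → Good label → Status flag label R
    absent : flag ≡ 0 → R → Status flag label R

  StatusOf : State → Set → Set
  StatusOf s R = Status (reg s 1) (arr s 1) R

  map-status : ∀ {f l R R′} → (R → R′) → Status f l R → Status f l R′
  map-status g (found e h)  = found e h
  map-status g (absent e r) = absent e (g r)

  -- The inequalities make `a₁`, `b₁`, `c` three different visited vertices, so a closure with at
  -- most two vertices is impossible for a compatible join.
  RefutedWith : ℕ → ℕ → ℕ → ℕ → ℕ → Set
  RefutedWith a₁ a₂ b₁ b₂ c = ∀ σ α β → Compatible σ α β a₁ a₂ b₁ b₂ → σ c ≡ true → c ≢ a₁ → c ≢ b₁ → ⊥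

  module Accepting {a₁ a₂ b₁ b₂ c : ℕ} (a₁<n : a₁ < n) (a₂<n : a₂ < n) (b₁<n : b₁ < n) (b₂<n : b₂ < n) (c<n : c < n) where

    open Closing a₁<n a₂<n b₁<n b₂<n c<n
    open Closures n E E-sym a₁ a₂ b₁ b₂ c weight

    module _ {vis : ℕ → ℕ} {tl : ℕ} (res : Result vis tl) where
      open Result res
      module Q = Queue (proj₂ queue)

      inside : ℕ → Bool
      inside v = vis v ≡ᵇ 1

      bit-inside : ∀ {v} → v < n → bit (inside v) ≡ vis v
      bit-inside v<n = go (Q.binary v<n)
        where
        go : ∀ {x} → x ≡ 0 ⊎ x ≡ 1 → bit (x ≡ᵇ 1) ≡ x
        go (inj₁ refl) = refl
        go (inj₂ refl) = refl

      visited⊆σ : ∀ {σ α β} → Compatible σ α β a₁ a₂ b₁ b₂ → σ c ≡ true → ∀ {v} → v < n → vis v ≢ 0 → σ v ≡ true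
      visited⊆σ {σ} cp σc {v} v<n ne with Q.binary v<n
      ... | inj₁ e = ⊥-elim (ne e)
      ... | inj₂ e = Q.forced v<n e σ (compatible-closed cp) (Compatible.σa₁ cp) (Compatible.σb₁ cp) σc

      refute-target : ∀ {v} → v < n → vis v ≢ 0 → (∀ {σ α β} → Compatible σ α β a₁ a₂ b₁ b₂ → σ v ≡ false) →
        RefutedWith a₁ a₂ b₁ b₂ c
      refute-target v<n ne out σ α β cp σc _ _ = true≢false (trans (sym (visited⊆σ cp σc v<n ne)) (out cp))

      refute-small : tl ≤ 2 → RefutedWith a₁ a₂ b₁ b₂ c
      refute-small tl≤2 σ α β cp σc c≢a c≢b = <⇒≱ (three≤sumTo n vis a₁<n b₁<n c<n a≢b c≢a c≢b
          (≤-reflexive (sym seed-a)) (≤-reflexive (sym seed-b)) (≤-reflexive (sym seed-c)))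
        (≤-trans (≤-reflexive Q.total) tl≤2)
        where
        a≢b : a₁ ≢ b₁
        a≢b refl = true≢false (trans (sym (Compatible.βb₁ cp)) (Compatible.disj cp a₁<n (Compatible.αa₁ cp)))

      -- All visited vertices lie in `σ`, so the second side of a compatible join would have to fit
      -- into at most two unvisited vertices.
      refute-large : n ≤ tl + 2 → RefutedWith a₁ a₂ b₁ b₂ c
      refute-large n≤ σ α β cp σc _ _ = <⇒≱ (begin-strict
          tl + 2                          <⟨ +-monoʳ-< tl ≤-refl ⟩
          tl + 3                          ≤⟨ +-mono-≤ tl≤ (Compatible.size₂ cp) ⟩
          sumTo n (λ v → bit (σ v)) + sumTo n (λ v → bit (not (σ v))) ≡⟨ count-not n σ ⟩
          n                               ∎) n≤
        where
        open ≤-Reasoning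
        below : ∀ v → v < n → vis v ≤ bit (σ v)
        below v v<n with Q.binary v<n
        ... | inj₁ e = ≤-trans (≤-reflexive e) z≤n
        ... | inj₂ e rewrite visited⊆σ cp σc v<n (λ z → 1+n≢0 (trans (sym e) z)) = ≤-reflexive e
        tl≤ : tl ≤ sumTo n (λ v → bit (σ v))
        tl≤ = ≤-trans (≤-reflexive (sym Q.total)) (sumTo-mono n below)

      accepted : ty₁ a₁ a₂ b₁ b₂ a₁ ≡ 1 → ty₁ a₁ a₂ b₁ b₂ b₁ ≡ 2 → vis a₂ ≡ 0 → vis b₂ ≡ 0 → 2 < tl → tl + 2 < n →
        ∃[ α ] ∃[ β ] Compatible inside α β a₁ a₂ b₁ b₂
      accepted ta tb va vb 2<tl tl< = sound a₁ a₂ b₁ b₂ closed a₁<n a₂<n b₁<n b₂<n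
        (≡⇒≡ᵇ-true seed-a) (≡⇒≡ᵇ-true seed-b) (cong (_≡ᵇ 1) va) (cong (_≡ᵇ 1) vb) ta tb
        (subst (3 ≤_) (sym size) 2<tl)
        (+-cancelˡ-≤ tl 3 _ (≤-trans (≤-reflexive (trans (+-suc tl 2) refl)) (≤-trans tl<
          (≤-reflexive (trans (sym (count-not n inside)) (cong (_+ sumTo n (λ v → bit (not (inside v)))) size))))))
        where
        size : sumTo n (λ v → bit (inside v)) ≡ tl
        size = trans (sumTo-cong n λ v v<n → bit-inside v<n) Q.total

      label-inside : ∀ {v} → v < n → 2 ∸ vis v ≡ (if inside v then 1 else 2)
      label-inside v<n = go (Q.binary v<n)
        where
        go : ∀ {x} → x ≡ 0 ⊎ x ≡ 1 → 2 ∸ x ≡ (if x ≡ᵇ 1 then 1 else 2)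
        go (inj₁ refl) = refl
        go (inj₂ refl) = refl

    label-run : ∀ {s} → reg s 0 ≡ n → Run labelP s (suc (suc (n * suc (3 + 1))) + 1)
      (λ s′ → reg s′ 1 ≡ 1 × (∀ v → v < n → arr s′ 1 v ≡ 2 ∸ arr s 9 v))
    label-run {s₀} r₀ = seqR (forR n 3 (λ i s → ∀ v → v < i → arr s 1 v ≡ 2 ∸ arr s₀ 9 v) (fits-vertex ≤-refl)
      (λ s f → trans (regF f 0 refl) r₀) refl
      (λ i s i<n f sm ri j →
        set (arr s₀ 9 i) (cong₂ (λ g x → g x) (arrF f 9 refl) ri) tt
        (set (2 ∸ arr s₀ 9 i) refl tt
        (storeR i (2 ∸ arr s₀ 9 i) ri refl tt
          (λ v → update-extend (λ v x → x ≡ 2 ∸ arr s₀ 9 v) (j _) refl))))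
      (λ _ ())
      (λ s f j → assignR 1 refl tt (refl , j)))

    acceptTime : ℕ
    acceptTime = 11 + (suc (suc (n * suc (3 + 1))) + 1)

    accept-run : ∀ {s} → Adjacent-lists s → HasSeeds s → HasTypes s → Result (arr s 9) (reg s 11) → reg s 1 ≡ 0 →
      Run acceptP s acceptTime (λ s′ → StatusOf s′ (RefutedWith a₁ a₂ b₁ b₂ c))
    accept-run {s} adj sd ht res z =
      set (types₁ a₁) (trans (cong (arr s 11) r₄≡) (Typed.typed₁ ht a₁<n)) tt (condR
      (λ ta → set (types₁ b₁) (trans (cong (arr s 11) r₆≡) (Typed.typed₁ ht b₁<n)) tt (condR
        (λ tb → set (arr s 9 a₂) (cong (arr s 9) r₅≡) tt (condR
          (λ va → set (arr s 9 b₂) (cong (arr s 9) r₇≡) tt (condR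
            (λ vb → condR
              (λ small → set (reg s 11 + 2) refl (fits-linear (+-mono-≤ (≤-trans (Queue.tl≤n (proj₂ (Result.queue res))) (m≤m+n n (4 * n))) (s≤s (s≤s z≤n)))) (condR
                (λ large → weaken ≤-refl
                  (λ s′ _ _ (e , lab) → found e
                    (let (α , β , cp) = accepted res (≡ᵇ-true ta) (≡ᵇ-true tb) (≡ᵇ-true va) (≡ᵇ-true vb)
                                          (<ᵇ-true {2} small) (subst (reg s 11 + 2 <_) A.size (<ᵇ-true {reg s 11 + 2} large))
                     in inside res , α , β , a₁ , a₂ , b₁ , b₂ , cp , λ v v<n → trans (lab v v<n) (label-inside res v<n)))
                  (label-run A.size))
                (λ large → skipR (absent z (refute-large res (subst (_≤ reg s 11 + 2) A.size (<ᵇ-false {reg s 11 + 2} large)))))))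
              (λ small → skipR (absent z (refute-small res (<ᵇ-false {2} small)))))
            (λ vb → skipR (absent z (refute-target res b₂<n (≡ᵇ-false vb) Compatible.σb₂)))))
          (λ va → skipR (absent z (refute-target res a₂<n (≡ᵇ-false va) Compatible.σa₂)))))
        (λ tb → skipR (absent z λ _ _ _ cp _ _ _ → ≡ᵇ-false tb (proj₂ (compatible-ty₁ cp))))))
      (λ ta → skipR (absent z λ _ _ _ cp _ _ _ → ≡ᵇ-false ta (proj₁ (compatible-ty₁ cp)))))
      where
      module A = Adjacency adj
      open Seeds sd

  attemptTime : ℕ
  attemptTime = suc (closureTime + (11 + (suc (suc (n * suc (3 + 1))) + 1)))

  record Tuple (a₁ a₂ b₁ b₂ r₄ r₅ r₆ r₇ : ℕ) : Set where
    constructor tuple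
    field
      r₄≡ : r₄ ≡ a₁
      r₅≡ : r₅ ≡ a₂
      r₆≡ : r₆ ≡ b₁
      r₇≡ : r₇ ≡ b₂

  HasTuple : ℕ → ℕ → ℕ → ℕ → State → Set
  HasTuple a₁ a₂ b₁ b₂ s = Tuple a₁ a₂ b₁ b₂ (reg s 4) (reg s 5) (reg s 6) (reg s 7)

  keep-tuple : ∀ {p s s′ a₁ a₂ b₁ b₂} → Frame p s s′ → {NotReg p 4 × NotReg p 5 × NotReg p 6 × NotReg p 7} →
    HasTuple a₁ a₂ b₁ b₂ s → HasTuple a₁ a₂ b₁ b₂ s′
  keep-tuple f {k₄ , k₅ , k₆ , k₇} h
    rewrite regF f 4 (T-not k₄) | regF f 5 (T-not k₅) | regF f 6 (T-not k₆) | regF f 7 (T-not k₇) = h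

  module _ {a₁ a₂ b₁ b₂ : ℕ} (a₁<n : a₁ < n) (a₂<n : a₂ < n) (b₁<n : b₁ < n) (b₂<n : b₂ < n) where

    attempt-run : ∀ {s R c} → c < n → Adjacent-lists s → HasTuple a₁ a₂ b₁ b₂ s → reg s 8 ≡ c → StatusOf s R →
      Run attemptP s attemptTime (λ s′ → StatusOf s′ (R × RefutedWith a₁ a₂ b₁ b₂ c))
    attempt-run {s} {R} {c} c<n adj (tuple e₄ e₅ e₆ e₇) e₈ status = condR (go status) (λ ne → skipR (stop status ne))
      where
      open Accepting a₁<n a₂<n b₁<n b₂<n c<n
      open Closing a₁<n a₂<n b₁<n b₂<n c<n
      sd : HasSeeds s
      sd = seeds e₄ e₅ e₆ e₇ e₈
      Post : State → Set
      Post s′ = StatusOf s′ (R × RefutedWith a₁ a₂ b₁ b₂ c)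
      stop : StatusOf s R → (reg s 1 ≡ᵇ 0) ≡ false → Post s
      stop (found e g)  ne = found e g
      stop (absent e _) ne = ⊥-elim (≡ᵇ-false ne e)
      go : StatusOf s R → (reg s 1 ≡ᵇ 0) ≡ true → Run (closureP ⨾ acceptP) s (closureTime + acceptTime) Post
      go (found e g)  eq with () ← trans (sym e) (≡ᵇ-true eq)
      go (absent e r) eq = seqR (weaken ≤-refl
        (λ s′ f _ (res , ht) → weaken ≤-refl (λ _ _ _ → map-status (r ,_))
          (accept-run (keep-graph f adj) (keep-seeds f sd) ht res
            (trans (regF f 1 refl) e)))
        (closure-run adj sd))

    attemptsTime : ℕ
    attemptsTime = suc (suc (5 * suc (attemptTime + 1)))

    attempts-run : ∀ {s R} → Adjacent-lists s → HasTuple a₁ a₂ b₁ b₂ s → StatusOf s R →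
      Run attemptsP s attemptsTime (λ s′ → StatusOf s′ (R × (∀ c → c < 5 → RefutedWith a₁ a₂ b₁ b₂ c)))
    attempts-run {s₀} {R} adj tu status = forR 5 attemptTime
      (λ i s → StatusOf s (R × (∀ c → c < i → RefutedWith a₁ a₂ b₁ b₂ c))) (fits-small 5 ≤-refl) (λ _ _ → refl) refl
      (λ i s i<5 f _ ri st → weaken ≤-refl
        (λ s′ _ _ → map-status λ ((r , before) , now) → r , below-suc {RefutedWith a₁ a₂ b₁ b₂} before now)
        (attempt-run (<-trans i<5 5<n) (keep-graph f adj)
          (keep-tuple f tu) ri st))
      (map-status (λ r → r , λ _ ()) status)
      (λ _ _ j → j)

  fresh : ∀ a b c d → ∃[ x ] (x < 5 × x ≢ a × x ≢ b × x ≢ c × x ≢ d)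
  fresh a b c d with any? {n = 5} (λ x → ¬? (toℕ x ≟ a) ×-dec ¬? (toℕ x ≟ b) ×-dec ¬? (toℕ x ≟ c) ×-dec ¬? (toℕ x ≟ d))
  ... | yes (x , p) = toℕ x , toℕ<n x , p
  ... | no none = ⊥-elim (collide (pigeonhole ≤-refl slot))
    where
    pick : Fin 4 → ℕ
    pick zero = a
    pick (suc zero) = b
    pick (suc (suc zero)) = c
    pick (suc (suc (suc zero))) = d
    hit : ∀ x → ∃[ k ] toℕ {5} x ≡ pick k
    hit x with toℕ x ≟ a | toℕ x ≟ b | toℕ x ≟ c | toℕ x ≟ d
    ... | yes e | _ | _ | _ = zero , e
    ... | no _ | yes e | _ | _ = suc zero , e
    ... | no _ | no _ | yes e | _ = suc (suc zero) , e
    ... | no _ | no _ | no _ | yes e = suc (suc (suc zero)) , e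
    ... | no p | no q | no r | no s = ⊥-elim (none (x , p , q , r , s))
    slot : Fin 5 → Fin 4
    slot x = proj₁ (hit x)
    collide : ∃[ i ] ∃[ j ] (Data.Fin.Base._<_ i j × slot i ≡ slot j) → ⊥
    collide (i , j , i<j , e) = <⇒≢ i<j (trans (proj₂ (hit i)) (trans (cong pick e) (sym (proj₂ (hit j)))))

  -- A vertex below 5 other than the four ends lies on one of the sides, and the attempts made with
  -- that side first apply to it.
  refute-both : ∀ {a₁ a₂ b₁ b₂} → (∀ c → c < 5 → RefutedWith a₁ a₂ b₁ b₂ c) → (∀ c → c < 5 → RefutedWith a₂ a₁ b₂ b₁ c) →
    Refuted a₁ a₂ b₁ b₂
  refute-both {a₁} {a₂} {b₁} {b₂} r₁ r₂ σ α β cp with fresh a₁ a₂ b₁ b₂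
  ... | x , x<5 , ≢a₁ , ≢a₂ , ≢b₁ , ≢b₂ with σ x in e
  ... | true  = r₁ x x<5 σ α β cp e ≢a₁ ≢b₁
  ... | false = r₂ x x<5 (not ∘ σ) α β (swapSides cp) (cong not e) ≢a₂ ≢b₂

  tupleTime : ℕ
  tupleTime = suc (suc (5 * suc (attemptTime + 1))) + (6 + suc (suc (5 * suc (attemptTime + 1))))

  tuple-run : ∀ {s R a₁ a₂ b₁ b₂} → a₁ < n → a₂ < n → b₁ < n → b₂ < n →
    Adjacent-lists s → HasTuple a₁ a₂ b₁ b₂ s → StatusOf s R →
    Run tupleP s tupleTime (λ s′ → StatusOf s′ (R × Refuted a₁ a₂ b₁ b₂))
  tuple-run {s} {a₁ = a₁} {a₂} {b₁} {b₂} a₁<n a₂<n b₁<n b₂<n adj tu st = seqR (weaken ≤-refl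
    (λ s′ f _ st′ → let open Tuple (keep-tuple {attemptsP} {s} {s′} f tu) in
      set a₁ r₄≡ tt (set a₂ r₅≡ tt (set a₁ refl tt
      (set b₁ r₆≡ tt (set b₂ r₇≡ tt (set b₁ refl tt
      (weaken ≤-refl (λ _ _ _ → map-status λ ((r , p) , q) → r , refute-both p q)
        (attempts-run a₂<n a₁<n b₂<n b₁<n (keep-graph f adj) (tuple refl refl refl refl) st′))))))))
    (attempts-run a₁<n a₂<n b₁<n b₂<n adj tu st))

-- Breadth-first forests

Live : (ℕ → ℕ → Bool) → (ℕ → ℕ) → ℕ → ℕ → Set
Live E ex u v = bit (E u v) ∸ ex u ∸ ex v ≡ 1

live-sym : ∀ {n E} ex → (∀ u v → E u v ≡ E v u) → ∀ {u v} → u < n → v < n → Live E ex u v → Live E ex v u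
live-sym {n} {E} ex E-sym {u} {v} _ _ l = begin
  bit (E v u) ∸ ex v ∸ ex u    ≡⟨ ∸-+-assoc (bit (E v u)) (ex v) (ex u) ⟩
  bit (E v u) ∸ (ex v + ex u)  ≡⟨ cong₂ (λ b k → bit b ∸ k) (E-sym v u) (+-comm (ex v) (ex u)) ⟩
  bit (E u v) ∸ (ex u + ex v)  ≡⟨ sym (∸-+-assoc (bit (E u v)) (ex u) (ex v)) ⟩
  bit (E u v) ∸ ex u ∸ ex v    ≡⟨ l ⟩
  1                            ∎
  where open ≡-Reasoning

module Forests (n : ℕ) (Link : ℕ → ℕ → Set) (link-sym : ∀ {u v} → u < n → v < n → Link u v → Link v u) where

  -- Roots are their own parents. `cut` expresses that the forest is spanning in the form in which
  -- this is used: a vertex set left by no forest edge is left by no link.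
  record Forest (key par : ℕ → ℕ) : Set where
    field
      parent : ∀ {v} → v < n → par v ≡ v ⊎ (par v < n × Link (par v) v × key v ≡ suc (key (par v)))
      near   : ∀ {u v} → u < n → v < n → Link u v → key v ≤ suc (key u)
      cut    : ∀ (τ : ℕ → Bool) → (∀ v → v < n → τ (par v) ≡ τ v) → ∀ {u v} → u < n → v < n → Link u v → τ u ≡ τ v

  -- The key suc n marks the vertices that have not been reached.
  record Search (key par done : ℕ → ℕ) : Set where
    field
      binary       : ∀ {v} → v < n → done v ≡ 0 ⊎ done v ≡ 1
      key≤         : ∀ {v} → v < n → key v ≤ suc n
      done-reached : ∀ {v} → v < n → done v ≡ 1 → key v ≢ suc n
      fresh        : ∀ {v} → v < n → key v ≡ suc n → par v ≡ v
      parent       : ∀ {v} → v < n → par v ≡ v ⊎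
                     (par v < n × Link (par v) v × key v ≡ suc (key (par v)) × done (par v) ≡ 1)
      closed       : ∀ {u v} → u < n → v < n → done u ≡ 1 → Link u v → key v ≢ suc n × key v ≤ suc (key u)
      level        : ∀ {u v} → u < n → v < n → done u ≡ 0 → done v ≡ 0 → key u ≢ suc n → key v ≢ suc n → key v ≤ suc (key u)
      order        : ∀ {u v} → u < n → v < n → done u ≡ 0 → done v ≡ 1 → key u ≢ suc n → Link v u → key v ≤ key u
      bound        : ∀ {v} → v < n → key v ≢ suc n → key v + sumTo n (λ x → 1 ∸ done x) ≤ n
      cut-front    : ∀ (τ : ℕ → Bool) → (∀ v → v < n → τ (par v) ≡ τ v) → ∀ {u v} → u < n → v < n →
                     done u ≡ 0 → done v ≡ 0 → key u ≢ suc n → key v ≢ suc n → τ u ≡ τ v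
      cut-done     : ∀ (τ : ℕ → Bool) → (∀ v → v < n → τ (par v) ≡ τ v) → ∀ {u v} → u < n → v < n →
                     done u ≡ 1 → Link u v → τ u ≡ τ v

  data Best (key done : ℕ → ℕ) (i u k : ℕ) : Set where
    none : u ≡ n → k ≡ suc (suc n) → (∀ v → v < i → done v ≡ 1) → Best key done i u k
    some : u < n → done u ≡ 0 → k ≡ key u → (∀ v → v < i → done v ≡ 0 → k ≤ key v) → Best key done i u k

  0≢1 : ∀ {x} → x ≡ 0 → x ≡ 1 → ⊥
  0≢1 refl ()

  forest : ∀ {key par done} → Search key par done → (∀ v → v < n → done v ≡ 1) → Forest key par
  forest s all = record
    { parent = λ v<n → forget (parent v<n)
    ; near   = λ u<n v<n l → proj₂ (closed u<n v<n (all _ u<n) l)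
    ; cut    = λ τ h u<n v<n l → cut-done τ h u<n v<n (all _ u<n) l
    }
    where
    open Search s
    forget : ∀ {A B C D E : Set} → A ⊎ (B × C × D × E) → A ⊎ (B × C × D)
    forget (inj₁ e) = inj₁ e
    forget (inj₂ (p , q , r , _)) = inj₂ (p , q , r)

  initial : ∀ {key par done} → (∀ v → v < n → key v ≡ suc n) → (∀ v → v < n → par v ≡ v) → (∀ v → v < n → done v ≡ 0) →
    Search key par done
  initial k p d = record
    { binary = λ v<n → inj₁ (d _ v<n)
    ; key≤ = λ v<n → ≤-reflexive (k _ v<n)
    ; done-reached = λ v<n e → ⊥-elim (0≢1 (d _ v<n) e)
    ; fresh = λ v<n _ → p _ v<n
    ; parent = λ v<n → inj₁ (p _ v<n)
    ; closed = λ u<n _ e → ⊥-elim (0≢1 (d _ u<n) e)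
    ; level = λ u<n _ _ _ ne → ⊥-elim (ne (k _ u<n))
    ; order = λ u<n _ _ _ ne → ⊥-elim (ne (k _ u<n))
    ; bound = λ v<n ne → ⊥-elim (ne (k _ v<n))
    ; cut-front = λ _ _ u<n _ _ _ ne → ⊥-elim (ne (k _ u<n))
    ; cut-done = λ _ _ u<n _ e → ⊥-elim (0≢1 (d _ u<n) e)
    }

  module _ {key par done : ℕ → ℕ} (s : Search key par done) {u : ℕ} (u<n : u < n) (undone : done u ≡ 0)
           (least : ∀ v → v < n → done v ≡ 0 → key u ≤ key v) where
    open Search s

    -- Since the least key of an unprocessed vertex is the marker `suc n`, no unprocessed vertex has
    -- been reached. The frontier therefore becomes the single vertex `u`, and by `closed` no
    -- processed vertex is linked to it.
    start-root : key u ≡ suc n → Search (update key u 0) par done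
    start-root new = record
      { binary       = binary
      ; key≤         = λ {v} v<n → key≤′ v v<n
      ; done-reached = λ v<n dv e → done-reached v<n dv (trans (sym (same (away dv))) e)
      ; fresh        = λ {v} v<n e → fresh′ v v<n e
      ; parent       = λ {v} v<n → parent′ v v<n
      ; closed       = λ {x} {v} x<n v<n dx l → closed′ x v x<n v<n dx l
      ; level        = λ {x} {v} x<n v<n dx dv rx rv → subst (_≤ suc (key′ x)) (sym (trans (cong key′ (only v<n dv rv)) (update-same key u 0))) z≤n
      ; order        = λ {x} {v} x<n v<n dx dv rx l → ⊥-elim (proj₁ (closed v<n u<n dv (subst (Link v) (only x<n dx rx) l)) new)
      ; bound        = λ {v} v<n rv → bound′ v v<n rv
      ; cut-front    = λ τ h {x} {v} x<n v<n dx dv rx rv → cong τ (trans (only x<n dx rx) (sym (only v<n dv rv)))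
      ; cut-done     = cut-done
      }
      where
      key′ = update key u 0
      same : ∀ {v} → u ≢ v → key′ v ≡ key v
      same {v} = update-other key u 0 v
      away : ∀ {v} → done v ≡ 1 → u ≢ v
      away dv refl = 0≢1 undone dv
      only : ∀ {v} → v < n → done v ≡ 0 → key′ v ≢ suc n → v ≡ u
      only {v} v<n dv rv with u ≟ v
      ... | yes e = sym e
      ... | no u≢v = ⊥-elim (rv (trans (same u≢v) (≤-antisym (key≤ v<n) (≤-trans (≤-reflexive (sym new)) (least v v<n dv)))))
      key≤′ : ∀ v → v < n → key′ v ≤ suc n
      key≤′ v v<n with u ≟ v
      ... | yes refl = subst (_≤ suc n) (sym (update-same key u 0)) z≤n
      ... | no u≢v   = subst (_≤ suc n) (sym (same u≢v)) (key≤ v<n)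
      fresh′ : ∀ v → v < n → key′ v ≡ suc n → par v ≡ v
      fresh′ v v<n e with u ≟ v
      ... | yes refl = fresh v<n new
      ... | no u≢v   = fresh v<n (trans (sym (same u≢v)) e)
      parent′ : ∀ v → v < n → par v ≡ v ⊎ (par v < n × Link (par v) v × key′ v ≡ suc (key′ (par v)) × done (par v) ≡ 1)
      parent′ v v<n with u ≟ v
      ... | yes refl = inj₁ (fresh v<n new)
      ... | no u≢v with parent v<n
      ...   | inj₁ e = inj₁ e
      ...   | inj₂ (p , l , e , d) = inj₂ (p , l , trans (same u≢v) (trans e (cong suc (sym (same (away d))))) , d)
      closed′ : ∀ x v → x < n → v < n → done x ≡ 1 → Link x v → key′ v ≢ suc n × key′ v ≤ suc (key′ x)
      closed′ x v x<n v<n dx l with u ≟ v | closed x<n v<n dx l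
      ... | yes refl | r , _ = ⊥-elim (r new)
      ... | no u≢v   | r , b = r ∘ trans (sym (same u≢v)) , subst₂ (λ a b → a ≤ suc b) (sym (same u≢v)) (sym (same (away dx))) b
      bound′ : ∀ v → v < n → key′ v ≢ suc n → key′ v + sumTo n (λ x → 1 ∸ done x) ≤ n
      bound′ v v<n rv with u ≟ v
      ... | yes refl = subst (λ z → z + sumTo n (λ x → 1 ∸ done x) ≤ n) (sym (update-same key u 0))
                         (≤-trans (sumTo-mono n λ i _ → m∸n≤m 1 (done i)) (≤-reflexive (trans (sumTo-const n 1) (*-identityʳ n))))
      ... | no u≢v   = subst (λ z → z + sumTo n (λ x → 1 ∸ done x) ≤ n) (sym (same u≢v)) (bound v<n (rv ∘ trans (same u≢v)))

    Relaxed : ℕ → ℕ → ℕ → Set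
    Relaxed v k p = (Link u v × key v ≡ suc n × k ≡ suc (key u) × p ≡ u) ⊎
                    (¬ (Link u v × key v ≡ suc n) × k ≡ key v × p ≡ par v)

    undone-drop : sumTo n (λ x → 1 ∸ done x) ≡ suc (sumTo n (λ x → 1 ∸ update done u 1 x))
    undone-drop = begin
      sumTo n f        ≡⟨ sym (+-identityʳ (sumTo n f)) ⟩
      sumTo n f + 0    ≡⟨ cong (λ z → sumTo n f + (1 ∸ z)) (sym (update-same done u 1)) ⟩
      sumTo n f + g u  ≡⟨ sumTo-change n f g u<n (λ i _ i≢u → cong (1 ∸_) (sym (update-other done u 1 i (i≢u ∘ sym)))) ⟩
      sumTo n g + f u  ≡⟨ cong (λ z → sumTo n g + (1 ∸ z)) undone ⟩
      sumTo n g + 1    ≡⟨ +-comm (sumTo n g) 1 ⟩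
      suc (sumTo n g)  ∎
      where
      open ≡-Reasoning
      f g : ℕ → ℕ
      f x = 1 ∸ done x
      g x = 1 ∸ update done u 1 x

    -- The usual breadth-first argument: `u` has the least key on the frontier, so the new frontier
    -- has keys `key u` and `suc (key u)` only. A neighbour of `u` that was reached before is on the
    -- frontier, where `level` applies, or processed, where `order` bounds its key.
    relax : key u ≢ suc n → ∀ {key′ par′} → (∀ v → v < n → Relaxed v (key′ v) (par′ v)) → Search key′ par′ (update done u 1)
    relax reached {key′} {par′} rel = record
      { binary       = λ {v} → binary′ v
      ; key≤         = λ {v} v<n → key≤′ v v<n
      ; done-reached = λ {v} v<n d → done-reached′ v v<n d
      ; fresh        = λ {v} v<n e → fresh′ v v<n e
      ; parent       = λ {v} v<n → parent′ v v<n
      ; closed       = λ {x} {v} x<n v<n dx l → closed′ x v x<n v<n dx l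
      ; level        = λ {x} {v} x<n v<n dx dv rx rv → level′ x v x<n v<n dx dv rx rv
      ; order        = λ {x} {v} x<n v<n dx dv rx l → order′ x v x<n v<n dx dv rx l
      ; bound        = λ {v} v<n rv → bound′ v v<n rv
      ; cut-front    = λ τ h {x} {v} x<n v<n dx dv rx rv → trans (front τ h x x<n dx rx) (sym (front τ h v v<n dv rv))
      ; cut-done     = λ τ h {x} {v} x<n v<n dx l → cut-done′ τ h x v x<n v<n dx l
      }
      where
      done′ = update done u 1
      U  = sumTo n (λ x → 1 ∸ done x)
      U′ = sumTo n (λ x → 1 ∸ done′ x)
      done-u : done′ u ≡ 1
      done-u = update-same done u 1
      other : ∀ {v} → u ≢ v → done′ v ≡ done v
      other {v} = update-other done u 1 v
      -- Processing `u` lowers the number of unprocessed vertices by one, which pays for the larger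
      -- key. Hence real keys never collide with the marker `suc n`.
      suc-key : suc (key u) + U′ ≤ n
      suc-key = ≤-trans (≤-reflexive (trans (sym (+-suc (key u) U′)) (cong (key u +_) (sym undone-drop)))) (bound u<n reached)
      new-reached : suc (key u) ≢ suc n
      new-reached e = <⇒≢ (s≤s (≤-trans (m≤m+n (suc (key u)) U′) suc-key)) e
      still : ∀ {v} → v < n → key v ≢ suc n → key′ v ≡ key v × par′ v ≡ par v
      still {v} v<n r with rel v v<n
      ... | inj₁ (_ , e , _) = ⊥-elim (r e)
      ... | inj₂ (_ , k , p) = k , p
      undone′ : ∀ {v} → done′ v ≡ 0 → done v ≡ 0 × u ≢ v
      undone′ {v} d with u ≟ v
      ... | yes refl = ⊥-elim (0≢1 d done-u)
      ... | no u≢v   = trans (sym (other u≢v)) d , u≢v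
      was-done : ∀ {v} → u ≢ v → done′ v ≡ 1 → done v ≡ 1
      was-done u≢v d = trans (sym (other u≢v)) d
      stays-done : ∀ {v} → done v ≡ 1 → done′ v ≡ 1
      stays-done {v} d = trans (other λ { refl → 0≢1 undone d }) d
      binary′ : ∀ v → v < n → done′ v ≡ 0 ⊎ done′ v ≡ 1
      binary′ v v<n with u ≟ v
      ... | yes refl = inj₂ done-u
      ... | no u≢v rewrite other u≢v = binary v<n
      key≤′ : ∀ v → v < n → key′ v ≤ suc n
      key≤′ v v<n with rel v v<n
      ... | inj₁ (_ , _ , k , _) = ≤-trans (≤-reflexive k) (m≤n⇒m≤1+n (≤-trans (m≤m+n _ U′) suc-key))
      ... | inj₂ (_ , k , _)     = ≤-trans (≤-reflexive k) (key≤ v<n)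
      done-reached′ : ∀ v → v < n → done′ v ≡ 1 → key′ v ≢ suc n
      done-reached′ v v<n d e with u ≟ v
      ... | yes refl = reached (trans (sym (proj₁ (still u<n reached))) e)
      ... | no u≢v   = let r = done-reached v<n (was-done u≢v d) in r (trans (sym (proj₁ (still v<n r))) e)
      fresh′ : ∀ v → v < n → key′ v ≡ suc n → par′ v ≡ v
      fresh′ v v<n e with rel v v<n
      ... | inj₁ (_ , _ , k , _) = ⊥-elim (new-reached (trans (sym k) e))
      ... | inj₂ (_ , k , p)     = trans p (fresh v<n (trans (sym k) e))
      parent′ : ∀ v → v < n → par′ v ≡ v ⊎ (par′ v < n × Link (par′ v) v × key′ v ≡ suc (key′ (par′ v)) × done′ (par′ v) ≡ 1)
      parent′ v v<n with rel v v<n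
      ... | inj₁ (l , _ , k , p) rewrite p = inj₂ (u<n , l , trans k (cong suc (sym (proj₁ (still u<n reached)))) , done-u)
      ... | inj₂ (_ , k , p) rewrite p with parent v<n
      ...   | inj₁ e = inj₁ e
      ...   | inj₂ (q , l , e , d) =
        inj₂ (q , l , trans k (trans e (cong suc (sym (proj₁ (still q (done-reached q d)))))) , stays-done d)
      closed′ : ∀ x v → x < n → v < n → done′ x ≡ 1 → Link x v → key′ v ≢ suc n × key′ v ≤ suc (key′ x)
      closed′ x v x<n v<n dx l with u ≟ x
      ... | no u≢x with closed x<n v<n (was-done u≢x dx) l
      ...   | r , b = r ∘ trans (sym (proj₁ (still v<n r)))
                    , subst₂ (λ a b → a ≤ suc b) (sym (proj₁ (still v<n r))) (sym (proj₁ (still x<n (done-reached x<n (was-done u≢x dx))))) b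
      closed′ x v x<n v<n dx l | yes refl rewrite proj₁ (still u<n reached) with rel v v<n
      ... | inj₁ (_ , _ , k , _) rewrite k = new-reached , ≤-refl
      ... | inj₂ (old , k , _) rewrite k = (λ e → old (l , e)) , close (binary v<n)
        where
        close : done v ≡ 0 ⊎ done v ≡ 1 → key v ≤ suc (key u)
        close (inj₁ d) = level u<n v<n undone d reached (λ e → old (l , e))
        close (inj₂ d) = m≤n⇒m≤1+n (order u<n v<n undone d reached (link-sym u<n v<n l))
      level′ : ∀ x v → x < n → v < n → done′ x ≡ 0 → done′ v ≡ 0 → key′ x ≢ suc n → key′ v ≢ suc n → key′ v ≤ suc (key′ x)
      level′ x v x<n v<n dx dv rx rv with rel x x<n | rel v v<n
      ... | inj₁ (_ , _ , k , _) | inj₁ (_ , _ , k′ , _) rewrite k | k′ = n≤1+n _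
      ... | inj₁ (_ , _ , k , _) | inj₂ (_ , k′ , _) rewrite k | k′ =
        m≤n⇒m≤1+n (level u<n v<n undone (proj₁ (undone′ dv)) reached rv)
      ... | inj₂ (_ , k , _) | inj₁ (_ , _ , k′ , _) rewrite k | k′ = s≤s (least x x<n (proj₁ (undone′ dx)))
      ... | inj₂ (_ , k , _) | inj₂ (_ , k′ , _) rewrite k | k′ =
        level x<n v<n (proj₁ (undone′ dx)) (proj₁ (undone′ dv)) rx rv
      order′ : ∀ x v → x < n → v < n → done′ x ≡ 0 → done′ v ≡ 1 → key′ x ≢ suc n → Link v x → key′ v ≤ key′ x
      order′ x v x<n v<n dx dv rx l with u ≟ v | rel x x<n
      ... | yes refl | inj₁ (_ , _ , k , _) rewrite proj₁ (still u<n reached) | k = n≤1+n _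
      ... | yes refl | inj₂ (_ , k , _) rewrite proj₁ (still u<n reached) | k = least x x<n (proj₁ (undone′ dx))
      ... | no u≢v | inj₁ (_ , e , _) = ⊥-elim (proj₁ (closed v<n x<n (was-done u≢v dv) l) e)
      ... | no u≢v | inj₂ (_ , k , _) rewrite proj₁ (still v<n (done-reached v<n (was-done u≢v dv))) | k =
        order x<n v<n (proj₁ (undone′ dx)) (was-done u≢v dv) rx l
      bound′ : ∀ v → v < n → key′ v ≢ suc n → key′ v + U′ ≤ n
      bound′ v v<n rv with rel v v<n
      ... | inj₁ (_ , _ , k , _) rewrite k = suc-key
      ... | inj₂ (_ , k , _) rewrite k =
        ≤-trans (+-monoʳ-≤ (key v) (≤-trans (n≤1+n U′) (≤-reflexive (sym undone-drop)))) (bound v<n rv)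
      -- Vertices that have just received the parent `u` were their own parents before, so stability
      -- under the new pointers implies stability under the old ones.
      restrict : ∀ (τ : ℕ → Bool) → (∀ v → v < n → τ (par′ v) ≡ τ v) → ∀ v → v < n → τ (par v) ≡ τ v
      restrict τ h v v<n with rel v v<n
      ... | inj₁ (_ , e , _) = cong τ (fresh v<n e)
      ... | inj₂ (_ , _ , p) = trans (cong τ (sym p)) (h v v<n)
      -- The frontier lies in a single tree. So a link from `u` to a frontier vertex preserves `τ`
      -- even when it is not a forest edge.
      front : ∀ (τ : ℕ → Bool) → (∀ v → v < n → τ (par′ v) ≡ τ v) → ∀ v → v < n → done′ v ≡ 0 → key′ v ≢ suc n → τ v ≡ τ u
      front τ h v v<n d r with rel v v<n
      ... | inj₁ (_ , _ , _ , p) = trans (sym (h v v<n)) (cong τ p)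
      ... | inj₂ (_ , k , _)     = cut-front τ (restrict τ h) v<n u<n (proj₁ (undone′ d)) undone (r ∘ trans k) reached
      cut-done′ : ∀ (τ : ℕ → Bool) → (∀ v → v < n → τ (par′ v) ≡ τ v) → ∀ x v → x < n → v < n → done′ x ≡ 1 → Link x v → τ x ≡ τ v
      cut-done′ τ h x v x<n v<n dx l with u ≟ x
      ... | no u≢x = cut-done τ (restrict τ h) x<n v<n (was-done u≢x dx) l
      ... | yes refl with rel v v<n
      ...   | inj₁ (_ , _ , _ , p) = trans (cong τ (sym p)) (h v v<n)
      ...   | inj₂ (old , _ , _) with binary v<n
      ...     | inj₁ d = cut-front τ (restrict τ h) u<n v<n undone d reached (λ e → old (l , e))
      ...     | inj₂ d = sym (cut-done τ (restrict τ h) v<n u<n d (link-sym u<n v<n l))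

-- The forest program: correctness and running time

module Growing (n : ℕ) (E : ℕ → ℕ → Bool) (E-sym : ∀ u v → E u v ≡ E v u)
               (W : ℕ) (big : n * n + (5 * n + 9) ≤ W) (ex : ℕ → ℕ) where

  open Setting n E E-sym W big

  open Forests n (Live E ex) (live-sym ex E-sym)

  SearchOf : State → Set
  SearchOf s = Search (arr s 6) (arr s 7) (arr s 8)

  BestOf : State → Set
  BestOf s = Best (arr s 6) (arr s 8) n (reg s 13) (reg s 14)

  pickTime : ℕ
  pickTime = 2 + suc (suc (n * suc (6 + 1)))

  pick-run : ∀ {s} → reg s 0 ≡ n → (∀ v → v < n → arr s 6 v ≤ suc n) → (∀ v → v < n → arr s 8 v ≡ 0 ⊎ arr s 8 v ≡ 1) →
    Run pickP s pickTime (λ s′ → Best (arr s 6) (arr s 8) n (reg s′ 13) (reg s′ 14))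
  pick-run {s₀} r₀ key≤ binary =
    set n r₀ tt (set (suc (suc n)) (trans (cong (_+ 2) r₀) (+-comm n 2))
      (fits-linear (≤-trans (≤-reflexive (+-comm 2 n)) (+-mono-≤ (m≤m+n n (4 * n)) (s≤s (s≤s z≤n)))))
    (forR n 6 (λ i s → Best key done i (reg s 13) (reg s 14)) (fits-vertex ≤-refl)
      (λ s f → trans (regF f 0 refl) r₀) refl body (none refl refl (λ _ ())) (λ _ _ j → j)))
    where
    key = arr s₀ 6
    done = arr s₀ 8
    s₁ : State
    s₁ = setReg (setReg s₀ 13 n) 14 (suc (suc n))
    body : ∀ i s → i < n → Frame (for 9 (var 0) pickStepP) s₁ s → Small W s → reg s 9 ≡ i → Best key done i (reg s 13) (reg s 14) →
      Run pickStepP s 6 (λ s′ → Best key done (suc i) (reg s′ 13) (reg s′ 14))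
    body i s i<n f _ ri best =
      set (done i) (cong₂ (λ g x → g x) (arrF f 8 refl) ri) tt (condR
        (λ d → set (key i) (cong₂ (λ g x → g x) (arrF f 6 refl) ri) tt (condR
          (λ lt → set i ri tt (assignR (key i) refl tt (better best (≡ᵇ-true d) (<ᵇ-true {key i} lt))))
          (λ ge → skipR (worse best (≡ᵇ-true d) (<ᵇ-false {key i} ge)))))
        (λ d → skipR (skipped best (≡ᵇ-false d))))
      where
      better : ∀ {u k} → Best key done i u k → done i ≡ 0 → key i < k → Best key done (suc i) i (key i)
      better (none _ _ all) d _ = some i<n d refl
        (below-suc {λ v → done v ≡ 0 → key i ≤ key v} (λ v v<i d′ → ⊥-elim (0≢1 d′ (all v v<i))) (λ _ → ≤-refl))
      better (some _ _ _ least) d lt = some i<n d refl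
        (below-suc {λ v → done v ≡ 0 → key i ≤ key v} (λ v v<i d′ → ≤-trans (<⇒≤ lt) (least v v<i d′)) (λ _ → ≤-refl))
      worse : ∀ {u k} → Best key done i u k → done i ≡ 0 → k ≤ key i → Best key done (suc i) u k
      worse (none _ refl _) d ge = ⊥-elim (<⇒≱ ge (key≤ i i<n))
      worse (some u<n du ku least) d ge = some u<n du ku (below-suc {λ v → done v ≡ 0 → _ ≤ key v} least (λ _ → ge))
      skipped : ∀ {u k} → Best key done i u k → done i ≢ 0 → Best key done (suc i) u k
      skipped (none e e′ all) d = none e e′ (below-suc {λ v → done v ≡ 1} all (one (binary i i<n)))
        where
        one : done i ≡ 0 ⊎ done i ≡ 1 → done i ≡ 1
        one (inj₁ z) = ⊥-elim (d z)
        one (inj₂ o) = o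
      skipped (some u<n du ku least) d = some u<n du ku (below-suc {λ v → done v ≡ 0 → _ ≤ key v} least (⊥-elim ∘ d))

  relaxTime : ℕ
  relaxTime = suc (suc (n * suc (10 + 1)))

  relax-run : ∀ {s par done} → Adjacent-lists s → (∀ v → v < n → arr s 5 v ≡ ex v) →
    (S : Search (arr s 6) par done) → ∀ {u} (u<n : u < n) (undone : done u ≡ 0)
    (least : ∀ v → v < n → done v ≡ 0 → arr s 6 u ≤ arr s 6 v) → par ≡ arr s 7 →
    reg s 13 ≡ u → reg s 15 ≡ suc n → reg s 16 ≡ suc (arr s 6 u) → reg s 18 ≡ u * n → reg s 19 ≡ ex u →
    Run relaxP s relaxTime (λ s′ → ∀ v → v < n → Relaxed S u<n undone least v (arr s′ 6 v) (arr s′ 7 v))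
  relax-run {s₀} adj ex≡ S {u} u<n undone least refl r₁₃ r₁₅ r₁₆ r₁₈ r₁₉ =
    forR n 10 J (fits-vertex ≤-refl) (λ s f → trans (regF f 0 refl) (Adjacency.size adj)) refl body
      ((λ _ ()) , λ _ _ → refl , refl)
      (λ s f j → proj₁ j)
    where
    key = arr s₀ 6
    par = arr s₀ 7
    New : ℕ → ℕ → ℕ → Set
    New v k p = Relaxed S u<n undone least v k p
    J : ℕ → State → Set
    J i s = (∀ v → v < i → New v (arr s 6 v) (arr s 7 v)) × (∀ v → i ≤ v → arr s 6 v ≡ key v × arr s 7 v ≡ par v)
    body : ∀ i s → i < n → Frame relaxP s₀ s → Small W s → reg s 9 ≡ i → J i s → Run _ s 10 (λ s′ → J (suc i) (setReg s′ 9 (suc i)))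
    body i s i<n f _ ri (before , after) =
      set (u * n + i) (cong₂ _+_ (trans (regF f 18 refl) r₁₈) ri) (fits-cell u<n i<n)
      (set (bit (E u i)) (Adjacency.cell (keep-graph f adj) u<n i<n) tt
      (set (bit (E u i) ∸ ex u) (cong (bit (E u i) ∸_) (trans (regF f 19 refl) r₁₉)) tt
      (set (ex i) (trans (cong₂ (λ g x → g x) (arrF f 5 refl) ri) (ex≡ i i<n)) tt
      (set (bit (E u i) ∸ ex u ∸ ex i) refl tt
      (condR
        (λ live → set (key i) (trans (cong (arr s 6) ri) (proj₁ (after i ≤-refl))) tt (condR
          (λ new → put i (suc (key u)) ri (trans (regF f 16 refl) r₁₆) tt
                  (storeR i u ri (trans (regF f 13 refl) r₁₃) tt
                    (changed (≡ᵇ-true live) (trans (≡ᵇ-true new) (trans (regF f 15 refl) r₁₅)))))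
          (λ old → skipR (unchanged (λ (_ , e) → ≡ᵇ-false old (trans e (sym (trans (regF f 15 refl) r₁₅))))))))
        (λ dead → skipR (unchanged (λ (l , _) → ≡ᵇ-false dead l))))))))
      where
      unchanged : ¬ (Live E ex u i × key i ≡ suc n) → J (suc i) s
      unchanged no-new = below-suc {λ v → New v (arr s 6 v) (arr s 7 v)} before (inj₂ (no-new , after i ≤-refl)) , λ v i<v → after v (<⇒≤ i<v)
      changed : Live E ex u i → key i ≡ suc n → J (suc i) (setArr (setArr s 6 i (suc (key u))) 7 i u)
      changed l e = done′ , λ v i<v → let i≢v = <⇒≢ i<v in
          trans (update-other (arr s 6) i _ v i≢v) (proj₁ (after v (<⇒≤ i<v))) ,
          trans (update-other (arr s 7) i _ v i≢v) (proj₂ (after v (<⇒≤ i<v)))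
        where
        done′ : ∀ v → v < suc i → New v (update (arr s 6) i (suc (key u)) v) (update (arr s 7) i u v)
        done′ v v< with i ≟ v
        ... | yes refl = inj₁ (l , e , update-same (arr s 6) i _ , update-same (arr s 7) i u)
        ... | no i≢v = subst₂ (New v) (sym (update-other (arr s 6) i _ v i≢v)) (sym (update-other (arr s 7) i u v i≢v))
                         (before v (≤∧≢⇒< (≤-pred v<) (i≢v ∘ sym)))

  undone# : (ℕ → ℕ) → ℕ
  undone# done = sumTo n (λ x → 1 ∸ done x)

  growTime : ℕ
  growTime = 3 + (4 + (relaxTime + pickTime))

  -- Each iteration processes exactly one vertex, so the potential is the number of unprocessed
  -- vertices times the cost of an iteration and its test.
  Looping : ℕ → State → Set
  Looping φ s = SearchOf s × BestOf s × reg s 15 ≡ suc n × φ ≡ undone# (arr s 8) * suc growTime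

  process-run : ∀ {φ s} → Adjacent-lists s → (∀ v → v < n → arr s 5 v ≡ ex v) → SearchOf s → reg s 15 ≡ suc n →
    φ ≡ undone# (arr s 8) * suc growTime →
    ∀ {u} → reg s 13 ≡ u → u < n → arr s 8 u ≡ 0 → reg s 14 ≡ arr s 6 u → arr s 6 u ≢ suc n →
    (∀ v → v < n → arr s 8 v ≡ 0 → arr s 6 u ≤ arr s 6 v) →
    Run processP s (4 + (relaxTime + pickTime)) (λ s′ → ∃[ φ′ ] (suc (growTime + φ′) ≤ φ × Looping φ′ s′))
  process-run {φ} {s} adj ex≡ S r₁₅ φ≡ {u} r₁₃ u<n undone k≡ reached least =
    put u 1 r₁₃ refl tt
    (set (suc (arr s 6 u)) (trans (+-comm _ 1) (cong suc k≡)) (fits-next′ (Search.key≤ S u<n))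
    (set (u * n) (cong₂ _*_ r₁₃ (Adjacency.size adj)) (fits-row u<n)
    (set (ex u) (trans (cong (arr s 5) r₁₃) (ex≡ u u<n)) tt
    (seqR (weaken ≤-refl
      (λ s₂ f _ rel →
        let S₂ = relax S u<n undone least reached rel
            done≡ : arr s₂ 8 ≡ update (arr s 8) u 1
            done≡ = arrF f 8 refl
            S₂′ = subst (λ d → Search (arr s₂ 6) (arr s₂ 7) d) (sym done≡) S₂
        in weaken ≤-refl
          (λ s₃ g _ best → _ ,
            ≤-reflexive (trans (cong (_* suc growTime) (trans (cong (suc ∘ undone#) (trans (arrF g 8 refl) done≡)) (sym (undone-drop S u<n undone least)))) (sym φ≡)) ,
            subst₂ (λ p q → Search p (arr s₃ 7) q) (sym (arrF g 6 refl)) (sym (arrF g 8 refl))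
              (subst (λ q → Search (arr s₂ 6) q (arr s₂ 8)) (sym (arrF g 7 refl)) S₂′) ,
            subst₂ (λ p q → Best p q n (reg s₃ 13) (reg s₃ 14)) (sym (arrF g 6 refl)) (sym (arrF g 8 refl)) best ,
            trans (regF g 15 refl) (trans (regF f 15 refl) r₁₅) , refl)
          (pick-run (trans (regF f 0 refl) (Adjacency.size adj)) (λ v v<n → Search.key≤ S₂′ v<n) (λ v v<n → Search.binary S₂′ v<n)))
      (relax-run adj ex≡ S u<n undone least refl r₁₃ r₁₅ refl refl refl))))))
    where
    fits-next′ : ∀ {x} → x ≤ suc n → suc x < W
    fits-next′ x≤ = fits-linear (≤-trans (s≤s x≤) (≤-trans (≤-reflexive (+-comm 2 n)) (+-mono-≤ (m≤m+n n (4 * n)) (s≤s (s≤s z≤n)))))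

  grow-run : ∀ {φ s} → Adjacent-lists s → (∀ v → v < n → arr s 5 v ≡ ex v) → Looping φ s → reg s 13 < n →
    Run growP s growTime (λ s′ → ∃[ φ′ ] (suc (growTime + φ′) ≤ φ × Looping φ′ s′))
  grow-run {φ} {s} adj ex≡ (S , none u≡n _ _ , _ , _) u< = ⊥-elim (<-irrefl u≡n u<)
  grow-run {φ} {s} adj ex≡ (S , some u<n undone k≡ least , r₁₅ , φ≡) _ = seqR {B = 3} (condR
    (λ root → set 0 refl tt (storeR u 0 refl refl tt
      (process-run adj ex≡ (start-root S u<n undone least′ (trans (sym k≡) (trans (≡ᵇ-true root) r₁₅))) r₁₅ φ≡
        refl u<n undone (sym key-u)
        (λ e → 0≢1+n (trans (sym key-u) e))
        (λ v v<n d → subst (_≤ update (arr s 6) u 0 v) (sym key-u) z≤n))))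
    (λ inner → skipR (process-run adj ex≡ S r₁₅ φ≡ refl u<n undone k≡
      (λ e → ≡ᵇ-false inner (trans k≡ (trans e (sym r₁₅)))) least′)))
    where
    u = reg s 13
    key-u : update (arr s 6) u 0 u ≡ 0
    key-u = update-same (arr s 6) u 0
    least′ : ∀ v → v < n → arr s 8 v ≡ 0 → arr s 6 u ≤ arr s 6 v
    least′ v v<n d = subst (_≤ arr s 6 v) k≡ (least v v<n d)

  forestTime : ℕ
  forestTime = suc (suc (suc (n * suc (3 + 1))) + (pickTime + suc (n * suc growTime)))

  forest-run : ∀ {s} → Adjacent-lists s → (∀ v → v < n → arr s 5 v ≡ ex v) →
    Run forestP s forestTime (λ s′ → Forest (arr s′ 6) (arr s′ 7))
  forest-run {s₀} adj ex≡ = set (suc n) (trans (cong (_+ 1) (Adjacency.size adj)) (+-comm n 1))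
    (fits-linear (≤-trans (≤-reflexive (+-comm 1 n)) (+-mono-≤ (m≤m+n n (4 * n)) (s≤s z≤n))))
    (seqR (forR n 3 J (fits-vertex ≤-refl) (λ s f → trans (regF f 0 refl) (Adjacency.size adj)) refl
      (λ i s i<n f _ ri (k , p , d) → put i (suc n) ri (regF f 15 refl) tt (put i i ri ri tt (storeR i 0 ri refl tt
        ((λ v → update-extend (λ _ x → x ≡ suc n) (k _) refl) , (λ v → update-extend (λ v x → x ≡ v) (p _) refl)
        , (λ v → update-extend (λ _ x → x ≡ 0) (d _) refl)))))
      ((λ _ ()) , (λ _ ()) , (λ _ ()))
      (λ s f (k , p , d) → seqR (weaken ≤-refl
        (λ s₂ g _ best → within (s≤s (*-monoˡ-≤ (suc growTime) (undone#≤n (arr s₂ 8))))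
          (whileR Looping
            (λ φ s₃ h _ l lt → let r₀ = trans (regF h 0 refl) (trans (regF g 0 refl) (trans (regF f 0 refl) (Adjacency.size adj))) in
              growTime , grow-run (keep-graph h (keep-graph g (keep-graph f adj)))
                (λ v v<n → trans (cong (λ q → q v) (trans (arrF h 5 refl) (trans (arrF g 5 refl) (arrF f 5 refl)))) (ex≡ v v<n)) l
                (subst (reg s₃ 13 <_) r₀ (<ᵇ-true {reg s₃ 13} lt)))
            (λ φ s₃ h _ (S , b , _ , _) ge → let r₀ = trans (regF h 0 refl) (trans (regF g 0 refl) (trans (regF f 0 refl) (Adjacency.size adj))) in
              finish S b (subst (_≤ reg s₃ 13) r₀ (<ᵇ-false {reg s₃ 13} ge)))
            ( initial (λ v v<n → trans (cong (λ q → q v) (arrF g 6 refl)) (k v v<n))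
                      (λ v v<n → trans (cong (λ q → q v) (arrF g 7 refl)) (p v v<n))
                      (λ v v<n → trans (cong (λ q → q v) (arrF g 8 refl)) (d v v<n))
            , subst₂ (λ p q → Best p q n (reg s₂ 13) (reg s₂ 14)) (sym (arrF g 6 refl)) (sym (arrF g 8 refl)) best
            , trans (regF g 15 refl) (regF f 15 refl) , refl)))
        (pick-run (trans (regF f 0 refl) (Adjacency.size adj)) (λ v v<n → ≤-reflexive (k v v<n)) (λ v v<n → inj₁ (d v v<n)))))))
    where
    J : ℕ → State → Set
    J i s = (∀ v → v < i → arr s 6 v ≡ suc n) × (∀ v → v < i → arr s 7 v ≡ v) × (∀ v → v < i → arr s 8 v ≡ 0)
    undone#≤n : ∀ done → undone# done ≤ n
    undone#≤n done = ≤-trans (sumTo-mono n λ i _ → m∸n≤m 1 (done i)) (≤-reflexive (trans (sumTo-const n 1) (*-identityʳ n)))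
    finish : ∀ {key par done u k} → Search key par done → Best key done n u k → n ≤ u → Forest key par
    finish S (none _ _ all) _ = forest S all
    finish S (some u<n _ _ _) n≤u = ⊥-elim (<⇒≱ u<n n≤u)

-- Enough pairs of edges

module Universal (n : ℕ) (E : ℕ → ℕ → Bool) (E-sym : ∀ u v → E u v ≡ E v u) (0<n : 0 < n)
  (connected : ∀ (τ : ℕ → Bool) → (∀ u v → u < n → v < n → E u v ≡ true → τ u ≡ τ v) → ∀ u v → u < n → v < n → τ u ≡ τ v)
  where

  open Joins n E E-sym

  ForestOf : (ℕ → ℕ) → (ℕ → ℕ) → (ℕ → ℕ) → Set
  ForestOf ex = Forests.Forest n (Live E ex) (live-sym ex E-sym)

  -- The first four tuples combine the A-edge from `p x` to `x` with the tree edge and the forest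
  -- edge at `y`, in both orientations. In the last one `x` and `y` are the ends of the B-edge.
  record Tried (p f : ℕ → ℕ) (x y : ℕ) : Set where
    constructor tried
    field
      tree-down   : Refuted (p x) x (p y) y
      tree-up     : Refuted (p x) x y (p y)
      forest-down : Refuted (p x) x (f y) y
      forest-up   : Refuted (p x) x y (f y)
      grandparent : Refuted (p (p x)) (p x) y x

  deleted : ℕ → ℕ → ℕ
  deleted x v = bit (E v x)

  module _ {key p : ℕ → ℕ} (tree : ForestOf (λ _ → 0) key p) where
    open Forests.Forest tree

    edge⇒live : ∀ {u v} → E u v ≡ true → Live E (λ _ → 0) u v
    edge⇒live e rewrite e = refl

    live⇒edge : ∀ {u v} → Live E (λ _ → 0) u v → E u v ≡ true
    live⇒edge {u} {v} l with E u v
    ... | true = refl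

    p<n : ∀ {v} → v < n → p v < n
    p<n {v} v<n with parent v<n
    ... | inj₁ e = subst (_< n) (sym e) v<n
    ... | inj₂ (p< , _) = p<

    ancestor : ℕ → ℕ → ℕ
    ancestor zero    v = v
    ancestor (suc k) v = ancestor k (p v)

    ancestor-p : ∀ k v → ancestor k (p v) ≡ p (ancestor k v)
    ancestor-p zero    v = refl
    ancestor-p (suc k) v = ancestor-p k (p v)

    ancestor-root : ∀ k {v} → p v ≡ v → ancestor k v ≡ v
    ancestor-root zero    e = refl
    ancestor-root (suc k) e = trans (cong (ancestor k) e) (ancestor-root k e)

    ancestor-fixed : ∀ k {v} → v < n → key v ≤ k → p (ancestor k v) ≡ ancestor k v
    ancestor-fixed k {v} v<n k≤ with parent v<n
    ancestor-fixed k       v<n k≤ | inj₁ e = trans (cong p (ancestor-root k e)) (trans e (sym (ancestor-root k e)))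
    ancestor-fixed zero    v<n k≤ | inj₂ (_ , _ , e) with () ← subst (_≤ 0) e k≤
    ancestor-fixed (suc k) v<n k≤ | inj₂ (p< , _ , e) = ancestor-fixed k p< (≤-pred (subst (_≤ suc k) e k≤))

    -- Keys drop by one along parents and each is at most the sum of all keys, so this many parent
    -- steps lead from any vertex to a root. The start 0 is arbitrary.
    root : ℕ
    root = ancestor (sumTo n key) 0

    -- Having `root` as the ancestor `K` steps up is stable under parents, hence by `cut` under
    -- edges, hence by connectedness shared by all vertices. A fixed point of `p` is its own
    -- ancestor.
    unique-root : ∀ {v} → v < n → p v ≡ v → v ≡ root
    unique-root {v} v<n e = trans (sym (ancestor-root K e)) (≡ᵇ-true (trans (connected τ (λ _ _ u<n v<n l → cut τ stable u<n v<n (edge⇒live l)) v 0 v<n 0<n) (≡⇒≡ᵇ-true {root} refl)))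
      where
      K = sumTo n key
      τ : ℕ → Bool
      τ v = ancestor K v ≡ᵇ root
      stable : ∀ v → v < n → τ (p v) ≡ τ v
      stable v v<n = cong (_≡ᵇ root) (trans (ancestor-p K v) (ancestor-fixed K v<n (sumTo-≤ n key v<n)))

    up : ∀ {v} → v < n → v ≢ root → E (p v) v ≡ true × key v ≡ suc (key (p v))
    up v<n v≢r with parent v<n
    ... | inj₁ e = ⊥-elim (v≢r (unique-root v<n e))
    ... | inj₂ (_ , l , k) = live⇒edge l , k

    module Side {σ α β a₁ a₂ b₁ b₂} (cp : Compatible σ α β a₁ a₂ b₁ b₂) (σr : σ root ≡ true)
                {x} (x<n : x < n) (σx : σ x ≡ false) (nearest : ∀ w → w < n → key w < key x → σ w ≡ true)
                (αx : α x ≡ true) (αpx : α (p x) ≡ true) (σpx : σ (p x) ≡ true)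
                (all : ∀ x → x < n → ∃[ k ] ∃[ f ] (ForestOf (deleted x) k f × (∀ y → y < n → Tried p f x y))) where
      open Compatible cp

      non-root : ∀ {v} → σ v ≡ false → v ≢ root
      non-root σv refl = true≢false (trans (sym σr) σv)

      not-both : ∀ {v} → v < n → α v ≡ true → β v ≡ true → ⊥
      not-both v<n αv βv = true≢false (trans (sym βv) (disj v<n αv))

      crossing : ∀ {u v} → u < n → v < n → σ u ≡ true → σ v ≡ false → E u v ≡ true →
        (α u ≡ true × α v ≡ true) ⊎ (β u ≡ true × β v ≡ true)
      crossing {u} {v} u<n v<n σu σv e = ∧∨∧-cases (α u) (α v) (β u) (β v) (trans (sym (cross u<n v<n σu σv)) e)

      at-x : ∀ {u v} → u < n → v < n → σ u ≡ true → σ v ≡ false → β u ≡ true → β v ≡ true →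
        Compatible σ α β (p x) x u v
      at-x u<n v<n σu σv βu βv = record
        { join = join ; a₁<n = p<n x<n ; a₂<n = x<n ; b₁<n = u<n ; b₂<n = v<n
        ; σa₁ = σpx ; σb₁ = σu ; σa₂ = σx ; σb₂ = σv ; αa₁ = αpx ; αa₂ = αx ; βb₁ = βu ; βb₂ = βv }

      α-edge : ∀ {u v} → u < n → v < n → σ u ≡ true → σ v ≡ false → α u ≡ true → α v ≡ true → E u v ≡ true
      α-edge {u} {v} u<n v<n σu σv αu αv rewrite cross u<n v<n σu σv | αu | αv = refl

      no-β-tree : ∀ y → y < n → σ y ≢ σ (p y) → β y ≡ true → β (p y) ≡ true → ⊥
      no-β-tree y y<n ne βy βp with all x x<n
      ... | _ , _ , _ , t with σ y in σy | σ (p y) in σp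
      ... | true  | true  = ne refl
      ... | false | false = ne refl
      ... | true  | false = Tried.tree-up (t y y<n) σ α β (at-x y<n (p<n y<n) σy σp βy βp)
      ... | false | true  = Tried.tree-down (t y y<n) σ α β (at-x (p<n y<n) y<n σp σy βp βy)

      live-free : ∀ {u v} → Live E (deleted x) u v → E u v ≡ true × E u x ≡ false × E v x ≡ false
      live-free {u} {v} l = survives (E u v) (E u x) (E v x) l
        where
        survives : ∀ a b c → bit a ∸ bit b ∸ bit c ≡ 1 → a ≡ true × b ≡ false × c ≡ false
        survives true  false false _ = refl , refl , refl
        survives true  true  false ()
        survives true  true  true  ()
        survives true  false true  ()
        survives false true  false ()
        survives false true  true  ()
        survives false false true  ()

      -- Deleting the neighbours of x destroys every α-edge across the cut.
      no-live-cut : ∀ {u v} → u < n → v < n → Live E (deleted x) u v → σ u ≡ true → σ v ≡ false → β u ≡ true × β v ≡ true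
      no-live-cut {u} u<n v<n l σu σv with live-free l
      ... | e , ux , _ with crossing u<n v<n σu σv e
      ...   | inj₂ bs = bs
      ...   | inj₁ (αu , _) = ⊥-elim (true≢false (trans (sym (α-edge u<n x<n σu σx αu αx)) ux))

      -- By `no-live-cut` a forest edge across the cut would be a B-edge, and every forest edge has
      -- been tried as B-edge in both orientations.
      forest-stable : ∀ {k f} → ForestOf (deleted x) k f → (∀ y → y < n → Tried p f x y) → ∀ y → y < n → σ (f y) ≡ σ y
      forest-stable {k} {f} F t y y<n with Forests.Forest.parent F y<n
      ... | inj₁ e = cong σ e
      ... | inj₂ (f< , l , _) with σ (f y) in σf | σ y in σy
      ...   | true  | true  = refl
      ...   | false | false = refl
      ...   | true  | false = let (βf , βy) = no-live-cut f< y<n l σf σy in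
              ⊥-elim (Tried.forest-down (t y y<n) σ α β (at-x f< y<n σf σy βf βy))
      ...   | false | true  = let (βy , βf) = no-live-cut y<n f< (live-sym {n} (deleted x) E-sym f< y<n l) σy σf in
              ⊥-elim (Tried.forest-up (t y y<n) σ α β (at-x y<n f< σy σf βy βf))

      -- Otherwise the edge from `b₁` to `b₂` survives the deletion: `b₁` has label β, `x` has label
      -- α, so they are not adjacent. Since no forest edge crosses the cut, `cut` forbids this edge
      -- to cross it.
      b₂-near : E b₂ x ≡ true
      b₂-near with all x x<n
      ... | _ , _ , F , t with E b₂ x in e₂
      ...   | true  = refl
      ...   | false = ⊥-elim (true≢false (trans (sym σb₁) (trans (Forests.Forest.cut F σ (forest-stable F t) b₁<n b₂<n live) σb₂)))
        where
        b₁-far : E b₁ x ≡ false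
        b₁-far with E b₁ x in e₁
        ... | false = refl
        ... | true with crossing b₁<n x<n σb₁ σx e₁
        ...   | inj₁ (αb₁ , _) = ⊥-elim (not-both b₁<n αb₁ βb₁)
        ...   | inj₂ (_ , βx) = ⊥-elim (not-both x<n αx βx)
        live : Live E (deleted x) b₁ b₂
        live rewrite b₁-far | e₂ = cong bit b₁b₂-edge
          where
          b₁b₂-edge : E b₁ b₂ ≡ true
          b₁b₂-edge rewrite cross b₁<n b₂<n σb₁ σb₂ | βb₁ | βb₂ = ∨-true (α b₁ ∧ α b₂)
            where
            ∨-true : ∀ b → b ∨ true ≡ true
            ∨-true true  = refl
            ∨-true false = refl

      σpb₂ : σ (p b₂) ≡ false
      σpb₂ with σ (p b₂) in e
      ... | false = refl
      ... | true with crossing (p<n b₂<n) b₂<n e σb₂ (proj₁ (up b₂<n (non-root σb₂)))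
      ...   | inj₁ (_ , αb₂) = ⊥-elim (not-both b₂<n αb₂ βb₂)
      ...   | inj₂ (βp , _) = ⊥-elim (no-β-tree b₂ b₂<n (λ q → true≢false (trans (sym e) (trans (sym q) σb₂))) βb₂ βp)

      -- As `b₂` is adjacent to `x`, its level is at most one more than that of `x`, so its
      -- grandparent is strictly nearer to the root than `x` and lies on the first side. The parent
      -- lies on the second side by `σpb₂`. The tree edge between them is a B-edge, excluded by
      -- `no-β-tree`, or the A-edge of the tuple `grandparent` tried at `b₂` and `b₁`.
      contradiction : ⊥
      contradiction with up b₂<n (non-root σb₂) | up (p<n b₂<n) (non-root σpb₂)
      ... | _ , k₁ | e₂ , k₂ with nearest (p (p b₂)) (p<n (p<n b₂<n)) closer
        where
        closer : key (p (p b₂)) < key x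
        closer = ≤-trans (≤-reflexive (sym k₂)) (≤-pred (subst (_≤ suc (key x)) k₁
                   (near x<n b₂<n (edge⇒live (trans (E-sym x b₂) b₂-near)))))
      ... | σpp with crossing (p<n (p<n b₂<n)) (p<n b₂<n) σpp σpb₂ e₂
      ...   | inj₂ (βpp , βp) = no-β-tree (p b₂) (p<n b₂<n) (λ q → true≢false (trans (sym σpp) (trans (sym q) σpb₂))) βp βpp
      ...   | inj₁ (αpp , αp) with all b₂ b₂<n
      ...     | _ , _ , _ , t = Tried.grandparent (t b₁ b₁<n) σ α β (record
        { join = join ; a₁<n = p<n (p<n b₂<n) ; a₂<n = p<n b₂<n ; b₁<n = b₁<n ; b₂<n = b₂<n
        ; σa₁ = σpp ; σb₁ = σb₁ ; σa₂ = σpb₂ ; σb₂ = σb₂ ; αa₁ = αpp ; αa₂ = αp ; βb₁ = βb₁ ; βb₂ = βb₂ })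

    -- Descent on the bound `k`: as long as some vertex outside `σ` has a smaller key, it replaces
    -- `v`.
    closest : ∀ (σ : ℕ → Bool) k v → key v ≤ k → v < n → σ v ≡ false →
      ∃[ x ] (x < n × σ x ≡ false × (∀ w → w < n → key w < key x → σ w ≡ true))
    closest σ k v k≤ v<n σv with anyUpTo? (λ w → (key w <? key v) ×-dec (σ w ≟ᵇ false)) n
    closest σ k v k≤ v<n σv | no none = v , v<n , σv , λ w w<n lt → true-of λ σw → none (w , w<n , lt , σw)
      where
      true-of : ∀ {b} → b ≢ false → b ≡ true
      true-of {true}  _ = refl
      true-of {false} r = ⊥-elim (r refl)
    closest σ zero    v k≤ v<n σv | yes (w , w<n , lt , σw) with () ← <-≤-trans lt k≤
    closest σ (suc k) v k≤ v<n σv | yes (w , w<n , lt , σw) = closest σ k w (≤-pred (<-≤-trans lt k≤)) w<n σw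

    module _ (all : ∀ x → x < n → ∃[ k ] ∃[ f ] (ForestOf (deleted x) k f × (∀ y → y < n → Tried p f x y))) where

      -- The parent of `x` is nearer to the root and hence on its side, so the tree edge at `x`
      -- crosses the cut. If it is a B-edge, exchanging the labels reduces to the case of an A-edge.
      from-root : ∀ {σ α β a₁ a₂ b₁ b₂} → Compatible σ α β a₁ a₂ b₁ b₂ → σ root ≡ true → ⊥
      from-root {σ} {α} {β} {a₂ = a₂} cp σr with closest σ (key a₂) a₂ ≤-refl (Compatible.a₂<n cp) (Compatible.σa₂ cp)
      ... | x , x<n , σx , nearest with up x<n (λ { refl → true≢false (trans (sym σr) σx) })
      ... | e , k with nearest (p x) (p<n x<n) (≤-reflexive (sym k))
      ... | σpx with ∧∨∧-cases (α (p x)) (α x) (β (p x)) (β x) (trans (sym (Compatible.cross cp (p<n x<n) x<n σpx σx)) e)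
      ... | inj₁ (αp , αx) = Side.contradiction cp σr x<n σx nearest αx αp σpx all
      ... | inj₂ (βp , βx) = Side.contradiction (swapLabels cp) σr x<n σx nearest βx βp σpx all

      exhaustive : ∀ {σ α β a₁ a₂ b₁ b₂} → Compatible σ α β a₁ a₂ b₁ b₂ → ⊥
      exhaustive {σ} cp with σ root in σr
      ... | true  = from-root cp σr
      ... | false = from-root (swapSides cp) (cong not σr)

-- Graphs on natural numbers

extend : ∀ {n} → (Fin n → Bool) → ℕ → Bool
extend {zero}  f v       = false
extend {suc n} f zero    = f zero
extend {suc n} f (suc v) = extend (f ∘ suc) v

extend-toℕ : ∀ {n} (f : Fin n → Bool) i → extend f (toℕ i) ≡ f i
extend-toℕ f zero    = refl
extend-toℕ f (suc i) = extend-toℕ (f ∘ suc) i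

extend-out : ∀ {n} (f : Fin n → Bool) {v} → n ≤ v → extend f v ≡ false
extend-out {zero}  f n≤v = refl
extend-out {suc n} f (s≤s n≤v) = extend-out (f ∘ suc) n≤v

data Vertex (n v : ℕ) : Set where
  inside  : (i : Fin n) → toℕ i ≡ v → Vertex n v
  outside : n ≤ v → Vertex n v

vertex : ∀ n v → Vertex n v
vertex n v with v <? n
... | yes v<n = inside (fromℕ< v<n) (toℕ-fromℕ< v<n)
... | no v≮n  = outside (≮⇒≥ v≮n)

∀Fin : ∀ {n} (P : ℕ → Set) → (∀ (i : Fin n) → P (toℕ i)) → ∀ {v} → v < n → P v
∀Fin P p v<n = subst P (toℕ-fromℕ< v<n) (p (fromℕ< v<n))

sumFin : ∀ n → (Fin n → ℕ) → ℕ
sumFin zero    f = 0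
sumFin (suc n) f = f zero + sumFin n (f ∘ suc)

sumFin-cong : ∀ n {f g} → (∀ i → f i ≡ g i) → sumFin n f ≡ sumFin n g
sumFin-cong zero    e = refl
sumFin-cong (suc n) e = cong₂ _+_ (e zero) (sumFin-cong n (e ∘ suc))

sumFin-mono : ∀ n {f g} → (∀ i → f i ≤ g i) → sumFin n f ≤ sumFin n g
sumFin-mono zero    e = z≤n
sumFin-mono (suc n) e = +-mono-≤ (e zero) (sumFin-mono n (e ∘ suc))

sumFin-+ : ∀ n f g → sumFin n (λ i → f i + g i) ≡ sumFin n f + sumFin n g
sumFin-+ zero    f g = refl
sumFin-+ (suc n) f g = trans (cong (f zero + g zero +_) (sumFin-+ n (f ∘ suc) (g ∘ suc)))
  (lemma (f zero) (g zero) (sumFin n (f ∘ suc)) (sumFin n (g ∘ suc)))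
  where
  lemma : ∀ a b c d → a + b + (c + d) ≡ a + c + (b + d)
  lemma = solve-∀

sumFin-swap : ∀ m n (f : Fin m → Fin n → ℕ) → sumFin m (λ i → sumFin n (f i)) ≡ sumFin n (λ j → sumFin m (λ i → f i j))
sumFin-swap zero n f = zeros n
  where
  zeros : ∀ n → 0 ≡ sumFin n (λ _ → 0)
  zeros zero    = refl
  zeros (suc n) = zeros n
sumFin-swap (suc m) n f = trans (cong (sumFin n (f zero) +_) (sumFin-swap m n (f ∘ suc)))
  (sym (sumFin-+ n (f zero) (λ j → sumFin m (λ i → f (suc i) j))))

sumTo-front : ∀ n f → sumTo (suc n) f ≡ f 0 + sumTo n (f ∘ suc)
sumTo-front zero    f = +-comm 0 (f 0)
sumTo-front (suc n) f = trans (cong (_+ f (suc n)) (sumTo-front n f)) (+-assoc (f 0) (sumTo n (f ∘ suc)) (f (suc n)))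

sumTo-sumFin : ∀ n f → sumTo n f ≡ sumFin n (f ∘ toℕ)
sumTo-sumFin zero    f = refl
sumTo-sumFin (suc n) f = trans (sumTo-front n f) (cong (f 0 +_) (sumTo-sumFin n (f ∘ suc)))

∣∣-sumFin : ∀ {n} (S : Subset n) → ∣ S ∣ ≡ sumFin n (bit ∘ lookup S)
∣∣-sumFin []          = refl
∣∣-sumFin (true  ∷ S) = cong suc (∣∣-sumFin S)
∣∣-sumFin (false ∷ S) = ∣∣-sumFin S

length-filter-map : ∀ {A B : Set} {P : B → Set} (P? : ∀ x → Dec (P x)) (g : A → B) n (h : Fin n → A) →
  length (filter P? (List.map g (List.tabulate h))) ≡ sumFin n (λ i → bit (does (P? (g (h i)))))
length-filter-map P? g zero    h = refl
length-filter-map P? g (suc n) h with does (P? (g (h zero)))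
... | true  = cong suc (length-filter-map P? g n (h ∘ suc))
... | false = length-filter-map P? g n (h ∘ suc)

length-filter-product : ∀ {A B : Set} {P : A × B → Set} (P? : ∀ x → Dec (P x)) m n (g : Fin m → A) (h : Fin n → B) →
  length (filter P? (cartesianProduct (List.tabulate g) (List.tabulate h))) ≡
  sumFin m (λ i → sumFin n (λ j → bit (does (P? (g i , h j)))))
length-filter-product P? zero    n g h = refl
length-filter-product P? (suc m) n g h = begin
  length (filter P? (row ++ rest))                     ≡⟨ cong length (filter-++ P? row rest) ⟩
  length (filter P? row ++ filter P? rest)             ≡⟨ length-++ (filter P? row) ⟩
  length (filter P? row) + length (filter P? rest)     ≡⟨ cong₂ _+_ (length-filter-map P? (g zero ,_) n h) (length-filter-product P? m n (g ∘ suc) h) ⟩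
  _                                                    ∎
  where
  open ≡-Reasoning
  row = List.map (g zero ,_) (List.tabulate h)
  rest = cartesianProduct (List.tabulate (g ∘ suc)) (List.tabulate h)

iff⇒≡ : ∀ {a b} → (a ≡ true → b ≡ true) → (b ≡ true → a ≡ true) → a ≡ b
iff⇒≡ {true}  {true}  _ _ = refl
iff⇒≡ {false} {false} _ _ = refl
iff⇒≡ {true}  {false} f _ = sym (f refl)
iff⇒≡ {false} {true}  _ g = g refl

T⇒true : ∀ {b} → T b → b ≡ true
T⇒true {true} _ = refl

true⇒T : ∀ {b} → b ≡ true → T b
true⇒T refl = tt

module OnNaturals {n : ℕ} (G : Graph n) where

  E : ℕ → ℕ → Bool
  E u v = extend (λ i → extend (adj G i) v) u

  E-toℕ : ∀ i j → E (toℕ i) (toℕ j) ≡ adj G i j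
  E-toℕ i j = trans (extend-toℕ (λ i → extend (adj G i) (toℕ j)) i) (extend-toℕ (adj G i) j)

  extend-false : ∀ {n} (f : Fin n → Bool) → (∀ i → f i ≡ false) → ∀ v → extend f v ≡ false
  extend-false {zero}  f e v       = refl
  extend-false {suc n} f e zero    = e zero
  extend-false {suc n} f e (suc v) = extend-false (f ∘ suc) (e ∘ suc) v

  E-out : ∀ u {v} → n ≤ v → E u v ≡ false
  E-out u n≤v = extend-false _ (λ i → extend-out (adj G i) n≤v) u

  E-sym : ∀ u v → E u v ≡ E v u
  E-sym u v with vertex n u | vertex n v
  ... | inside i refl | inside j refl = trans (E-toℕ i j) (trans (Graph.sym G i j) (sym (E-toℕ j i)))
  ... | outside n≤u | _ = trans (extend-out _ n≤u) (sym (E-out v n≤u))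
  ... | _ | outside n≤v = trans (E-out u n≤v) (sym (extend-out _ n≤v))

  matrix-cell : ∀ {u v} → u < n → v < n → matrix G (u * n + v) ≡ bit (E u v)
  matrix-cell {u} {v} u<n v<n with u * n + v <? n * n
  ... | no ≮ = ⊥-elim (≮ (cell-< u u<n v<n))
  ... | yes p = cong bit (trans (cong (uncurry (adj G)) (trans (cong (remQuot n) index) (remQuot-combine i j)))
                  (trans (sym (E-toℕ i j)) (cong₂ E (toℕ-fromℕ< u<n) (toℕ-fromℕ< v<n))))
    where
    i = fromℕ< u<n
    j = fromℕ< v<n
    index : fromℕ< p ≡ combine i j
    index = toℕ-injective (trans (toℕ-fromℕ< p) (sym (trans (toℕ-combine i j)
      (cong₂ _+_ (trans (*-comm n (toℕ i)) (cong (_* n) (toℕ-fromℕ< u<n))) (toℕ-fromℕ< v<n)))))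

  -- Connectedness in the language of cuts, to be combined with the field `cut` of a forest.
  connected : Connected G → ∀ (τ : ℕ → Bool) → (∀ u v → u < n → v < n → E u v ≡ true → τ u ≡ τ v) →
    ∀ u v → u < n → v < n → τ u ≡ τ v
  connected conn τ h u v u<n v<n with vertex n u | vertex n v
  ... | outside n≤u | _ = ⊥-elim (<⇒≱ u<n n≤u)
  ... | _ | outside n≤v = ⊥-elim (<⇒≱ v<n n≤v)
  ... | inside i refl | inside j refl = along (conn i j)
    where
    along : ∀ {i j} → Star (Adjacent G) i j → τ (toℕ i) ≡ τ (toℕ j)
    along ε = refl
    along {i} (_◅_ {j = k} a as) = trans (h (toℕ i) (toℕ k) (toℕ<n i) (toℕ<n k) (trans (E-toℕ i k) (T⇒true a))) (along as)

  degree-sum : ℕ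
  degree-sum = sumTo n (λ v → sumTo n (λ x → bit (E v x)))

  degree-sum-Fin : degree-sum ≡ sumFin n (λ i → sumFin n (λ j → bit (adj G i j)))
  degree-sum-Fin = trans (sumTo-sumFin n _) (sumFin-cong n λ i →
    trans (sumTo-sumFin n _) (sumFin-cong n λ j → cong bit (E-toℕ i j)))

  -- An adjacent pair is listed in one of its two orientations, and summing over both orientations
  -- counts the list of edges twice.
  handshake : degree-sum ≤ 2 * ∣E G ∣
  handshake = begin
    degree-sum                                                      ≡⟨ degree-sum-Fin ⟩
    sumFin n (λ i → sumFin n (λ j → bit (adj G i j)))               ≤⟨ sumFin-mono n (λ i → sumFin-mono n (λ j → either i j)) ⟩
    sumFin n (λ i → sumFin n (λ j → g i j + g j i))                 ≡⟨ sumFin-cong n (λ i → sumFin-+ n (g i) (λ j → g j i)) ⟩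
    sumFin n (λ i → sumFin n (g i) + sumFin n (λ j → g j i))        ≡⟨ sumFin-+ n _ _ ⟩
    M + sumFin n (λ i → sumFin n (λ j → g j i))                     ≡⟨ cong (M +_) (sym (sumFin-swap n n g)) ⟩
    M + M                                                           ≡⟨ cong (λ z → z + z) (sym (length-filter-product P? n n id id)) ⟩
    ∣E G ∣ + ∣E G ∣                                                 ≡⟨ cong (∣E G ∣ +_) (sym (+-identityʳ ∣E G ∣)) ⟩
    2 * ∣E G ∣                                                      ∎
    where
    open ≤-Reasoning
    P? : ∀ e → Dec _
    P? = λ ((u , v) : Fin n × Fin n) → (u <ᶠ? v) ×-dec T? (adj G u v)
    g : Fin n → Fin n → ℕ
    g i j = bit (does (P? (i , j)))
    M = sumFin n (λ i → sumFin n (g i))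
    listed : ∀ i j → toℕ i < toℕ j → adj G i j ≡ true → 1 ≤ g i j
    listed i j i<j a = ≤-reflexive (sym (cong bit (cong₂ _∧_ (T⇒true (<⇒<ᵇ i<j)) a)))
    either : ∀ i j → bit (adj G i j) ≤ g i j + g j i
    either i j = go (adj G i j) refl
      where
      go : ∀ b → adj G i j ≡ b → bit b ≤ g i j + g j i
      go false a = z≤n
      go true  a with <-cmp (toℕ i) (toℕ j)
      ... | tri< i<j _ _ = ≤-trans (listed i j i<j a) (m≤m+n _ _)
      ... | tri> _ _ j<i = ≤-trans (listed j i j<i (trans (Graph.sym G j i) a)) (m≤n+m _ (g i j))
      ... | tri≈ _ e _ with toℕ-injective e
      ...   | refl with () ← trans (sym a) (Graph.irrefl G i)

  -- A path to another vertex starts with an edge, so no vertex is isolated. This lets terms without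
  -- a factor m be absorbed in the time bound.
  n≤degree-sum : Connected G → 2 ≤ n → n ≤ degree-sum
  n≤degree-sum conn 2≤n = begin
    n                             ≡⟨ sym (trans (sumTo-const n 1) (*-identityʳ n)) ⟩
    sumTo n (λ _ → 1)             ≤⟨ sumTo-mono n (λ v → ∀Fin (λ v → 1 ≤ sumTo n (λ x → bit (E v x))) degree≥1) ⟩
    degree-sum                    ∎
    where
    open ≤-Reasoning
    another : ∀ {n} → 2 ≤ n → (i : Fin n) → ∃[ j ] i ≢ j
    another (s≤s (s≤s z≤n)) zero    = suc zero , λ ()
    another (s≤s (s≤s z≤n)) (suc i) = zero , λ ()
    degree≥1 : ∀ i → 1 ≤ sumTo n (λ x → bit (E (toℕ i) x))
    degree≥1 i with another 2≤n i
    ... | j , i≢j with conn i j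
    ...   | ε = ⊥-elim (i≢j refl)
    ...   | _◅_ {j = k} a _ = ≤-trans (≤-reflexive (cong bit (sym (trans (E-toℕ i k) (T⇒true a)))))
              (sumTo-≤ n (λ x → bit (E (toℕ i) x)) (toℕ<n k))

  open Joins n E E-sym

  size-tabulate : ∀ f → ∣ tabulate {n = n} (f ∘ toℕ) ∣ ≡ sumTo n (λ v → bit (f v))
  size-tabulate f = trans (∣∣-sumFin (tabulate {n = n} (f ∘ toℕ)))
    (trans (sumFin-cong n λ i → cong bit (lookup∘tabulate (f ∘ toℕ) i)) (sym (sumTo-sumFin n _)))

  size-extend : ∀ (S : Subset n) → ∣ S ∣ ≡ sumTo n (λ v → bit (extend (lookup S) v))
  size-extend S = trans (∣∣-sumFin S)
    (trans (sumFin-cong n λ i → cong bit (sym (extend-toℕ (lookup S) i))) (sym (sumTo-sumFin n _)))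

  -- Joining A₁ with A₂ and B₁ with B₂ loses nothing, as the sides separate them again; this is the
  -- role of `first` and `second`. The four chosen vertices are the witnesses of non-emptiness.
  fromJoin : ∀ {X₁ X₂} → Is2Join G X₁ X₂ → ∃[ σ ] ∃[ α ] ∃[ β ] ∃[ a₁ ] ∃[ a₂ ] ∃[ b₁ ] ∃[ b₂ ] Compatible σ α β a₁ a₂ b₁ b₂
  fromJoin {X₁} {X₂} J = χ X₁ , χ (A₁ ∪ A₂) , χ (B₁ ∪ B₂) ,
    toℕ (proj₁ A₁-nonempty) , toℕ (proj₁ A₂-nonempty) , toℕ (proj₁ B₁-nonempty) , toℕ (proj₁ B₂-nonempty) , record
    { join = record
      { cross = λ u<n v<n → ∀Fin (λ u → χ X₁ u ≡ true → χ X₁ _ ≡ false → _) (λ i → ∀Fin (λ v → χ X₁ (toℕ i) ≡ true → χ X₁ v ≡ false →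
          E (toℕ i) v ≡ (χ (A₁ ∪ A₂) (toℕ i) ∧ χ (A₁ ∪ A₂) v) ∨ (χ (B₁ ∪ B₂) (toℕ i) ∧ χ (B₁ ∪ B₂) v)) (cross i) v<n) u<n
      ; disj  = λ v<n → ∀Fin (λ v → χ (A₁ ∪ A₂) v ≡ true → χ (B₁ ∪ B₂) v ≡ false) (λ i a → ≢true⇒false λ b → apart (∈-of a) (∈-of b)) v<n
      ; size₁ = ≤-trans 3≤∣X₁∣ (≤-reflexive (size-extend X₁))
      ; size₂ = ≤-trans 3≤∣X₂∣ (≤-reflexive (trans (size-extend X₂) (sumTo-cong n λ v v<n →
          ∀Fin (λ v → bit (χ X₂ v) ≡ bit (not (χ X₁ v))) (cong bit ∘ opposite) v<n)))
      }
    ; a₁<n = toℕ<n _ ; a₂<n = toℕ<n _ ; b₁<n = toℕ<n _ ; b₂<n = toℕ<n _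
    ; σa₁ = of-∈ (A₁⊆X₁ (proj₂ A₁-nonempty)) ; σb₁ = of-∈ (B₁⊆X₁ (proj₂ B₁-nonempty))
    ; σa₂ = not-X₁ (A₂⊆X₂ (proj₂ A₂-nonempty)) ; σb₂ = not-X₁ (B₂⊆X₂ (proj₂ B₂-nonempty))
    ; αa₁ = of-∈ (x∈p∪q⁺ {p = A₁} {A₂} (inj₁ (proj₂ A₁-nonempty))) ; αa₂ = of-∈ (x∈p∪q⁺ {p = A₁} {A₂} (inj₂ (proj₂ A₂-nonempty)))
    ; βb₁ = of-∈ (x∈p∪q⁺ {p = B₁} {B₂} (inj₁ (proj₂ B₁-nonempty))) ; βb₂ = of-∈ (x∈p∪q⁺ {p = B₁} {B₂} (inj₂ (proj₂ B₂-nonempty)))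
    }
    where
    open Is2Join J
    χ : Subset n → ℕ → Bool
    χ S = extend (lookup S)
    of-∈ : ∀ {S i} → i ∈ S → χ S (toℕ i) ≡ true
    of-∈ {S} {i} i∈S = trans (extend-toℕ (lookup S) i) ([]=⇒lookup i∈S)
    ∈-of : ∀ {S i} → χ S (toℕ i) ≡ true → i ∈ S
    ∈-of {S} {i} e = lookup⇒[]= i S (trans (sym (extend-toℕ (lookup S) i)) e)
    separate : ∀ {i} → i ∈ X₁ → i ∈ X₂ → ⊥
    separate p q = X-disjoint (_ , x∈p∩q⁺ (p , q))
    not-X₁ : ∀ {i} → i ∈ X₂ → χ X₁ (toℕ i) ≡ false
    not-X₁ q = ≢true⇒false λ e → separate (∈-of e) q
    in-X₂ : ∀ {i} → χ X₁ (toℕ i) ≡ false → i ∈ X₂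
    in-X₂ {i} e with x∈p∪q⁻ X₁ X₂ (subst (i ∈_) (sym X-cover) ∈⊤)
    ... | inj₂ q = q
    ... | inj₁ p with () ← trans (sym (of-∈ p)) e
    opposite : ∀ i → χ X₂ (toℕ i) ≡ not (χ X₁ (toℕ i))
    opposite i with χ X₁ (toℕ i) in e
    ... | true  = ≢true⇒false λ q → separate (∈-of e) (∈-of q)
    ... | false = of-∈ (in-X₂ e)
    apart : ∀ {i} → i ∈ A₁ ∪ A₂ → i ∈ B₁ ∪ B₂ → ⊥
    apart a b with x∈p∪q⁻ A₁ A₂ a | x∈p∪q⁻ B₁ B₂ b
    ... | inj₁ a₁ | inj₁ b₁ = A₁B₁-disjoint (_ , x∈p∩q⁺ (a₁ , b₁))
    ... | inj₁ a₁ | inj₂ b₂ = separate (A₁⊆X₁ a₁) (B₂⊆X₂ b₂)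
    ... | inj₂ a₂ | inj₁ b₁ = separate (B₁⊆X₁ b₁) (A₂⊆X₂ a₂)
    ... | inj₂ a₂ | inj₂ b₂ = A₂B₂-disjoint (_ , x∈p∩q⁺ (a₂ , b₂))
    first : ∀ {S T i} → T ⊆ X₂ → i ∈ X₁ → i ∈ S ∪ T → i ∈ S
    first {S} {T} T⊆X₂ i∈X₁ i∈ with x∈p∪q⁻ S T i∈
    ... | inj₁ s = s
    ... | inj₂ t = ⊥-elim (separate i∈X₁ (T⊆X₂ t))
    second : ∀ {S T i} → S ⊆ X₁ → i ∈ X₂ → i ∈ S ∪ T → i ∈ T
    second {S} {T} S⊆X₁ i∈X₂ i∈ with x∈p∪q⁻ S T i∈
    ... | inj₁ s = ⊥-elim (separate (S⊆X₁ s) i∈X₂)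
    ... | inj₂ t = t
    ∧-left : ∀ {a b} c d → a ≡ true → b ≡ true → (a ∧ b) ∨ (c ∧ d) ≡ true
    ∧-left c d refl refl = refl
    ∧-right : ∀ a b {c d} → c ≡ true → d ≡ true → (a ∧ b) ∨ (c ∧ d) ≡ true
    ∧-right true  true  refl refl = refl
    ∧-right true  false refl refl = refl
    ∧-right false b     refl refl = refl
    cross : ∀ i j → χ X₁ (toℕ i) ≡ true → χ X₁ (toℕ j) ≡ false →
      E (toℕ i) (toℕ j) ≡ (χ (A₁ ∪ A₂) (toℕ i) ∧ χ (A₁ ∪ A₂) (toℕ j)) ∨ (χ (B₁ ∪ B₂) (toℕ i) ∧ χ (B₁ ∪ B₂) (toℕ j))
    cross i j σi σj = iff⇒≡ to from
      where
      i∈X₁ = ∈-of {X₁} σi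
      j∈X₂ = in-X₂ σj
      to : E (toℕ i) (toℕ j) ≡ true → _
      to e with no-others i j i∈X₁ j∈X₂ (true⇒T (trans (sym (E-toℕ i j)) e))
      ... | inj₁ (a , a′) = ∧-left (χ (B₁ ∪ B₂) (toℕ i)) _ (of-∈ (x∈p∪q⁺ {p = A₁} {A₂} (inj₁ a))) (of-∈ (x∈p∪q⁺ {p = A₁} {A₂} (inj₂ a′)))
      ... | inj₂ (b , b′) = ∧-right (χ (A₁ ∪ A₂) (toℕ i)) _ (of-∈ (x∈p∪q⁺ {p = B₁} {B₂} (inj₁ b))) (of-∈ (x∈p∪q⁺ {p = B₁} {B₂} (inj₂ b′)))
      from : _ → E (toℕ i) (toℕ j) ≡ true
      from e with ∧∨∧-cases (χ (A₁ ∪ A₂) (toℕ i)) _ _ _ e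
      ... | inj₁ (a , a′) = trans (E-toℕ i j) (T⇒true (A-complete i j (first {A₁} {A₂} A₂⊆X₂ i∈X₁ (∈-of a)) (second {A₁} {A₂} A₁⊆X₁ j∈X₂ (∈-of a′))))
      ... | inj₂ (b , b′) = trans (E-toℕ i j) (T⇒true (B-complete i j (first {B₁} {B₂} B₂⊆X₂ i∈X₁ (∈-of b)) (second {B₁} {B₂} B₁⊆X₁ j∈X₂ (∈-of b′))))

  toJoin : ∀ {σ α β a₁ a₂ b₁ b₂} → Compatible σ α β a₁ a₂ b₁ b₂ →
    Is2Join G (tabulate (σ ∘ toℕ)) (tabulate (not ∘ σ ∘ toℕ))
  toJoin {σ} {α} {β} cp = record
    { X-disjoint = λ (i , p) → let (q , r) = x∈p∩q⁻ _ _ p in true≢false (trans (sym (∈-of σ q)) (not-true (∈-of (not ∘ σ) r)))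
    ; X-cover = ⊆-antisym ⊆⊤ (λ {i} _ → cover i)
    ; A₁ = set (λ v → σ v ∧ α v) ; B₁ = set (λ v → σ v ∧ β v)
    ; A₂ = set (λ v → not (σ v) ∧ α v) ; B₂ = set (λ v → not (σ v) ∧ β v)
    ; A₁⊆X₁ = λ p → of-∈ σ (∧-fst (∈-of (λ v → σ v ∧ α v) p)) ; B₁⊆X₁ = λ p → of-∈ σ (∧-fst (∈-of (λ v → σ v ∧ β v) p))
    ; A₂⊆X₂ = λ p → of-∈ (not ∘ σ) (∧-fst (∈-of (λ v → not (σ v) ∧ α v) p))
    ; B₂⊆X₂ = λ p → of-∈ (not ∘ σ) (∧-fst (∈-of (λ v → not (σ v) ∧ β v) p))
    ; A₁-nonempty = element (λ v → σ v ∧ α v) a₁<n (∧-intro σa₁ αa₁)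
    ; B₁-nonempty = element (λ v → σ v ∧ β v) b₁<n (∧-intro σb₁ βb₁)
    ; A₂-nonempty = element (λ v → not (σ v) ∧ α v) a₂<n (∧-intro (cong not σa₂) αa₂)
    ; B₂-nonempty = element (λ v → not (σ v) ∧ β v) b₂<n (∧-intro (cong not σb₂) βb₂)
    ; A₁B₁-disjoint = λ (i , p) → let (q , r) = x∈p∩q⁻ _ _ p in
        exclusive i (∧-snd (σ (toℕ i)) (∈-of (λ v → σ v ∧ α v) q)) (∧-snd (σ (toℕ i)) (∈-of (λ v → σ v ∧ β v) r))
    ; A₂B₂-disjoint = λ (i , p) → let (q , r) = x∈p∩q⁻ _ _ p in
        exclusive i (∧-snd (not (σ (toℕ i))) (∈-of (λ v → not (σ v) ∧ α v) q)) (∧-snd (not (σ (toℕ i))) (∈-of (λ v → not (σ v) ∧ β v) r))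
    ; A-complete = λ u v p q → let p′ = ∈-of (λ v → σ v ∧ α v) p ; q′ = ∈-of (λ v → not (σ v) ∧ α v) q in
        adjacent u v (∧-fst p′) (not-true (∧-fst q′)) (inj₁ (∧-snd (σ (toℕ u)) p′ , ∧-snd (not (σ (toℕ v))) q′))
    ; B-complete = λ u v p q → let p′ = ∈-of (λ v → σ v ∧ β v) p ; q′ = ∈-of (λ v → not (σ v) ∧ β v) q in
        adjacent u v (∧-fst p′) (not-true (∧-fst q′)) (inj₂ (∧-snd (σ (toℕ u)) p′ , ∧-snd (not (σ (toℕ v))) q′))
    ; no-others = λ u v p q a → others u v (∈-of σ p) (∈-of (not ∘ σ) q) a
    ; 3≤∣X₁∣ = ≤-trans size₁ (≤-reflexive (sym (size-tabulate σ)))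
    ; 3≤∣X₂∣ = ≤-trans size₂ (≤-reflexive (sym (size-tabulate (not ∘ σ))))
    }
    where
    open Compatible cp
    set : (ℕ → Bool) → Subset n
    set f = tabulate (f ∘ toℕ)
    of-∈ : ∀ f {i} → f (toℕ i) ≡ true → i ∈ set f
    of-∈ f {i} e = lookup⇒[]= i (set f) (trans (lookup∘tabulate (f ∘ toℕ) i) e)
    ∈-of : ∀ f {i} → i ∈ set f → f (toℕ i) ≡ true
    ∈-of f {i} p = trans (sym (lookup∘tabulate (f ∘ toℕ) i)) ([]=⇒lookup p)
    not-true : ∀ {b} → not b ≡ true → b ≡ false
    not-true {false} _ = refl
    ∧-fst : ∀ {a b} → a ∧ b ≡ true → a ≡ true
    ∧-fst {true} _ = refl
    ∧-snd : ∀ a {b} → a ∧ b ≡ true → b ≡ true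
    ∧-snd true e = e
    ∧-intro : ∀ {a b} → a ≡ true → b ≡ true → a ∧ b ≡ true
    ∧-intro refl refl = refl
    cover : ∀ i → i ∈ set σ ∪ set (not ∘ σ)
    cover i with σ (toℕ i) in e
    ... | true  = x∈p∪q⁺ (inj₁ (of-∈ σ e))
    ... | false = x∈p∪q⁺ {p = set σ} (inj₂ (of-∈ (not ∘ σ) (cong not e)))
    element : ∀ f {v} → v < n → f v ≡ true → Nonempty (set f)
    element f v<n e = fromℕ< v<n , of-∈ f (trans (cong f (toℕ-fromℕ< v<n)) e)
    exclusive : ∀ i → α (toℕ i) ≡ true → β (toℕ i) ≡ true → ⊥
    exclusive i a b = true≢false (trans (sym b) (disj (toℕ<n i) a))
    adjacent : ∀ u v → σ (toℕ u) ≡ true → σ (toℕ v) ≡ false →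
      (α (toℕ u) ≡ true × α (toℕ v) ≡ true) ⊎ (β (toℕ u) ≡ true × β (toℕ v) ≡ true) → Adjacent G u v
    adjacent u v σu σv c = true⇒T (trans (sym (E-toℕ u v)) (trans (cross (toℕ<n u) (toℕ<n v) σu σv) (holds c)))
      where
      holds : ∀ {a b c d} → (a ≡ true × b ≡ true) ⊎ (c ≡ true × d ≡ true) → (a ∧ b) ∨ (c ∧ d) ≡ true
      holds (inj₁ (refl , refl)) = refl
      holds {true}  {true}  (inj₂ (refl , refl)) = refl
      holds {true}  {false} (inj₂ (refl , refl)) = refl
      holds {false}         (inj₂ (refl , refl)) = refl
    others : ∀ u v → σ (toℕ u) ≡ true → not (σ (toℕ v)) ≡ true → Adjacent G u v →
      (u ∈ set (λ v → σ v ∧ α v) × v ∈ set (λ v → not (σ v) ∧ α v)) ⊎ (u ∈ set (λ v → σ v ∧ β v) × v ∈ set (λ v → not (σ v) ∧ β v))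
    others u v σu σv a with ∧∨∧-cases (α (toℕ u)) (α (toℕ v)) (β (toℕ u)) (β (toℕ v))
        (trans (sym (cross (toℕ<n u) (toℕ<n v) σu (not-true σv))) (trans (E-toℕ u v) (T⇒true a)))
    ... | inj₁ (p , q) = inj₁ (of-∈ (λ v → σ v ∧ α v) (∧-intro σu p) , of-∈ (λ v → not (σ v) ∧ α v) (∧-intro σv q))
    ... | inj₂ (p , q) = inj₂ (of-∈ (λ v → σ v ∧ β v) (∧-intro σu p) , of-∈ (λ v → not (σ v) ∧ β v) (∧-intro σv q))

  labelled-join : ∀ {σ α β a₁ a₂ b₁ b₂} s → Compatible σ α β a₁ a₂ b₁ b₂ →
    (∀ v → v < n → arr s 1 v ≡ (if σ v then 1 else 2)) → Is2Join G (labelled n s 1) (labelled n s 2)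
  labelled-join {σ} s cp lab = subst₂ (Is2Join G)
    (sym (tabulate-cong λ i → trans (cong (_≡ᵇ 1) (lab (toℕ i) (toℕ<n i))) (is-1 (σ (toℕ i)))))
    (sym (tabulate-cong λ i → trans (cong (_≡ᵇ 2) (lab (toℕ i) (toℕ<n i))) (is-2 (σ (toℕ i)))))
    (toJoin cp)
    where
    is-1 : ∀ b → ((if b then 1 else 2) ≡ᵇ 1) ≡ b
    is-1 true  = refl
    is-1 false = refl
    is-2 : ∀ b → ((if b then 1 else 2) ≡ᵇ 2) ≡ not b
    is-2 true  = refl
    is-2 false = refl

-- The search for a 2-join

module Search (n : ℕ) (E : ℕ → ℕ → Bool) (E-sym : ∀ u v → E u v ≡ E v u)
              (W : ℕ) (big : n * n + (5 * n + 9) ≤ W) (5<n : 5 < n)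
  (connected : ∀ (τ : ℕ → Bool) → (∀ u v → u < n → v < n → E u v ≡ true → τ u ≡ τ v) → ∀ u v → u < n → v < n → τ u ≡ τ v)
  where

  open Setting n E E-sym W big
  open Joins n E E-sym
  open Tuples n E E-sym W big 5<n
  open Universal n E E-sym (≤-<-trans z≤n 5<n) connected

  record Row (u j l : ℕ) (nbr : ℕ → ℕ) : Set where
    field
      counted : l ≡ sumTo j (λ v → bit (E u v))
      near    : ∀ {i} → i < l → nbr (u * n + i) < n × E u (nbr (u * n + i)) ≡ true
      listed  : ∀ {v} → v < j → E u v ≡ true → ∃[ i ] (i < l × nbr (u * n + i) ≡ v)

    l≤j : l ≤ j
    l≤j = ≤-trans (≤-reflexive counted)
      (≤-trans (sumTo-mono j λ i _ → bit≤1 (E u i)) (≤-reflexive (trans (sumTo-const j 1) (*-identityʳ j))))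

  row-keep : ∀ {u l nbr} i k x → u ≢ i → k < n → Row u n l nbr → Row u n l (update nbr (i * n + k) x)
  row-keep {u} {l} {nbr} i k x u≢i k<n r = record
    { counted = counted
    ; near    = λ i< → subst (λ y → y < n × E u y ≡ true) (sym (old i<)) (near i<)
    ; listed  = λ v< e → let (j , j< , eq) = listed v< e in j , j< , trans (old j<) eq
    }
    where
    open Row r
    old : ∀ {j} → j < l → update nbr (i * n + k) x (u * n + j) ≡ nbr (u * n + j)
    old j< = update-other nbr (i * n + k) x _ (u≢i ∘ sym ∘ cell-injective i u k<n (<-≤-trans j< l≤j))

  row-add : ∀ {u j l nbr} → j < n → E u j ≡ true → Row u j l nbr → Row u (suc j) (l + 1) (update nbr (u * n + l) j)
  row-add {u} {j} {l} {nbr} j<n e r = record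
    { counted = cong₂ _+_ counted (cong bit (sym e))
    ; near    = λ {i} i< → near′ i i<
    ; listed  = λ {v} v< ev → listed′ v v< ev
    }
    where
    open Row r
    old : ∀ {i} → i < l → update nbr (u * n + l) j (u * n + i) ≡ nbr (u * n + i)
    old i< = update-other nbr (u * n + l) j _ λ q → <⇒≢ i< (sym (+-cancelˡ-≡ (u * n) _ _ q))
    near′ : ∀ i → i < l + 1 → update nbr (u * n + l) j (u * n + i) < n × E u (update nbr (u * n + l) j (u * n + i)) ≡ true
    near′ i i< with i ≟ l
    ... | yes refl rewrite update-same nbr (u * n + l) j = j<n , e
    ... | no i≢l = let i<l = ≤∧≢⇒< (≤-pred (subst (i <_) (+-comm l 1) i<)) i≢l
                   in subst (λ y → y < n × E u y ≡ true) (sym (old i<l)) (near i<l)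
    listed′ : ∀ v → v < suc j → E u v ≡ true → ∃[ i ] (i < l + 1 × update nbr (u * n + l) j (u * n + i) ≡ v)
    listed′ v v< ev with v ≟ j
    ... | yes refl = l , m<m+n l (s≤s z≤n) , update-same nbr (u * n + l) v
    ... | no v≢j = let (i , i< , eq) = listed (≤∧≢⇒< (≤-pred v<) v≢j) ev
                   in i , <-≤-trans i< (m≤m+n l 1) , trans (old i<) eq

  row-skip : ∀ {u j l nbr} → E u j ≡ false → Row u j l nbr → Row u (suc j) l nbr
  row-skip {u} {j} e r = record
    { counted = trans counted (trans (sym (+-identityʳ _)) (cong (λ b → sumTo j (λ v → bit (E u v)) + bit b) (sym e)))
    ; near    = near
    ; listed  = λ {v} v< ev → listed (≤∧≢⇒< (≤-pred v<) (λ { refl → true≢false (trans (sym ev) e) })) ev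
    }
    where open Row r

  neighboursTime : ℕ
  neighboursTime = suc (suc (n * suc ((2 + (suc (suc (n * suc (6 + 1))) + 1)) + 1)))

  neighbours-run : ∀ {s} → reg s 0 ≡ n → (∀ {u v} → u < n → v < n → arr s 0 (u * n + v) ≡ bit (E u v)) →
    Run neighboursP s neighboursTime Adjacent-lists
  neighbours-run {s₀} r₀ cell = forR n (2 + (suc (suc (n * suc (6 + 1))) + 1)) J (fits-vertex ≤-refl)
    (λ s f → trans (regF f 0 refl) r₀) refl body (λ _ ())
    (λ s f j → record
      { size   = trans (regF f 0 refl) r₀
      ; cell   = λ u<n v<n → trans (cong (λ g → g _) (arrF f 0 refl)) (cell u<n v<n)
      ; degree = λ u<n → Row.counted (j _ u<n)
      ; near   = λ u<n → Row.near (j _ u<n)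
      ; listed = λ u<n → Row.listed (j _ u<n) })
    where
    J : ℕ → State → Set
    J i s = ∀ u → u < i → Row u n (arr s 2 u) (arr s 3)
    body : ∀ i s → i < n → Frame neighboursP s₀ s → Small W s → reg s 9 ≡ i → J i s →
      Run _ s (2 + (suc (suc (n * suc (6 + 1))) + 1)) (λ s′ → J (suc i) (setReg s′ 9 (suc i)))
    body i s i<n f _ ri before =
      set (i * n) (cong₂ _*_ ri (trans (regF f 0 refl) r₀)) (fits-row i<n)
      (set 0 refl tt
      (seqR (forR n 6 J′ (fits-vertex ≤-refl) (λ s′ g → trans (regF g 0 refl) (trans (regF f 0 refl) r₀)) refl inner
        (record { counted = refl ; near = λ () ; listed = λ () } , before)
        (λ s′ g (row , others) → storeR i (reg s′ 16) (trans (regF g 9 refl) ri) refl tt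
          (λ u → update-extend (λ u d → Row u n d (arr s′ 3))
            (λ {v} v<i → subst (λ d → Row v n (d v) (arr s′ 3)) (sym (arrF g 2 refl)) (others v v<i)) row)))))
      where
      s₁ : State
      s₁ = setReg (setReg s 18 (i * n)) 16 0
      J′ : ℕ → State → Set
      J′ j s′ = Row i j (reg s′ 16) (arr s′ 3) × (∀ u → u < i → Row u n (arr s 2 u) (arr s′ 3))
      inner : ∀ j s′ → j < n → Frame rowP s₁ s′ → Small W s′ → reg s′ 17 ≡ j → J′ j s′ →
        Run _ s′ 6 (λ s″ → J′ (suc j) (setReg s″ 17 (suc j)))
      inner j s′ j<n g _ rj (row , others) =
        set (i * n + j) (cong₂ _+_ (regF g 18 refl) rj) (fits-cell i<n j<n)
        (set (bit (E i j)) (trans (cong (λ h → h (i * n + j)) (trans (arrF g 0 refl) (arrF f 0 refl))) (cell i<n j<n)) tt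
        (condR
          (λ e → set (i * n + reg s′ 16) (cong (_+ reg s′ 16) (regF g 18 refl)) (fits-cell i<n l<n)
            (put (i * n + reg s′ 16) j refl rj tt
            (assignR (reg s′ 16 + 1) refl (fits-next (<⇒≤ l<n))
              ( row-add j<n (bit-one (E i j) e) row
              , λ u u<i → row-keep i (reg s′ 16) j (<⇒≢ u<i) l<n (others u u<i)))))
          (λ e → skipR (row-skip (bit-other (E i j) e) row , others))))
        where
        l<n : reg s′ 16 < n
        l<n = ≤-<-trans (Row.l≤j row) j<n
        bit-one : ∀ b → (bit b ≡ᵇ 1) ≡ true → b ≡ true
        bit-one true _ = refl
        bit-other : ∀ b → (bit b ≡ᵇ 1) ≡ false → b ≡ false
        bit-other false _ = refl

  deleteTime : ℕ
  deleteTime = suc (suc (n * suc (4 + 1)))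

  delete-run : ∀ {s x} → Adjacent-lists s → reg s 2 ≡ x → x < n →
    Run deleteP s deleteTime (λ s′ → ∀ v → v < n → arr s′ 5 v ≡ deleted x v)
  delete-run {s₀} {x} adj r₂ x<n = forR n 4 (λ i s → ∀ v → v < i → arr s 5 v ≡ deleted x v) (fits-vertex ≤-refl)
    (λ s f → trans (regF f 0 refl) (Adjacency.size adj)) refl
    (λ i s i<n f _ ri j →
      set (i * n) (cong₂ _*_ ri (trans (regF f 0 refl) (Adjacency.size adj))) (fits-row i<n)
      (set (i * n + x) (cong (i * n +_) (trans (regF f 2 refl) r₂)) (fits-cell i<n x<n)
      (set (bit (E i x)) (trans (cong (λ g → g _) (arrF f 0 refl)) (Adjacency.cell adj i<n x<n)) tt
      (storeR i (bit (E i x)) ri refl tt (λ v → update-extend (λ v z → z ≡ deleted x v) (j _) refl)))))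
    (λ _ ()) (λ _ _ j → j)

  -- The running time of the forest routine does not depend on the deleted vertices.
  forestTime : ℕ
  forestTime = Growing.forestTime n E E-sym W big (λ _ → 0)

  treeTime : ℕ
  treeTime = forestTime + suc (suc (n * suc (2 + 1)))

  tree-run : ∀ {s} → Adjacent-lists s → (∀ v → v < n → arr s 5 v ≡ 0) →
    Run treeP s treeTime (λ s′ → ∃[ key ] ForestOf (λ _ → 0) key (arr s′ 4))
  tree-run {s₀} adj none = seqR (weaken ≤-refl
    (λ s₁ f _ F → forR n 2 (λ i s → ∀ v → v < i → arr s 4 v ≡ arr s₁ 7 v) (fits-vertex ≤-refl)
      (λ s g → trans (regF g 0 refl) (trans (regF f 0 refl) (Adjacency.size adj))) refl
      (λ i s i<n g _ ri j → set (arr s₁ 7 i) (cong₂ (λ h x → h x) (arrF g 7 refl) ri) tt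
        (storeR i (arr s₁ 7 i) ri refl tt (λ v → update-extend (λ v z → z ≡ arr s₁ 7 v) (j _) refl)))
      (λ _ ())
      (λ s g j → arr s₁ 6 , copy F j))
    (Growing.forest-run n E E-sym W big (λ _ → 0) adj none))
    where
    copy : ∀ {key p p′} → ForestOf (λ _ → 0) key p → (∀ v → v < n → p′ v ≡ p v) → ForestOf (λ _ → 0) key p′
    copy {key} {p} {p′} F e = record
      { parent = λ {v} v<n → subst (λ q → q ≡ v ⊎ (q < n × Live E (λ _ → 0) q v × key v ≡ suc (key q))) (sym (e v v<n)) (F.parent v<n)
      ; near   = F.near
      ; cut    = λ τ h → F.cut τ (λ v v<n → trans (cong τ (sym (e v v<n))) (h v v<n))
      }
      where module F = Forests.Forest F

  record Pair (p f : ℕ → ℕ) (x y r₂ r₃ : ℕ) (a₄ a₇ : ℕ → ℕ) : Set where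
    constructor pair
    field
      r₂≡ : r₂ ≡ x
      r₃≡ : r₃ ≡ y
      a₄≡ : ∀ {v} → v < n → a₄ v ≡ p v
      a₇≡ : ∀ {v} → v < n → a₇ v ≡ f v

  HasPair : (p f : ℕ → ℕ) (x y : ℕ) → State → Set
  HasPair p f x y s = Pair p f x y (reg s 2) (reg s 3) (arr s 4) (arr s 7)

  pairTime : ℕ
  pairTime = 4 + (tupleTime + (4 + (tupleTime + (4 + (tupleTime + (4 + (tupleTime + (4 + tupleTime))))))))

  pair-run : ∀ {p f x y s R} → (∀ {v} → v < n → p v < n) → (∀ {v} → v < n → f v < n) → x < n → y < n →
    Adjacent-lists s → HasPair p f x y s → StatusOf s R →
    Run pairP s pairTime (λ s′ → StatusOf s′ (R × Tried p f x y))
  pair-run {p} {f} {x} {y} {s} p<n f<n x<n y<n adj pr st =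
    set x (Pair.r₂≡ pr) tt (set (p x) (parent pr) tt (set y (Pair.r₃≡ pr) tt (set (p y) (parent₃ pr) tt
    (seqR (weaken ≤-refl (λ s₁ g₁ _ st₁ → let adj₁ = keep adj g₁ ; pr₁ = keepP pr g₁ in
      set x (Pair.r₂≡ pr₁) tt (set (p x) (parent pr₁) tt (set y (Pair.r₃≡ pr₁) tt (set (p y) (parent₃ pr₁) tt
    (seqR (weaken ≤-refl (λ s₂ g₂ _ st₂ → let adj₂ = keep adj₁ g₂ ; pr₂ = keepP pr₁ g₂ in
      set x (Pair.r₂≡ pr₂) tt (set (p x) (parent pr₂) tt (set y (Pair.r₃≡ pr₂) tt (set (f y) (forest₃ pr₂) tt
    (seqR (weaken ≤-refl (λ s₃ g₃ _ st₃ → let adj₃ = keep adj₂ g₃ ; pr₃ = keepP pr₂ g₃ in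
      set x (Pair.r₂≡ pr₃) tt (set (p x) (parent pr₃) tt (set y (Pair.r₃≡ pr₃) tt (set (f y) (forest₃ pr₃) tt
    (seqR (weaken ≤-refl (λ s₄ g₄ _ st₄ → let adj₄ = keep adj₃ g₄ ; pr₄ = keepP pr₃ g₄ in
      set (p x) (parent pr₄) tt (set (p (p x)) (Pair.a₄≡ pr₄ (p<n x<n)) tt (set y (Pair.r₃≡ pr₄) tt (set x (Pair.r₂≡ pr₄) tt
    (weaken ≤-refl (λ _ _ _ → map-status λ (((((r , t₁) , t₂) , t₃) , t₄) , t₅) → r , tried t₁ t₂ t₃ t₄ t₅)
      (tuple-run (p<n (p<n x<n)) (p<n x<n) y<n x<n adj₄ (tuple refl refl refl refl) st₄))))))
      (tuple-run (p<n x<n) x<n y<n (f<n y<n) adj₃ (tuple refl refl refl refl) st₃)))))))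
      (tuple-run (p<n x<n) x<n (f<n y<n) y<n adj₂ (tuple refl refl refl refl) st₂)))))))
      (tuple-run (p<n x<n) x<n y<n (p<n y<n) adj₁ (tuple refl refl refl refl) st₁)))))))
      (tuple-run (p<n x<n) x<n (p<n y<n) y<n adj (tuple refl refl refl refl) st))))))
    where
    keep : ∀ {s s′} → Adjacent-lists s → Frame tupleP s s′ → Adjacent-lists s′
    keep a g = keep-graph g a
    keepP : ∀ {s s′} → Pair p f x y (reg s 2) (reg s 3) (arr s 4) (arr s 7) → Frame tupleP s s′ → Pair p f x y (reg s′ 2) (reg s′ 3) (arr s′ 4) (arr s′ 7)
    keepP h g rewrite regF g 2 refl | regF g 3 refl | arrF g 4 refl | arrF g 7 refl = h
    parent : ∀ {r₂ r₃ a₄ a₇} → Pair p f x y r₂ r₃ a₄ a₇ → a₄ r₂ ≡ p x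
    parent (pair refl _ e _) = e x<n
    parent₃ : ∀ {r₂ r₃ a₄ a₇} → Pair p f x y r₂ r₃ a₄ a₇ → a₄ r₃ ≡ p y
    parent₃ (pair _ refl e _) = e y<n
    forest₃ : ∀ {r₂ r₃ a₄ a₇} → Pair p f x y r₂ r₃ a₄ a₇ → a₇ r₃ ≡ f y
    forest₃ (pair _ refl _ e) = e y<n

  columnsTime : ℕ
  columnsTime = suc (suc (n * suc (pairTime + 1)))

  vertexTime : ℕ
  vertexTime = deleteTime + (forestTime + columnsTime)

  searchTime : ℕ
  searchTime = neighboursTime + (treeTime + suc (suc (n * suc (vertexTime + 1))))

  TriedAt : (p : ℕ → ℕ) → ℕ → Set
  TriedAt p x = ∃[ k ] ∃[ f ] (ForestOf (deleted x) k f × (∀ y → y < n → Tried p f x y))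

  vertex-run : ∀ {p x s R} → (∀ {v} → v < n → p v < n) → x < n → Adjacent-lists s → reg s 2 ≡ x → arr s 4 ≡ p → StatusOf s R →
    Run vertexP s vertexTime (λ s′ → StatusOf s′ (R × TriedAt p x))
  vertex-run {p} {x} {s} {R} p<n x<n adj r₂ a₄ st =
    seqR (weaken ≤-refl (λ s₁ f₁ _ ex≡ →
      let adj₁ = keep-graph f₁ adj in
    seqR (weaken ≤-refl (λ s₂ f₂ _ F →
      let adj₂ = keep-graph f₂ adj₁
          f    = arr s₂ 7
      in forR n pairTime (λ y s₃ → StatusOf s₃ (R × (∀ y′ → y′ < y → Tried p f x y′))) (fits-vertex ≤-refl)
        (λ s₃ g → trans (regF g 0 refl) (Adjacency.size adj₂)) refl
        (λ y s₃ y<n g _ ry st₃ → weaken ≤-refl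
          (λ _ _ _ → map-status λ ((r , before) , now) → r , below-suc {Tried p f x} before now)
          (pair-run {p} {f} {x} {y} p<n (forest<n F) x<n y<n (keep-graph g adj₂)
            (pair (trans (regF g 2 refl) (trans (regF f₂ 2 refl) (trans (regF f₁ 2 refl) r₂))) ry
              (λ {v} _ → cong (λ h → h v) (trans (arrF g 4 refl) (trans (arrF f₂ 4 refl) (trans (arrF f₁ 4 refl) a₄))))
              (λ {v} _ → cong (λ h → h v) (arrF g 7 refl)))
            st₃))
        (subst₂ (λ r a → Status r a (R × (∀ y′ → y′ < 0 → Tried p f x y′)))
          (sym (trans (regF f₂ 1 refl) (regF f₁ 1 refl))) (sym (trans (arrF f₂ 1 refl) (arrF f₁ 1 refl)))
          (map-status (λ r → r , λ _ ()) st))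
        (λ s₃ _ → map-status λ (r , t) → r , (arr s₂ 6 , f , F , t)))
      (Growing.forest-run n E E-sym W big (deleted x) adj₁ ex≡)))
      (delete-run adj r₂ x<n))
    where
    forest<n : ∀ {k f v} → ForestOf (deleted x) k f → v < n → f v < n
    forest<n F v<n with Forests.Forest.parent F v<n
    ... | inj₁ e = subst (_< n) (sym e) v<n
    ... | inj₂ (f< , _) = f<

  search-run : ∀ {s} → reg s 0 ≡ n → reg s 1 ≡ 0 → (∀ {u v} → u < n → v < n → arr s 0 (u * n + v) ≡ bit (E u v)) →
    (∀ v → v < n → arr s 5 v ≡ 0) →
    Run searchP s searchTime (λ s′ → StatusOf s′ (∀ σ α β a₁ a₂ b₁ b₂ → Compatible σ α β a₁ a₂ b₁ b₂ → ⊥))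
  search-run {s} r₀ r₁ cell none =
    seqR (weaken ≤-refl (λ s₁ f₁ _ adj₁ →
    seqR (weaken ≤-refl (λ s₂ f₂ _ (key , tree) →
      let adj₂ = keep-graph f₂ adj₁
          p    = arr s₂ 4
      in forR n vertexTime (λ x s₃ → StatusOf s₃ (∀ x′ → x′ < x → TriedAt p x′)) (fits-vertex ≤-refl)
        (λ s₃ g → trans (regF g 0 refl) (Adjacency.size adj₂)) refl
        (λ x s₃ x<n g _ rx st₃ → weaken ≤-refl
          (λ _ _ _ → map-status λ (before , now) → below-suc {TriedAt p} before now)
          (vertex-run {p} (p<n tree) x<n (keep-graph g adj₂) rx (arrF g 4 refl) st₃))
        (absent (trans (regF f₂ 1 refl) (trans (regF f₁ 1 refl) r₁)) λ _ ())
        (λ s₃ _ → map-status λ all _ _ _ _ _ _ _ → exhaustive tree all))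
      (tree-run adj₁ (λ v v<n → trans (cong (λ h → h v) (arrF f₁ 5 refl)) (none v v<n)))))
      (neighbours-run r₀ cell))

  -- The constant is 16 + 52 + 3083 + 6470 + 1600, the sum of the coefficients of the exact running
  -- time, each monomial being at most n²D. The leading 1600 is 5 tuples times 10 attempts times the
  -- 32 of `closureTime`.
  searchTime≤ : 1 ≤ edgeEnds → n ≤ edgeEnds → searchTime + 2 ≤ 11221 * (n * n * edgeEnds)
  searchTime≤ 1≤D n≤D = begin
    searchTime + 2
      ≡⟨ cong total pair≡ ⟩
    total (20 + 5 * (30 + 10 * (57 + 129 * n + 32 * D)))
      ≡⟨ expand n D ⟩
    16 + 52 * n + 3083 * (n * n) + 6470 * (n * n * n) + 1600 * (n * n * D)
      ≤⟨ +-monoˡ-≤ (1600 * X) (+-mono-≤ (+-mono-≤ (+-mono-≤ (*-monoʳ-≤ 16 1≤X) (*-monoʳ-≤ 52 n≤X)) (*-monoʳ-≤ 3083 n²≤X)) (*-monoʳ-≤ 6470 (*-monoʳ-≤ (n * n) n≤D))) ⟩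
    16 * X + 52 * X + 3083 * X + 6470 * X + 1600 * X
      ≡⟨ collect 16 52 3083 6470 1600 X ⟩
    11221 * X ∎
    where
    open ≤-Reasoning
    D = edgeEnds
    X = n * n * D
    1≤n : 1 ≤ n
    1≤n = ≤-trans (s≤s z≤n) 5<n
    n²≤X : n * n ≤ X
    n²≤X = ≤-trans (≤-reflexive (sym (*-identityʳ (n * n)))) (*-monoʳ-≤ (n * n) 1≤D)
    n≤X : n ≤ X
    n≤X = ≤-trans (≤-trans (≤-reflexive (sym (*-identityʳ n))) (*-monoʳ-≤ n 1≤n)) n²≤X
    1≤X : 1 ≤ X
    1≤X = ≤-trans 1≤n n≤X
    total : ℕ → ℕ
    total q = neighboursTime + (treeTime +
      suc (suc (n * suc ((deleteTime + (forestTime + suc (suc (n * suc (q + 1))))) + 1)))) + 2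
    attempt≡ : ∀ n D → suc (42 + 124 * n + 32 * D + (11 + (suc (suc (n * 5)) + 1))) ≡ 57 + 129 * n + 32 * D
    attempt≡ = solve-∀
    tuple≡ : ∀ a → suc (suc (5 * suc (a + 1))) + (6 + suc (suc (5 * suc (a + 1)))) ≡ 30 + 10 * a
    tuple≡ = solve-∀
    tuples≡ : ∀ t → 4 + (t + (4 + (t + (4 + (t + (4 + (t + (4 + t)))))))) ≡ 20 + 5 * t
    tuples≡ = solve-∀
    pair≡ : pairTime ≡ 20 + 5 * (30 + 10 * (57 + 129 * n + 32 * D))
    pair≡ = trans (tuples≡ tupleTime) (cong (λ t → 20 + 5 * t) (trans (tuple≡ attemptTime) (cong (λ a → 30 + 10 * a) (attempt≡ n D))))
    expand : ∀ n D →
      suc (suc (n * suc (2 + (suc (suc (n * 8)) + 1) + 1))) +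
      (suc (suc (suc (n * 5)) + (4 + n * 8 + suc (n * suc (3 + (4 + (suc (suc (n * 12)) + (4 + n * 8))))))) + suc (suc (n * 4)) +
       suc (suc (n * suc (suc (suc (n * 6)) +
         (suc (suc (suc (n * 5)) + (4 + n * 8 + suc (n * suc (3 + (4 + (suc (suc (n * 12)) + (4 + n * 8))))))) +
          suc (suc (n * suc (20 + 5 * (30 + 10 * (57 + 129 * n + 32 * D)) + 1)))) + 1)))) + 2
      ≡ 16 + 52 * n + 3083 * (n * n) + 6470 * (n * n * n) + 1600 * (n * n * D)
    expand = solve-∀
    collect : ∀ a b c d e X → a * X + b * X + c * X + d * X + e * X ≡ (a + b + c + d + e) * X
    collect = solve-∀

-- Word size, small graphs and the final time bound

small-input : ∀ {n} (G : Graph n) {W} → n < W → 1 < W → Small W (input G)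
small-input {n} G {W} n<W 1<W = small registers arrays
  where
  0<W : 0 < W
  0<W = <-trans (s≤s z≤n) 1<W
  registers : ∀ x → reg (input G) x < W
  registers zero    = n<W
  registers (suc _) = 0<W
  arrays : ∀ r i → arr (input G) r i < W
  arrays (suc _) i = 0<W
  arrays zero i with i <? n * n
  ... | yes _ = ≤-<-trans (bit≤1 _) 1<W
  ... | no  _ = 0<W

-- One constant serves as summand and as exponent. With 2 the word range would be n² + 4n + 4, which
-- is too small; with 3 already the square n² + 6n + 9 suffices.
word-size : ∀ n → n * n + (5 * n + 9) ≤ (n + 3) ^ 3
word-size n = begin
  n * n + (5 * n + 9)             ≤⟨ m≤m+n _ n ⟩
  n * n + (5 * n + 9) + n         ≡⟨ square n ⟩
  (n + 3) * (n + 3)               ≤⟨ *-monoʳ-≤ (n + 3) (≤-trans (≤-reflexive (sym (*-identityʳ (n + 3)))) (*-monoʳ-≤ (n + 3) (≤-trans (s≤s z≤n) (m≤n+m 3 n)))) ⟩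
  (n + 3) * ((n + 3) * (n + 3))   ≡⟨ cong (λ z → (n + 3) * ((n + 3) * z)) (sym (*-identityʳ (n + 3))) ⟩
  (n + 3) ^ 3                     ∎
  where
  open ≤-Reasoning
  square : ∀ n → n * n + (5 * n + 9) + n ≡ (n + 3) * (n + 3)
  square = solve-∀

too-small : ∀ {n} (G : Graph n) → n ≤ 5 → ∀ X₁ X₂ → ¬ Is2Join G X₁ X₂
too-small {n} G n≤5 X₁ X₂ J with OnNaturals.fromJoin G J
... | σ , _ , _ , _ , _ , _ , _ , cp =
  <⇒≱ (s≤s n≤5) (≤-trans (+-mono-≤ (Compatible.size₁ cp) (Compatible.size₂ cp)) (≤-reflexive (count-not n σ)))
  where open Joins n (OnNaturals.E G) (OnNaturals.E-sym G)

twoJoin-run : ∀ n (G : Graph n) → Connected G →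
  ∃[ s ] ∃[ t ] (((n + 3) ^ 3 ⊢ twoJoinP , input G ⇓ s ∥ t) × t ≤ 22442 * (1 + n ^ 2 * ∣E G ∣) × CorrectAnswer G s)
twoJoin-run n G conn = run (5 <? n) sm
  where
  open OnNaturals G
  open Setting n E E-sym ((n + 3) ^ 3) (word-size n)
  open Joins n E E-sym
  -- Twice the constant of `searchTime≤`, because `handshake` bounds the degree sum by twice the
  -- number of edges. The summand 1 pays for graphs with at most five vertices, possibly without
  -- edges.
  bound = 22442 * (1 + n ^ 2 * ∣E G ∣)
  sm : Small ((n + 3) ^ 3) (input G)
  sm = small-input G (fits-vertex ≤-refl) (fits-small 1 ≤-refl)
  three≤bound : 3 ≤ bound
  three≤bound = ≤-trans (m≤m+n 3 22439) (≤-trans (≤-reflexive (sym (*-identityʳ 22442))) (*-monoʳ-≤ 22442 (s≤s z≤n)))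
  module Large (5<n : 5 < n) where
    open Search n E E-sym ((n + 3) ^ 3) (word-size n) 5<n (connected conn)
    open Tuples n E E-sym ((n + 3) ^ 3) (word-size n) 5<n
    n≤D : n ≤ edgeEnds
    n≤D = n≤degree-sum conn (≤-trans (s≤s (s≤s z≤n)) 5<n)
    time≤ : suc searchTime + 1 ≤ bound
    time≤ = begin
      suc searchTime + 1                  ≡⟨ sym (+-suc searchTime 1) ⟩
      searchTime + 2                      ≤⟨ searchTime≤ (≤-trans (≤-trans (s≤s z≤n) 5<n) n≤D) n≤D ⟩
      11221 * (n * n * edgeEnds)          ≤⟨ *-monoʳ-≤ 11221 (*-monoʳ-≤ (n * n) handshake) ⟩
      11221 * (n * n * (2 * ∣E G ∣))      ≡⟨ arrange 11221 n ∣E G ∣ ⟩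
      22442 * (n * (n * 1) * ∣E G ∣)      ≤⟨ *-monoʳ-≤ 22442 (m≤n+m _ 1) ⟩
      bound                               ∎
      where
      open ≤-Reasoning
      arrange : ∀ c n m → c * (n * n * (2 * m)) ≡ (2 * c) * (n * (n * 1) * m)
      arrange = solve-∀
    answer : ∀ {s} → StatusOf s (∀ σ α β a₁ a₂ b₁ b₂ → Compatible σ α β a₁ a₂ b₁ b₂ → ⊥) →
      Run (0 ≔ atom (var 1)) s 1 (CorrectAnswer G)
    answer {s} (found e (_ , _ , _ , _ , _ , _ , _ , cp , lab)) =
      assignR 1 e tt (inj₁ (refl , labelled-join (setReg s 0 1) cp lab))
    answer (absent e r) = assignR 0 e tt (inj₂ (refl , λ X₁ X₂ J → let (σ , α , β , a₁ , a₂ , b₁ , b₂ , cp) = fromJoin J in r σ α β a₁ a₂ b₁ b₂ cp))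
  run : Dec (5 < n) → Run twoJoinP (input G) bound (CorrectAnswer G)
  run (yes 5<n) = within (Large.time≤ 5<n) (seqR (condR
    (λ _ → weaken ≤-refl (λ _ _ _ → Large.answer 5<n)
      (Search.search-run n E E-sym ((n + 3) ^ 3) (word-size n) 5<n (connected conn) refl refl matrix-cell (λ _ _ → refl)))
    (λ n≤5 → ⊥-elim (<⇒≱ 5<n (<ᵇ-false {5} n≤5)))))
  run (no 5≮n) = within three≤bound (seqR {B = 2} (condR
    (λ 5<n → ⊥-elim (5≮n (<ᵇ-true {5} 5<n)))
    (λ _ → skipR (assignR 0 refl tt (inj₂ (refl , too-small G (≮⇒≥ 5≮n)))))))

theorem3p2 : ∃[ p ] ∃[ c ] ∃[ k ]
    (∀ (n : ℕ) (G : Graph n) → Connected G →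
    ∃[ s ] ∃[ t ]
    ((n + k) ^ k ⊢ p , input G ⇓ s ∥ t
    × t ≤ c * (1 + n ^ 2 * ∣E G ∣)
    × CorrectAnswer G s))
theorem3p2 = twoJoinP , 22442 , 3 , twoJoin-run
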